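{- There is an algorithm that, given a set of $n$ unit-length jobs with precedence constraints and a number $m$ of identical parallel machines, computes the minimum makespan of a feasible schedule (i.e., solves $Pm\,|\,\mathrm{prec},p_j=1\,|\,C_{\max}$) in time $\left(1+\frac{n}{m}\right)^{\mathcal{O}(\sqrt{nm})}$.
   Context: Problem $Pm\,|\,\mathrm{prec},p_j=1\,|\,C_{\max}$: the input is a finite set $V$ of $n$ jobs, each of unit length, a number $m$ of identical machines, and a strict partial order $\prec$ on $V$ (the precedence constraints, given as a transitively closed directed acyclic graph $G=(V,A)$ with $(v,w)\in A$ iff $v\prec w$). A feasible schedule of makespan $M$ is a sequence $(T_1,\dots,T_M)$ of pairwise disjoint subsets of $V$ (timeslots) such that (i) $\bigcup_{i=1}^M T_i=V$, (ii) $|T_i|\le m$ for every $i$, and (iii) if $u\in T_i$, $v\in T_j$ and $u\prec v$, then $i<j$. The goal is to minimize the makespan $M$. In the running time, the constant hidden in $\mathcal{O}(\cdot)$ is absolute, i.e., independent of both $n$ and $m$.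
   Formalization: For m > n the running time is bounded only up to a factor polynomial in n, since for fixed n the stated bound tends to 1 as m grows and no algorithm can meet it; for 1 ≤ m ≤ n the bound is proved exactly as stated, on a unit-cost random access machine with addition and subtraction. -}

module Defs where

open import Data.Bool.Base using (if_then_else_)
open import Data.Fin.Base using (Fin; fromℕ<; remQuot; _<_)
open import Data.Fin.Subset using (Subset; _∈_; _∩_; Empty; ∣_∣)
open import Data.Nat.Base as ℕ using (ℕ; suc; _+_; _*_; _∸_; _^_; _≤_; NonZero)
open import Data.Nat.Properties using (_≟_; _<?_)
open import Data.Product.Base using (_×_; _,_; ∃-syntax)
open import Level using (0ℓ)
open import Relation.Binary.Core using (Rel)
open import Relation.Binary.PropositionalEquality.Core using (_≡_; _≢_)
open import Relation.Binary.Structures using (IsDecStrictPartialOrder)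
open import Relation.Nullary.Decidable.Core using (does; yes; no)

------------------------------------------------------------------------
-- The scheduling problem Pm | prec, pⱼ = 1 | Cmax

-- The order is decidable because the precedence graph is finite input data.

record Instance : Set₁ where
  infix 4 _≺_
  field
    jobs       : ℕ
    machines   : ℕ
    machines≢0 : NonZero machines
    _≺_        : Rel (Fin jobs) 0ℓ
    isOrder    : IsDecStrictPartialOrder _≡_ _≺_

  open IsDecStrictPartialOrder isOrder public using () renaming (_<?_ to _≺?_)

record IsFeasible (I : Instance) {M : ℕ}
                  (T : Fin M → Subset (Instance.jobs I)) : Set where
  open Instance I
  field
    disjoint   : ∀ i j → i ≢ j → Empty (T i ∩ T j)
    covering   : ∀ v → ∃[ i ] v ∈ T i
    capacity   : ∀ i → ∣ T i ∣ ≤ machines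
    precedence : ∀ {u v i j} → u ∈ T i → v ∈ T j → u ≺ v → i < j

HasSchedule : Instance → ℕ → Set
HasSchedule I M = ∃[ T ] IsFeasible I {M} T

IsMinimumMakespan : Instance → ℕ → Set
IsMinimumMakespan I M = HasSchedule I M × (∀ M′ → HasSchedule I M′ → M ≤ M′)

------------------------------------------------------------------------
-- Random access machines

-- Structured programs over registers and an indirectly addressed memory,
-- all holding natural numbers.  Every instruction and every test takes one
-- unit of time.  Arithmetic is limited to addition and truncated
-- subtraction: unit-cost multiplication of unbounded numbers would make the
-- machine unreasonably powerful, whereas this one is polynomially
-- equivalent to Turing machines.

Reg : Set
Reg = ℕ

infix  6 _⟵_ [_]⟵_
infixr 5 _⨾_

data Expr : Set where
  const : ℕ → Expr
  reg   : Reg → Expr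
  _⊕_   : Reg → Reg → Expr
  _⊖_   : Reg → Reg → Expr
  load  : Reg → Expr

data Program : Set where
  skip         : Program
  _⟵_          : Reg → Expr → Program
  [_]⟵_        : Reg → Reg → Program
  _⨾_          : Program → Program → Program
  ifNonZero    : Reg → Program → Program → Program
  whileNonZero : Reg → Program → Program

record State : Set where
  constructor ⟪_,_⟫
  field
    regs : ℕ → ℕ
    mem  : ℕ → ℕ

open State public

_[_↦_] : (ℕ → ℕ) → ℕ → ℕ → (ℕ → ℕ)
(f [ k ↦ v ]) j = if does (j ≟ k) then v else f j

eval : State → Expr → ℕ
eval σ (const k) = k
eval σ (reg r)   = regs σ r
eval σ (r ⊕ s)   = regs σ r + regs σ s
eval σ (r ⊖ s)   = regs σ r ∸ regs σ s
eval σ (load r)  = mem σ (regs σ r)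

-- ⟨ P , σ ⟩⇓⟨ τ , t ⟩: started in σ, P halts in τ after exactly t steps.

infix 4 ⟨_,_⟩⇓⟨_,_⟩

data ⟨_,_⟩⇓⟨_,_⟩ : Program → State → State → ℕ → Set where
  skip : ∀ {σ} → ⟨ skip , σ ⟩⇓⟨ σ , 1 ⟩

  assign : ∀ {σ r e} →
    ⟨ r ⟵ e , σ ⟩⇓⟨ ⟪ regs σ [ r ↦ eval σ e ] , mem σ ⟫ , 1 ⟩

  store : ∀ {σ r s} →
    ⟨ [ r ]⟵ s , σ ⟩⇓⟨ ⟪ regs σ , mem σ [ regs σ r ↦ regs σ s ] ⟫ , 1 ⟩

  seq : ∀ {P Q σ τ υ s t} →
    ⟨ P , σ ⟩⇓⟨ τ , s ⟩ → ⟨ Q , τ ⟩⇓⟨ υ , t ⟩ →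
    ⟨ P ⨾ Q , σ ⟩⇓⟨ υ , s + t ⟩

  if-nonzero : ∀ {r P Q σ τ t} → regs σ r ≢ 0 →
    ⟨ P , σ ⟩⇓⟨ τ , t ⟩ →
    ⟨ ifNonZero r P Q , σ ⟩⇓⟨ τ , suc t ⟩

  if-zero : ∀ {r P Q σ τ t} → regs σ r ≡ 0 →
    ⟨ Q , σ ⟩⇓⟨ τ , t ⟩ →
    ⟨ ifNonZero r P Q , σ ⟩⇓⟨ τ , suc t ⟩

  while-nonzero : ∀ {r P σ τ υ s t} → regs σ r ≢ 0 →
    ⟨ P , σ ⟩⇓⟨ τ , s ⟩ → ⟨ whileNonZero r P , τ ⟩⇓⟨ υ , t ⟩ →
    ⟨ whileNonZero r P , σ ⟩⇓⟨ υ , suc (s + t) ⟩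

  while-zero : ∀ {r P σ} → regs σ r ≡ 0 →
    ⟨ whileNonZero r P , σ ⟩⇓⟨ σ , 1 ⟩

-- Registers 0 and 1 hold the numbers n of jobs and m of machines, memory
-- cells 0, …, n * n - 1 hold the adjacency matrix of ≺ (cell u * n + v is 1
-- if u ≺ v and 0 otherwise), and everything else is 0.

module _ (I : Instance) where
  open Instance I

  inputRegs : ℕ → ℕ
  inputRegs 0             = jobs
  inputRegs 1             = machines
  inputRegs (suc (suc _)) = 0

  adjacency : Fin jobs × Fin jobs → ℕ
  adjacency (u , v) = if does (u ≺? v) then 1 else 0

  inputMem : ℕ → ℕ
  inputMem a with a <? jobs * jobs
  ... | yes a<n² = adjacency (remQuot jobs (fromℕ< a<n²))
  ... | no  _    = 0

  input : State
  input = ⟪ inputRegs , inputMem ⟫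

output : State → ℕ
output σ = regs σ 0

------------------------------------------------------------------------
-- Running times

-- t ≤ K · (1 + n/m)^(C · √(n·m)) over the reals, for m ≥ 1.  As the base is
-- at least 1, this holds iff t ≤ K · (1 + n/m)^(p/q) for every rational
-- p/q ≥ C · √(n·m); raising to the power q and clearing denominators gives
-- the inequality between natural numbers below.

TimeBound : (K C n m t : ℕ) → Set
TimeBound K C n m t =
  ∀ p q → NonZero q → C ^ 2 * (n * m) * q ^ 2 ≤ p ^ 2 →
  t ^ q * m ^ p ≤ K ^ q * (m + n) ^ p

-- The bound (1 + n/m)^O(√(nm)) presupposes 1 ≤ m ≤ n: for fixed n it tends
-- to 1 as m grows, so no algorithm can meet it for all m.  When m exceeds n
-- it is read up to a factor polynomial in n; for m ≤ n such a factor would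
-- be absorbed by the constant in the exponent.

RunsInTime : (C n m t : ℕ) → Set
RunsInTime C n m t =
  (m ≤ n → TimeBound 1 C n m t) ×
  (n ℕ.< m → TimeBound (C * suc n ^ C) C n m t)

{-# OPTIONS --safe #-}

-- Delaying maximal jobs never hurts, so by Dolev and Warmuth some optimal
-- schedule of a set X of jobs starts with slots of m non-maximal jobs each,
-- up to a slot that holds the set A of all non-maximal jobs then available,
-- with |A| < m.  The non-maximal jobs of earlier slots form a set Y, all
-- other non-maximal jobs lie in A or in the set U of jobs above A, and the
-- maximal jobs outside U fill the idle machines.  Hence the minimum makespan
-- f satisfies f X = min_A (f Y + max ⌈(|X| − |Y|) / m⌉ (1 + f U)).
--
-- Every set met by this recursion is E ∩ S, where S is everything or all jobs
-- above some A, and E is a down-set that loses its maximal jobs and the jobs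
-- from some A on whenever the recursion passes to Y.  Let s = ⌊√(nm)⌋.  If
-- E ∩ S has at most s maximal jobs then E may be replaced by the down-set
-- they generate; otherwise E loses more than s jobs, which can happen at most
-- n / s times in a row.  With (1 + n/m)^O(m) choices of A and
-- (1 + n/m)^O(s) choices of s jobs, only (1 + n/m)^O(s) sets are met.
--
-- The program collects these sets in a queue and improves upper bounds for
-- f, initially |X|, in n + 1 sweeps; after sweep r the bounds of all sets of
-- fewer than r jobs are exact.  For m > n it only tries A = ∅, which suffices
-- as then f is the height of the order.

module Submission where

open import Defs
open import Data.Bool.Base using (Bool; true; false; T; not; _∨_; if_then_else_)
import Data.Bool.Properties as Boolₚ
open import Data.Empty using (⊥-elim)
open import Data.Fin.Base as Fin using (Fin; zero; suc; toℕ; fromℕ<)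
open import Data.Fin.Induction using (spo-wellFounded; spo-noetherian)
import Data.Fin.Properties as Finₚ
open import Data.Fin.Subset as Subset
  using (Subset; _∈_; _∉_; _⊆_; _∪_; _─_; _-_; ⊥; ⊤; ⁅_⁆; ∣_∣; Nonempty; Empty)
open import Data.Fin.Subset.Properties renaming (x∈p∪q⁻ to ∈-∪⁻)
open import Data.List.Base as List using (List; []; _∷_; _++_; length)
open import Data.List.Membership.Propositional using () renaming (_∈_ to _∈ₗ_)
open import Data.List.Membership.Propositional.Properties
  using (∈-map⁺; ∈-map⁻; ∈-++⁺ˡ; ∈-++⁺ʳ; ∈-++⁻; ∈-∃++; ∈-filter⁺; ∈-filter⁻;
         ∈-applyUpTo⁺; ∈-cartesianProductWith⁺)
import Data.List.Properties as Listₚ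
import Data.List.Relation.Unary.All as All
open import Data.List.Relation.Unary.AllPairs using ([]; _∷_)
import Data.List.Relation.Unary.Any as Any
open import Data.List.Relation.Unary.Unique.Propositional using (Unique)
import Data.List.Relation.Unary.Unique.Propositional.Properties as Uniqueₚ
open import Data.Nat.Base hiding (∣_-_∣)
open import Data.Nat.DivMod using (_/_; m/n*n≤m; m*n/n≡m; /-monoˡ-≤)
open import Data.Nat.Properties
open import Data.Nat.Tactic.RingSolver using (solve-∀)
open import Data.Product.Base using (_×_; _,_; proj₁; proj₂; ∃-syntax; Σ-syntax)
open import Data.Sum.Base using (_⊎_; inj₁; inj₂)
open import Data.Unit.Base using (tt)
open import Data.Vec.Base as Vec using (Vec; []; _∷_; here; there)
import Data.Vec.Properties as Vecₚ
open import Function.Base using (_∘_; _$_; case_of_)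
open import Induction.WellFounded using (Acc; acc)
open import Relation.Binary.PropositionalEquality hiding (J)
open import Relation.Binary.Structures using (IsDecStrictPartialOrder)
open import Relation.Nullary using (¬_; Dec; yes; no; does)
open import Relation.Nullary.Decidable
  using (_×-dec_; _⊎-dec_; ¬?; dec-true; dec-false; decidable-stable)

-- Programs with time bounds

-- The choice of `s` is a balance. A set is described by a starting down-set, which costs an
-- exponent O(s), and by the sets A of the passages to Y made since, at most about n / s times an
-- exponent O(m); the two costs s and mn / s agree near √(nm). Passages to U do not lengthen the
-- description, as they replace S and leave E alone. The obstacle for a program is that these sets
-- are not known beforehand, while the recursion reaches the same set along many paths. So the table
-- is addressed by codes and has 2 ^ n cells. These cost no time: memory is 0 at the start, only
-- cells of sets that are met are touched, and the number 2 ^ n itself takes n doublings. Sweeps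
-- stand in for recursion. As the value of a set depends on strictly smaller sets only, no order of
-- evaluation has to be found, at the price of a factor n + 1. Constants and polynomial factors
-- disappear in the exponent because 1 + n/m is at least 2 for m ≤ n. For m > n this fails, and the
-- same running time has to be read as a polynomial in n instead.

infixl 6 _⊞_
infixl 7 _⊠_

-- Costs are kept as syntax because `cost main` is read in two ways: through `exponent` for m ≤ n,
-- and through `coefficient` and `degree` for m > n. Here `sets` bounds the length of the queue and
-- `lists` the number of sets A.
data Cost : Set where
  con : ℕ → Cost
  jobs sets lists : Cost
  _⊞_ _⊠_ : Cost → Cost → Cost

record Sizes : Set where
  constructor sizes
  field
    #jobs #sets #lists : ℕ

open Sizes public

⟦_⟧ : Cost → Sizes → ℕ
⟦ con k ⟧ ρ = k
⟦ jobs ⟧ ρ  = #jobs ρ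
⟦ sets ⟧ ρ  = #sets ρ
⟦ lists ⟧ ρ = #lists ρ
⟦ c ⊞ d ⟧ ρ = ⟦ c ⟧ ρ + ⟦ d ⟧ ρ
⟦ c ⊠ d ⟧ ρ = ⟦ c ⟧ ρ * ⟦ d ⟧ ρ

infix  6 _≔_ [_]≔_
infixr 5 _▸_

-- Programs whose loops carry a bound on their number of iterations, so that
-- a running time can be read off the syntax.

data Cmd : Set where
  nop   : Cmd
  _≔_   : Reg → Expr → Cmd
  [_]≔_ : Reg → Reg → Cmd
  _▸_   : Cmd → Cmd → Cmd
  cond  : Reg → Cmd → Cmd → Cmd
  loop  : Cost → Reg → Cmd → Cmd

erase : Cmd → Program
erase nop          = skip
erase (r ≔ e)      = r ⟵ e
erase ([ r ]≔ s)   = [ r ]⟵ s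
erase (c ▸ d)      = erase c ⨾ erase d
erase (cond r c d) = ifNonZero r (erase c) (erase d)
erase (loop _ r c) = whileNonZero r (erase c)

cost : Cmd → Cost
cost nop          = con 1
cost (r ≔ e)      = con 1
cost ([ r ]≔ s)   = con 1
cost (c ▸ d)      = cost c ⊞ cost d
-- The sum of both branches replaces their maximum, so that costs are built from sums and products
-- alone.
cost (cond r c d) = con 1 ⊞ (cost c ⊞ cost d)
cost (loop b r c) = con 1 ⊞ b ⊠ (con 1 ⊞ cost c)

writes : Cmd → Reg → Bool
writes nop          s = false
writes (r ≔ e)      s = s ≡ᵇ r
writes ([ r ]≔ _)   s = false
writes (c ▸ d)      s = writes c s ∨ writes d s
writes (cond r c d) s = writes c s ∨ writes d s
writes (loop b r c) s = writes c s

stores : Cmd → Bool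
stores nop          = false
stores (r ≔ e)      = false
stores ([ r ]≔ _)   = true
stores (c ▸ d)      = stores c ∨ stores d
stores (cond r c d) = stores c ∨ stores d
stores (loop b r c) = stores c

record Frame (c : Cmd) (σ τ : State) : Set where
  field
    kept    : ∀ r → writes c r ≡ false → regs τ r ≡ regs σ r
    keptMem : stores c ≡ false → mem τ ≡ mem σ

open Frame public

-- For a concrete command and register the hidden last argument computes to the unit type and is
-- filled in by type checking, so a fact about a register survives a command without further proof.
carry : ∀ {c σ τ} → Frame c σ τ → ∀ r {x} {_ : T (not (writes c r))} → regs σ r ≡ x → regs τ r ≡ x
carry {c} f r {_} {w} eq = trans (kept f r (not-T w)) eq
  where
  not-T : ∀ {b} → T (not b) → b ≡ false
  not-T {false} _ = refl

frame-refl : ∀ {c σ} → Frame c σ σ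
frame-refl = record { kept = λ _ _ → refl ; keptMem = λ _ → refl }

frame-trans : ∀ {c σ τ υ} → Frame c σ τ → Frame c τ υ → Frame c σ υ
frame-trans f g = record
  { kept    = λ r p → trans (kept g r p) (kept f r p)
  ; keptMem = λ p → trans (keptMem g p) (keptMem f p) }

∨-falseˡ : ∀ {a b} → a ∨ b ≡ false → a ≡ false
∨-falseˡ {false} p = refl

∨-falseʳ : ∀ {a b} → a ∨ b ≡ false → b ≡ false
∨-falseʳ {false} p = p

≡ᵇ-refl : ∀ k → (k ≡ᵇ k) ≡ true
≡ᵇ-refl zero    = refl
≡ᵇ-refl (suc k) = ≡ᵇ-refl k

update-other : ∀ (f : ℕ → ℕ) {k v j} → j ≢ k → (f [ k ↦ v ]) j ≡ f j
update-other f {k} {v} {j} j≢k with j ≡ᵇ k in eq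
... | true  = ⊥-elim (j≢k (≡ᵇ⇒≡ j k (subst T (sym eq) tt)))
... | false = refl

update-same : ∀ (f : ℕ → ℕ) k {v} → (f [ k ↦ v ]) k ≡ v
update-same f k rewrite ≡ᵇ-refl k = refl

frame : ∀ c {σ τ t} → ⟨ erase c , σ ⟩⇓⟨ τ , t ⟩ → Frame c σ τ
frame nop skip = frame-refl
frame (r ≔ e) {σ} assign = record
  { kept    = λ s p → update-other (regs σ) λ { refl → case trans (sym p) (≡ᵇ-refl r) of λ () }
  ; keptMem = λ _ → refl }
frame ([ r ]≔ s) store = record { kept = λ _ _ → refl ; keptMem = λ () }
frame (c ▸ d) (seq p q) = frame-trans
  (record { kept    = λ r w → kept (frame c p) r (∨-falseˡ w)
          ; keptMem = λ w → keptMem (frame c p) (∨-falseˡ w) })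
  (record { kept    = λ r w → kept (frame d q) r (∨-falseʳ {writes c r} w)
          ; keptMem = λ w → keptMem (frame d q) (∨-falseʳ {stores c} w) })
frame (cond r c d) (if-nonzero _ p) = record
  { kept    = λ r w → kept (frame c p) r (∨-falseˡ w)
  ; keptMem = λ w → keptMem (frame c p) (∨-falseˡ w) }
frame (cond r c d) (if-zero _ p) = record
  { kept    = λ r w → kept (frame d p) r (∨-falseʳ {writes c r} w)
  ; keptMem = λ w → keptMem (frame d p) (∨-falseʳ {stores c} w) }
frame (loop b r c) (while-nonzero _ p q) =
  frame-trans (frame-loop (frame c p)) (frame (loop b r c) q)
  where
  frame-loop : ∀ {σ τ} → Frame c σ τ → Frame (loop b r c) σ τ
  frame-loop f = record { kept = kept f ; keptMem = keptMem f }
frame (loop b r c) (while-zero _) = frame-refl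

-- Rules for total correctness within a time bound

module Logic (ρ : Sizes) where

  -- A total correctness triple. The time bound is no parameter but is read off the annotated
  -- command, so specifications speak of values only.
  record Run (c : Cmd) (σ : State) (Q : State → Set) : Set where
    constructor run
    field
      {final}    : State
      {time}     : ℕ
      executes   : ⟨ erase c , σ ⟩⇓⟨ final , time ⟩
      time-bound : time ≤ ⟦ cost c ⟧ ρ
      post       : Q final

  open Run public

  weaken : ∀ {c σ Q R} → Run c σ Q → (∀ {τ} → Frame c σ τ → Q τ → R τ) → Run c σ R
  weaken {c} r f = run (executes r) (time-bound r) (f (frame c (executes r)) (post r))

  stop : ∀ {σ} {Q : State → Set} → Q σ → Run nop σ Q
  stop q = run skip ≤-refl q

  set : ∀ {σ r e} {Q : State → Set} →
        Q ⟪ regs σ [ r ↦ eval σ e ] , mem σ ⟫ → Run (r ≔ e) σ Q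
  set q = run assign ≤-refl q

  put : ∀ {σ r s} {Q : State → Set} →
        Q ⟪ regs σ , mem σ [ regs σ r ↦ regs σ s ] ⟫ → Run ([ r ]≔ s) σ Q
  put q = run store ≤-refl q

  infixr 5 _then_

  -- The continuation also receives the frame of the first command; hence postconditions need to
  -- mention only what changes.
  _then_ : ∀ {c d σ Q R} → Run c σ Q →
           (∀ {τ} → Frame c σ τ → Q τ → Run d τ R) → Run (c ▸ d) σ R
  _then_ {c} r f = run (seq (executes r) (executes r′))
                       (+-mono-≤ (time-bound r) (time-bound r′)) (post r′)
    where r′ = f (frame c (executes r)) (post r)

  set▸ : ∀ {d σ r e} {Q : State → Set} →
         Run d ⟪ regs σ [ r ↦ eval σ e ] , mem σ ⟫ Q → Run (r ≔ e ▸ d) σ Q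
  set▸ p = run (seq assign (executes p)) (s≤s (time-bound p)) (post p)

  put▸ : ∀ {d σ r s} {Q : State → Set} →
         Run d ⟪ regs σ , mem σ [ regs σ r ↦ regs σ s ] ⟫ Q → Run ([ r ]≔ s ▸ d) σ Q
  put▸ p = run (seq store (executes p)) (s≤s (time-bound p)) (post p)

  branch : ∀ {c d σ r} {Q : State → Set} →
           (regs σ r ≢ 0 → Run c σ Q) → (regs σ r ≡ 0 → Run d σ Q) →
           Run (cond r c d) σ Q
  branch {c} {d} {σ} {r} f g with regs σ r ≟ 0
  ... | yes z = run (if-zero z (executes p))
                    (s≤s (≤-trans (time-bound p) (m≤n+m _ (⟦ cost c ⟧ ρ)))) (post p)
    where p = g z
  ... | no nz = run (if-nonzero nz (executes p))
                    (s≤s (≤-trans (time-bound p) (m≤m+n _ _))) (post p)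
    where p = f nz

  module _ {b : Cost} {r : Reg} {c : Cmd} {σ₀ : State}
           (J : ℕ → State → Set) (Q : State → Set)
           (iterate : ∀ k {σ} → Frame c σ₀ σ → J k σ →
                      (regs σ r ≡ 0 × Q σ) ⊎
                      (regs σ r ≢ 0 × ∃[ k′ ] (k ≡ suc k′ × Run c σ (J k′)))) where

    private
      iterations : ∀ k {σ} → Frame c σ₀ σ → J k σ →
                   ∃[ τ ] ∃[ t ] (⟨ whileNonZero r (erase c) , σ ⟩⇓⟨ τ , t ⟩ ×
                t ≤ suc (k * suc (⟦ cost c ⟧ ρ)) × Q τ)
      iterations k f j with iterate k f j
      ... | inj₁ (z , q) = _ , _ , while-zero z , s≤s z≤n , q
      iterations (suc k) f j | inj₂ (nz , .k , refl , p)
        with iterations k (frame-trans f (frame c (executes p))) (post p)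
      ... | τ , t , e , t≤ , q = τ , _ , while-nonzero nz (executes p) e ,
        s≤s (subst (time p + t ≤_) (+-suc (⟦ cost c ⟧ ρ) (k * suc (⟦ cost c ⟧ ρ)))
              (+-mono-≤ (time-bound p) t≤)) , q

    -- The measure `k` bounds the iterations to come and is independent of the tested register. The
    -- loop over the queue needs this, since the queue grows while it is read.
    while : ∀ k → k ≤ ⟦ b ⟧ ρ → J k σ₀ → Run (loop b r c) σ₀ Q
    while k k≤ j with iterations k frame-refl j
    ... | τ , t , e , t≤ , q =
      run e (≤-trans t≤ (s≤s (*-monoˡ-≤ (suc (⟦ cost c ⟧ ρ)) k≤))) q

  for : ∀ {b r c σ₀} (J : ℕ → State → Set) →
        (∀ k {σ} → Frame c σ₀ σ → regs σ r ≡ suc k → J (suc k) σ →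
         Run c σ (λ τ → regs τ r ≡ k × J k τ)) →
        ∀ {k} → k ≤ ⟦ b ⟧ ρ → regs σ₀ r ≡ k → J k σ₀ → Run (loop b r c) σ₀ (J 0)
  for {b} {r} {c} {σ₀} J iterate {k} k≤ eq j =
    while (λ k σ → regs σ r ≡ k × J k σ) (J 0) go k k≤ (eq , j)
    where
    go : ∀ k {σ} → Frame c σ₀ σ → regs σ r ≡ k × J k σ →
         (regs σ r ≡ 0 × J 0 σ) ⊎
         (regs σ r ≢ 0 × ∃[ k′ ] (k ≡ suc k′ × Run c σ (λ τ → regs τ r ≡ k′ × J k′ τ)))
    go zero    f (eq , j) = inj₁ (eq , j)
    go (suc k) f (eq , j) = inj₂ ((λ z → case trans (sym eq) z of λ ()) , k , refl , iterate k f eq j)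

-- Codes of sets

-- A subset is coded by the binary number whose leading digit is its first
-- element; shifting the code left then yields the elements in order.

code : ∀ {k} → Subset k → ℕ
code []                = 0
code {suc k} (b ∷ xs)  = (if b then 2 ^ k else 0) + code xs

bit : ∀ {k} → Subset k → ℕ → ℕ
bit []       u       = 0
bit (b ∷ xs) zero    = if b then 1 else 0
bit (b ∷ xs) (suc u) = bit xs u

-- This is 2 ^ u times the code of what follows the first `u` positions: the content of a register
-- after `u` doublings, each of which drops a digit that overflows 2 ^ k.
shift : ∀ {k} → Subset k → ℕ → ℕ
shift xs       zero    = code xs
shift []       (suc u) = 0
shift (b ∷ xs) (suc u) = shift xs u + shift xs u

double : ∀ k → 2 ^ suc k ≡ 2 ^ k + 2 ^ k
double k = cong (2 ^ k +_) (+-identityʳ (2 ^ k))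

code< : ∀ {k} (xs : Subset k) → code xs < 2 ^ k
code< [] = s≤s z≤n
code< {suc k} (true  ∷ xs) = subst (2 ^ k + code xs <_) (sym (double k)) (+-monoʳ-< (2 ^ k) (code< xs))
code< {suc k} (false ∷ xs) = ≤-trans (code< xs) (m≤m+n (2 ^ k) _)

shift< : ∀ {k} (xs : Subset k) u → shift xs u < 2 ^ k
shift< xs zero = code< xs
shift< [] (suc u) = s≤s z≤n
shift< {suc k} (b ∷ xs) (suc u) =
  subst (shift xs u + shift xs u <_) (sym (double k)) (+-mono-< (shift< xs u) (shift< xs u))

double-shift : ∀ {k} (xs : Subset k) u → u < k →
               shift xs u + shift xs u ≡ bit xs u * 2 ^ k + shift xs (suc u)
double-shift {suc k} (true ∷ xs) zero _ = leading (2 ^ k) (code xs)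
  where
  leading : ∀ p c → (p + c) + (p + c) ≡ 1 * (2 * p) + (c + c)
  leading = solve-∀
double-shift {suc k} (false ∷ xs) zero _ = refl
double-shift {suc k} (b ∷ xs) (suc u) (s≤s u<k) =
  trans (cong (λ z → z + z) (double-shift xs u u<k)) (regroup (bit xs u) (2 ^ k) (shift xs (suc u)))
  where
  regroup : ∀ b p s → (b * p + s) + (b * p + s) ≡ b * (2 * p) + (s + s)
  regroup = solve-∀

bit01 : ∀ {k} (xs : Subset k) u → bit xs u ≡ 0 ⊎ bit xs u ≡ 1
bit01 []           u       = inj₁ refl
bit01 (true  ∷ xs) zero    = inj₂ refl
bit01 (false ∷ xs) zero    = inj₁ refl
bit01 (b ∷ xs)     (suc u) = bit01 xs u

∈⇒bit : ∀ {k} {xs : Subset k} {u} → u ∈ xs → bit xs (toℕ u) ≡ 1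
∈⇒bit here          = refl
∈⇒bit (there u∈xs) = ∈⇒bit u∈xs

bit⇒∈ : ∀ {k} {xs : Subset k} (u : Fin k) → bit xs (toℕ u) ≢ 0 → u ∈ xs
bit⇒∈ {xs = true  ∷ xs} zero    b = here
bit⇒∈ {xs = false ∷ xs} zero    b = ⊥-elim (b refl)
bit⇒∈ {xs = x ∷ xs}     (suc u) b = there (bit⇒∈ u b)

∉⇒bit : ∀ {k} {xs : Subset k} (u : Fin k) → u ∉ xs → bit xs (toℕ u) ≡ 0
∉⇒bit {xs = xs} u u∉xs with bit01 xs (toℕ u)
... | inj₁ eq = eq
... | inj₂ eq = ⊥-elim (u∉xs (bit⇒∈ u λ z → case trans (sym z) eq of λ ()))

code-injective : ∀ {k} (xs ys : Subset k) → code xs ≡ code ys → xs ≡ ys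
code-injective [] [] _ = refl
code-injective {suc k} (true ∷ xs) (true ∷ ys) eq =
  cong (true ∷_) (code-injective xs ys (+-cancelˡ-≡ (2 ^ k) _ _ eq))
code-injective (false ∷ xs) (false ∷ ys) eq = cong (false ∷_) (code-injective xs ys eq)
code-injective {suc k} (true ∷ xs) (false ∷ ys) eq =
  ⊥-elim (<-irrefl (sym eq) (<-≤-trans (code< ys) (m≤m+n (2 ^ k) (code xs))))
code-injective {suc k} (false ∷ xs) (true ∷ ys) eq =
  ⊥-elim (<-irrefl eq (<-≤-trans (code< xs) (m≤m+n (2 ^ k) (code ys))))

code-⊥ : ∀ k → code (⊥ {k}) ≡ 0
code-⊥ zero    = refl
code-⊥ (suc k) = code-⊥ k

suc-code-⊤ : ∀ k → suc (code (⊤ {k})) ≡ 2 ^ k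
suc-code-⊤ zero    = refl
suc-code-⊤ (suc k) = trans (sym (+-suc (2 ^ k) _))
  (trans (cong (2 ^ k +_) (suc-code-⊤ k)) (sym (double k)))

code-⊤ : ∀ k → code (⊤ {k}) ≡ 2 ^ k ∸ 1
code-⊤ k = cong (_∸ 1) (suc-code-⊤ k)

-- The program finds the elements of a child one by one and doubles before it adds a digit, whereas
-- `code` gives each digit its final weight at once; `horner-code` identifies the two.
horner : (ℕ → ℕ) → ℕ → ℕ
horner g zero    = 0
horner g (suc u) = horner g u + horner g u + g u

∑ : (ℕ → ℕ) → ℕ → ℕ
∑ g zero    = 0
∑ g (suc u) = ∑ g u + g u

horner-suc : ∀ g k → horner g (suc k) ≡ g 0 * 2 ^ k + horner (g ∘ suc) k
horner-suc g zero = sym (trans (+-identityʳ (g 0 * 1)) (*-identityʳ (g 0)))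
horner-suc g (suc k) = trans (cong (λ z → z + z + g (suc k)) (horner-suc g k))
  (regroup (g 0) (2 ^ k) (horner (g ∘ suc) k) (g (suc k)))
  where
  regroup : ∀ a p h e → (a * p + h) + (a * p + h) + e ≡ a * (2 * p) + (h + h + e)
  regroup = solve-∀

∑-suc : ∀ g k → ∑ g (suc k) ≡ g 0 + ∑ (g ∘ suc) k
∑-suc g zero    = sym (+-identityʳ (g 0))
∑-suc g (suc k) = trans (cong (_+ g (suc k)) (∑-suc g k)) (+-assoc (g 0) _ _)

horner-code : ∀ {k} (xs : Subset k) → horner (bit xs) k ≡ code xs
horner-code [] = refl
horner-code {suc k} (true ∷ xs) =
  trans (horner-suc (bit (true ∷ xs)) k) (cong₂ _+_ (+-identityʳ (2 ^ k)) (horner-code xs))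
horner-code {suc k} (false ∷ xs) =
  trans (horner-suc (bit (false ∷ xs)) k) (horner-code xs)

∑-size : ∀ {k} (xs : Subset k) → ∑ (bit xs) k ≡ ∣ xs ∣
∑-size [] = refl
∑-size {suc k} (true  ∷ xs) = trans (∑-suc (bit (true ∷ xs)) k) (cong suc (∑-size xs))
∑-size {suc k} (false ∷ xs) = trans (∑-suc (bit (false ∷ xs)) k) (∑-size xs)

-- The program decides an existential statement by counting witnesses; this and `∃⇒∑≢0` translate
-- back.
∑≢0⇒∃ : ∀ g k → ∑ g k ≢ 0 → ∃[ u ] (u < k × g u ≢ 0)
∑≢0⇒∃ g zero    nz = ⊥-elim (nz refl)
∑≢0⇒∃ g (suc k) nz with g k ≟ 0
... | no  gk≢0 = k , ≤-refl , gk≢0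
... | yes gk≡0 with ∑≢0⇒∃ g k (λ z → nz (trans (cong₂ _+_ z gk≡0) refl))
...   | u , u<k , gu≢0 = u , m≤n⇒m≤1+n u<k , gu≢0

∃⇒∑≢0 : ∀ g k {u} → u < k → g u ≢ 0 → ∑ g k ≢ 0
∃⇒∑≢0 g (suc k) {u} (s≤s u≤k) gu≢0 z with m≤n⇒m<n∨m≡n u≤k
... | inj₁ u<k  = ∃⇒∑≢0 g k u<k gu≢0 (m+n≡0⇒m≡0 _ z)
... | inj₂ refl = gu≢0 (m+n≡0⇒n≡0 (∑ g k) z)

tabulateSet : ∀ {k} {P : Fin k → Set} → (∀ u → Dec (P u)) → Subset k
tabulateSet P? = Vec.tabulate (λ u → does (P? u))

module _ {k} {P : Fin k → Set} (P? : ∀ u → Dec (P u)) where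

  ∈-tabulate⁺ : ∀ {u} → P u → u ∈ tabulateSet P?
  ∈-tabulate⁺ {u} p = Vecₚ.lookup⇒[]= u _
    (trans (Vecₚ.lookup∘tabulate (λ v → does (P? v)) u) (dec-true (P? u) p))

  ∈-tabulate⁻ : ∀ {u} → u ∈ tabulateSet P? → P u
  ∈-tabulate⁻ {u} u∈ with P? u in eq
  ... | yes p = p
  ... | no ¬p = case trans (sym (Vecₚ.[]=⇒lookup u∈))
                       (trans (Vecₚ.lookup∘tabulate (λ v → does (P? v)) u) (dec-false (P? u) ¬p)) of λ ()

-- Schedules

∈-─⁻ : ∀ {k} {p q : Subset k} {x} → x ∈ p ─ q → x ∈ p × x ∉ q
∈-─⁻ {p = true ∷ p} {false ∷ q} here = here , λ ()
∈-─⁻ {p = false ∷ p} {true ∷ q} {zero} ()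
∈-─⁻ {p = false ∷ p} {false ∷ q} {zero} ()
∈-─⁻ {p = b ∷ p} {c ∷ q} (there x∈) with ∈-─⁻ {p = p} {q} x∈
... | x∈p , x∉q = there x∈p , λ { (there x∈q) → x∉q x∈q }

∈-─⁺ : ∀ {k} {p q : Subset k} {x} → x ∈ p → x ∉ q → x ∈ p ─ q
∈-─⁺ = x∈p∧x∉q⇒x∈p─q

∣p─q∣+∣q∣ : ∀ {k} (p q : Subset k) → q ⊆ p → ∣ p ─ q ∣ + ∣ q ∣ ≡ ∣ p ∣
∣p─q∣+∣q∣ [] [] _ = refl
∣p─q∣+∣q∣ (true ∷ p) (true ∷ q) q⊆p =
  trans (+-suc _ _) (cong suc (∣p─q∣+∣q∣ p q (drop-∷-⊆ q⊆p)))
∣p─q∣+∣q∣ (true ∷ p) (false ∷ q) q⊆p = cong suc (∣p─q∣+∣q∣ p q (drop-∷-⊆ q⊆p))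
∣p─q∣+∣q∣ (false ∷ p) (true ∷ q) q⊆p = case q⊆p here of λ ()
∣p─q∣+∣q∣ (false ∷ p) (false ∷ q) q⊆p = ∣p─q∣+∣q∣ p q (drop-∷-⊆ q⊆p)

∣p∪q∣≤ : ∀ {k} (p q : Subset k) → ∣ p ∪ q ∣ ≤ ∣ p ∣ + ∣ q ∣
∣p∪q∣≤ [] [] = z≤n
∣p∪q∣≤ (true ∷ p) (true ∷ q) =
  s≤s (≤-trans (∣p∪q∣≤ p q) (+-monoʳ-≤ ∣ p ∣ (n≤1+n _)))
∣p∪q∣≤ (true ∷ p) (false ∷ q) = s≤s (∣p∪q∣≤ p q)
∣p∪q∣≤ (false ∷ p) (true ∷ q) = ≤-trans (s≤s (∣p∪q∣≤ p q)) (≤-reflexive (sym (+-suc _ _)))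
∣p∪q∣≤ (false ∷ p) (false ∷ q) = ∣p∪q∣≤ p q

∣p-x∪⁅y⁆∣≤ : ∀ {k} (p : Subset k) {x} y → x ∈ p → ∣ (p - x) ∪ ⁅ y ⁆ ∣ ≤ ∣ p ∣
∣p-x∪⁅y⁆∣≤ p {x} y x∈p = begin
  ∣ (p - x) ∪ ⁅ y ⁆ ∣   ≤⟨ ∣p∪q∣≤ (p - x) ⁅ y ⁆ ⟩
  ∣ p - x ∣ + ∣ ⁅ y ⁆ ∣ ≡⟨ cong (∣ p - x ∣ +_) (∣⁅x⁆∣≡1 y) ⟩
  ∣ p - x ∣ + 1         ≡⟨ +-comm _ 1 ⟩
  suc ∣ p - x ∣         ≤⟨ x∈p⇒∣p-x∣<∣p∣ x∈p ⟩
  ∣ p ∣                 ∎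
  where open ≤-Reasoning

∣p∣≡0⇒Empty : ∀ {k} {p : Subset k} → ∣ p ∣ ≤ 0 → Empty p
∣p∣≡0⇒Empty {p = true ∷ p} () (zero , here)
∣p∣≡0⇒Empty {p = false ∷ p} le (suc x , there x∈p) = ∣p∣≡0⇒Empty {p = p} le (x , x∈p)
∣p∣≡0⇒Empty {p = true ∷ p} () (suc x , there x∈p)

Empty⇒∣p∣≡0 : ∀ {k} {p : Subset k} → Empty p → ∣ p ∣ ≡ 0
Empty⇒∣p∣≡0 {k} e rewrite Empty-unique e = ∣⊥∣≡0 k

-- Greedy filling of a slot around the compulsory jobs `A`. What matters is the last alternative:
-- either no machine is idle or no candidate is left.
choose : ∀ {k} (A W : Subset k) c → A ⊆ W → ∣ A ∣ ≤ c →
         ∃[ S ] (A ⊆ S × S ⊆ W × ∣ S ∣ ≤ c × (∣ S ∣ ≡ c ⊎ W ⊆ S))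
choose [] [] c A⊆W le = [] , (λ ()) , (λ ()) , z≤n , inj₂ λ ()
choose (true ∷ A) (false ∷ W) c A⊆W le = case A⊆W here of λ ()
choose (false ∷ A) (false ∷ W) c A⊆W le with choose A W c (drop-∷-⊆ A⊆W) le
... | S , A⊆S , S⊆W , ≤c , inj₁ eq  = false ∷ S , s⊆s A⊆S , s⊆s S⊆W , ≤c , inj₁ eq
... | S , A⊆S , S⊆W , ≤c , inj₂ W⊆S = false ∷ S , s⊆s A⊆S , s⊆s S⊆W , ≤c , inj₂ (s⊆s W⊆S)
choose (true ∷ A) (true ∷ W) (suc c) A⊆W (s≤s le) with choose A W c (drop-∷-⊆ A⊆W) le
... | S , A⊆S , S⊆W , ≤c , inj₁ eq  = true ∷ S , s⊆s A⊆S , s⊆s S⊆W , s≤s ≤c , inj₁ (cong suc eq)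
... | S , A⊆S , S⊆W , ≤c , inj₂ W⊆S = true ∷ S , s⊆s A⊆S , s⊆s S⊆W , s≤s ≤c , inj₂ (s⊆s W⊆S)
choose (false ∷ A) (true ∷ W) c A⊆W le with choose A W c (drop-∷-⊆ A⊆W) le
... | S , A⊆S , S⊆W , ≤c , inj₁ eq  = false ∷ S , s⊆s A⊆S , out⊆ S⊆W , ≤c , inj₁ eq
... | S , A⊆S , S⊆W , ≤c , inj₂ W⊆S with ∣ S ∣ ≟ c
...   | yes eq = false ∷ S , s⊆s A⊆S , out⊆ S⊆W , ≤c , inj₁ eq
...   | no neq = true ∷ S , out⊆ A⊆S , s⊆s S⊆W , ≤∧≢⇒< ≤c neq , inj₂ (s⊆s W⊆S)

module Scheduling {n : ℕ} (_≺_ : Fin n → Fin n → Set)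
                  (order : IsDecStrictPartialOrder _≡_ _≺_) (m : ℕ) where

  open IsDecStrictPartialOrder order public using (isStrictPartialOrder)
    renaming (_<?_ to _≺?_; irrefl to ≺-irrefl; trans to ≺-trans)

  Minimal : Subset n → Subset n → Set
  Minimal S X = ∀ {s u} → s ∈ S → u ∈ X → ¬ (u ≺ s)

  -- Schedules in the form that suits induction. As `S ⊆ X`, minimality also makes the jobs of one
  -- slot incomparable.
  data Sch : ℕ → Subset n → Set where
    finished : ∀ {X} → Empty X → Sch 0 X
    slot     : ∀ {ℓ X} S → S ⊆ X → Minimal S X → ∣ S ∣ ≤ m → Sch ℓ (X ─ S) → Sch (suc ℓ) X

  restrict : ∀ {ℓ X X′} → X′ ⊆ X → Sch ℓ X → Sch ℓ X′
  restrict X′⊆X (finished e) = finished λ (x , x∈) → e (x , X′⊆X x∈)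
  restrict {X = X} {X′} X′⊆X (slot S S⊆X min le r) =
    slot (S Subset.∩ X′) (p∩q⊆q S X′) (λ s∈ u∈ → min (p∩q⊆p S X′ s∈) (X′⊆X u∈))
         (≤-trans (∣p∩q∣≤∣p∣ S X′) le) (restrict sub r)
    where
    sub : X′ ─ (S Subset.∩ X′) ⊆ X ─ S
    sub x∈ with ∈-─⁻ x∈
    ... | x∈X′ , x∉ = ∈-─⁺ (X′⊆X x∈X′) λ x∈S → x∉ (x∈p∩q⁺ (x∈S , x∈X′))

  idle : ∀ {ℓ X} → Sch ℓ X → Sch (suc ℓ) X
  idle (finished e) = slot ⊥ (λ x∈ → ⊥-elim (∉⊥ x∈)) (λ s∈ → ⊥-elim (∉⊥ s∈))
    (subst (_≤ m) (sym (∣⊥∣≡0 n)) z≤n) (finished λ (x , x∈) → e (x , p─q⊆p _ _ x∈))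
  idle (slot S S⊆X min le r) = slot S S⊆X min le (idle r)

  extend : ∀ {ℓ ℓ′ X} → ℓ ≤ ℓ′ → Sch ℓ X → Sch ℓ′ X
  extend {ℓ} {ℓ′} {X} ℓ≤ s = subst (λ k → Sch k X) (m∸n+n≡m ℓ≤) (add (ℓ′ ∸ ℓ))
    where
    add : ∀ k → Sch (k + ℓ) X
    add zero    = s
    add (suc k) = idle (add k)

  size-bound : ∀ {ℓ X} → Sch ℓ X → ∣ X ∣ ≤ ℓ * m
  size-bound (finished e) = ≤-reflexive (Empty⇒∣p∣≡0 e)
  size-bound {suc ℓ} {X} (slot S S⊆X min le r) = begin
    ∣ X ∣ ≡⟨ sym (∣p─q∣+∣q∣ X S S⊆X) ⟩
    ∣ X ─ S ∣ + ∣ S ∣ ≤⟨ +-mono-≤ (size-bound r) le ⟩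
    ℓ * m + m ≡⟨ +-comm (ℓ * m) m ⟩
    m + ℓ * m ∎
    where open ≤-Reasoning

  full-slot : ∀ ℓ {X S : Subset n} → S ⊆ X → ∣ S ∣ ≡ m → ∣ X ∣ ≤ suc ℓ * m → ∣ X ─ S ∣ ≤ ℓ * m
  full-slot ℓ {X} {S} S⊆X eq le = +-cancelʳ-≤ m _ _ (begin
    ∣ X ─ S ∣ + m     ≡⟨ cong (∣ X ─ S ∣ +_) (sym eq) ⟩
    ∣ X ─ S ∣ + ∣ S ∣ ≡⟨ ∣p─q∣+∣q∣ X S S⊆X ⟩
    ∣ X ∣             ≤⟨ le ⟩
    m + ℓ * m         ≡⟨ +-comm m (ℓ * m) ⟩
    ℓ * m + m         ∎)
    where open ≤-Reasoning

  concat : ∀ {k ℓ X Y} → Sch k Y → Y ⊆ X → (∀ {y u} → y ∈ Y → u ∈ X → u ≺ y → u ∈ Y) →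
           Sch ℓ (X ─ Y) → Sch (k + ℓ) X
  concat (finished e) Y⊆X closed r = restrict (λ x∈ → ∈-─⁺ x∈ λ x∈Y → e (_ , x∈Y)) r
  concat {X = X} {Y} (slot S S⊆Y min le s) Y⊆X closed r =
    slot S (λ x∈ → Y⊆X (S⊆Y x∈))
      (λ s∈ u∈ u≺s → min s∈ (closed (S⊆Y s∈) u∈ u≺s) u≺s) le
      (concat s sub closed′ (restrict sub′ r))
    where
    sub : Y ─ S ⊆ X ─ S
    sub x∈ with ∈-─⁻ x∈
    ... | x∈Y , x∉S = ∈-─⁺ (Y⊆X x∈Y) x∉S
    closed′ : ∀ {y u} → y ∈ Y ─ S → u ∈ X ─ S → u ≺ y → u ∈ Y ─ S
    closed′ y∈ u∈ u≺y = ∈-─⁺ (closed (proj₁ (∈-─⁻ y∈)) (proj₁ (∈-─⁻ u∈)) u≺y) (proj₂ (∈-─⁻ {q = S} u∈))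
    sub′ : (X ─ S) ─ (Y ─ S) ⊆ X ─ Y
    sub′ x∈ with ∈-─⁻ x∈
    ... | x∈X─S , x∉ = ∈-─⁺ (proj₁ (∈-─⁻ x∈X─S)) λ x∈Y → x∉ (∈-─⁺ x∈Y (proj₂ (∈-─⁻ {q = S} x∈X─S)))

  -- Jobs of `Z` outside `X` are comparable to nothing, so any idle machine will do. Filling
  -- greedily suffices: a full slot uses up exactly `m` of the capacity, and once candidates run out
  -- only jobs of the given schedule remain.
  fill : ∀ {ℓ X Z} → Sch ℓ X → X ⊆ Z →
         (∀ {w u} → w ∈ Z → w ∉ X → u ∈ Z → ¬ (u ≺ w) × ¬ (w ≺ u)) →
         ∣ Z ∣ ≤ ℓ * m → Sch ℓ Z
  fill (finished e) X⊆Z free le = finished (∣p∣≡0⇒Empty le)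
  fill {suc ℓ} {X} {Z} (slot S S⊆X min ≤m r) X⊆Z free le
    with choose S (S ∪ (Z ─ X)) m (λ x∈ → p⊆p∪q _ x∈) ≤m
  ... | S′ , S⊆S′ , S′⊆W , ≤m′ , full =
    slot S′ (λ x∈ → W⊆Z (S′⊆W x∈)) (λ s∈ → min′ (S′⊆W s∈)) ≤m′
         (fill r sub free′ (small full))
    where
    W⊆Z : S ∪ (Z ─ X) ⊆ Z
    W⊆Z x∈ with ∈-∪⁻ S (Z ─ X) x∈
    ... | inj₁ x∈S = X⊆Z (S⊆X x∈S)
    ... | inj₂ x∈  = p─q⊆p Z X x∈
    min′ : Minimal (S ∪ (Z ─ X)) Z
    min′ {s} {u} s∈ u∈ u≺s with ∈-∪⁻ S (Z ─ X) s∈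
    ... | inj₂ s∈′ = proj₁ (free (proj₁ (∈-─⁻ s∈′)) (proj₂ (∈-─⁻ {q = X} s∈′)) u∈) u≺s
    ... | inj₁ s∈S with u ∈? X
    ...   | yes u∈X = min s∈S u∈X u≺s
    ...   | no  u∉X = proj₂ (free u∈ u∉X (X⊆Z (S⊆X s∈S))) u≺s
    sub : X ─ S ⊆ Z ─ S′
    sub x∈ with ∈-─⁻ x∈
    ... | x∈X , x∉S = ∈-─⁺ (X⊆Z x∈X) λ x∈S′ → case ∈-∪⁻ S (Z ─ X) (S′⊆W x∈S′) of λ where
      (inj₁ x∈S) → x∉S x∈S
      (inj₂ x∈′) → proj₂ (∈-─⁻ {q = X} x∈′) x∈X
    free′ : ∀ {w u} → w ∈ Z ─ S′ → w ∉ X ─ S → u ∈ Z ─ S′ → ¬ (u ≺ w) × ¬ (w ≺ u)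
    free′ w∈ w∉ u∈ with ∈-─⁻ w∈
    ... | w∈Z , w∉S′ = free w∈Z (λ w∈X → w∉ (∈-─⁺ w∈X λ w∈S → w∉S′ (S⊆S′ w∈S))) (proj₁ (∈-─⁻ u∈))
    small : ∣ S′ ∣ ≡ m ⊎ S ∪ (Z ─ X) ⊆ S′ → ∣ Z ─ S′ ∣ ≤ ℓ * m
    small (inj₁ eq) = full-slot ℓ (λ x∈ → W⊆Z (S′⊆W x∈)) eq le
    small (inj₂ W⊆S′) = ≤-trans (p⊆q⇒∣p∣≤∣q∣ sub″) (size-bound r)
      where
      sub″ : Z ─ S′ ⊆ X ─ S
      sub″ {x} x∈ with ∈-─⁻ x∈
      ... | x∈Z , x∉S′ = ∈-─⁺
        (decidable-stable (x ∈? X) λ x∉X → x∉S′ (W⊆S′ (q⊆p∪q S (Z ─ X) (∈-─⁺ x∈Z x∉X))))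
        (λ x∈S → x∉S′ (S⊆S′ x∈S))

  NonMaximal : Subset n → Fin n → Set
  NonMaximal X v = ∃[ w ] (w ∈ X × v ≺ w)

  Above : Subset n → Subset n → Fin n → Set
  Above A X v = ∃[ a ] (a ∈ A × a ∈ X × a ≺ v)

  nonMaximal? : ∀ X v → Dec (NonMaximal X v)
  nonMaximal? X v = Finₚ.any? λ w → (w ∈? X) ×-dec (v ≺? w)

  above? : ∀ A X v → Dec (Above A X v)
  above? A X v = Finₚ.any? λ a → (a ∈? A) ×-dec ((a ∈? X) ×-dec (a ≺? v))

  inLower? : ∀ X A v → Dec (v ∈ X × NonMaximal X v × v ∉ A × ¬ Above A X v)
  inLower? X A v = (v ∈? X) ×-dec (nonMaximal? X v ×-dec (¬? (v ∈? A) ×-dec ¬? (above? A X v)))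

  inUpper? : ∀ X A v → Dec (v ∈ X × Above A X v)
  inUpper? X A v = (v ∈? X) ×-dec above? A X v

  -- The non-maximal jobs of X run before, and the jobs of X run after, the
  -- first slot that is not filled by non-maximal jobs; A is the set of all
  -- non-maximal jobs available then.

  lower upper : Subset n → Subset n → Subset n
  lower X A = tabulateSet (inLower? X A)
  upper X A = tabulateSet (inUpper? X A)

  lower⁻ : ∀ {X A v} → v ∈ lower X A → v ∈ X × NonMaximal X v × v ∉ A × ¬ Above A X v
  lower⁻ {X} {A} = ∈-tabulate⁻ (inLower? X A)

  lower⁺ : ∀ {X A v} → v ∈ X × NonMaximal X v × v ∉ A × ¬ Above A X v → v ∈ lower X A
  lower⁺ {X} {A} = ∈-tabulate⁺ (inLower? X A)

  upper⁻ : ∀ {X A v} → v ∈ upper X A → v ∈ X × Above A X v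
  upper⁻ {X} {A} = ∈-tabulate⁻ (inUpper? X A)

  upper⁺ : ∀ {X A v} → v ∈ X × Above A X v → v ∈ upper X A
  upper⁺ {X} {A} = ∈-tabulate⁺ (inUpper? X A)

  ∉lower : ∀ {X A v} → v ∈ X → NonMaximal X v → v ∉ lower X A → v ∈ A ⊎ Above A X v
  ∉lower {X} {A} {v} v∈X nm v∉ with v ∈? A | above? A X v
  ... | yes v∈A | _      = inj₁ v∈A
  ... | no  _   | yes ab = inj₂ ab
  ... | no v∉A  | no ¬ab = ⊥-elim (v∉ (lower⁺ (v∈X , nm , v∉A , ¬ab)))

  -- The upper bound on f X, for each `A` of at most `m` jobs. After the lower part, the jobs
  -- outside the upper part are minimal: a predecessor left over would lie in `A` or above it and
  -- put them into the upper part. One slot takes those of them that are in `A` and is filled up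
  -- with others. Those that still remain are not in `A`, hence also maximal, and `fill` spreads
  -- them over the idle machines.
  assemble : ∀ {X A k ℓ ℓ′} → ∣ A ∣ ≤ m → Sch k (lower X A) → Sch ℓ (upper X A) → ℓ ≤ ℓ′ →
             ∣ X ∣ ∸ ∣ lower X A ∣ ≤ suc ℓ′ * m → Sch (k + suc ℓ′) X
  assemble {X} {A} {k} {ℓ} {ℓ′} ∣A∣≤m low upp ℓ≤ le =
    concat low (λ y∈ → proj₁ (lower⁻ y∈)) closed later
    where
    Y = lower X A
    U = upper X A
    R = X ─ Y
    W = R ─ U
    closed : ∀ {y u} → y ∈ Y → u ∈ X → u ≺ y → u ∈ Y
    closed {y} {u} y∈ u∈X u≺y with lower⁻ y∈
    ... | y∈X , _ , y∉A , ¬ab = lower⁺ (u∈X , (y , y∈X , u≺y) ,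
      (λ u∈A → ¬ab (u , u∈A , u∈X , u≺y)) ,
      λ (a , a∈A , a∈X , a≺u) → ¬ab (a , a∈A , a∈X , ≺-trans a≺u u≺y))
    minW : Minimal W R
    minW {s} {u} s∈W u∈R u≺s with ∈-─⁻ s∈W
    ... | s∈R , s∉U with ∈-─⁻ s∈R | ∈-─⁻ u∈R
    ... | s∈X , s∉Y | u∈X , u∉Y with ∉lower u∈X (s , s∈X , u≺s) u∉Y
    ... | inj₁ u∈A = s∉U (upper⁺ (s∈X , u , u∈A , u∈X , u≺s))
    ... | inj₂ (a , a∈A , a∈X , a≺u) = s∉U (upper⁺ (s∈X , a , a∈A , a∈X , ≺-trans a≺u u≺s))
    U⊆R : U ⊆ R
    U⊆R x∈ with upper⁻ x∈
    ... | x∈X , ab = ∈-─⁺ x∈X λ x∈Y → proj₂ (proj₂ (proj₂ (lower⁻ x∈Y))) ab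
    ∣R∣≤ : ∣ R ∣ ≤ suc ℓ′ * m
    ∣R∣≤ = subst (_≤ suc ℓ′ * m)
      (trans (cong (_∸ ∣ Y ∣) (sym (∣p─q∣+∣q∣ X Y (λ y∈ → proj₁ (lower⁻ y∈)))))
             (m+n∸n≡m ∣ R ∣ ∣ Y ∣)) le
    later : Sch (suc ℓ′) R
    later with choose (A Subset.∩ W) W m (p∩q⊆q A W) (≤-trans (∣p∩q∣≤∣p∣ A W) ∣A∣≤m)
    ... | S , A⊆S , S⊆W , ≤m , full =
      slot S (λ s∈ → p─q⊆p R U (S⊆W s∈)) (λ s∈ → minW (S⊆W s∈)) ≤m
           (fill (extend ℓ≤ upp) sub free (small full))
      where
      sub : U ⊆ R ─ S
      sub x∈ = ∈-─⁺ (U⊆R x∈) λ x∈S → proj₂ (∈-─⁻ {q = U} (S⊆W x∈S)) x∈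
      free : ∀ {w u} → w ∈ R ─ S → w ∉ U → u ∈ R ─ S → ¬ (u ≺ w) × ¬ (w ≺ u)
      free {w} {u} w∈ w∉U u∈ with ∈-─⁻ w∈ | ∈-─⁻ u∈
      ... | w∈R , w∉S | u∈R , _ = minW (∈-─⁺ w∈R w∉U) u∈R , maximal
        where
        w∈X = p─q⊆p X Y w∈R
        maximal : ¬ (w ≺ u)
        maximal w≺u with ∉lower w∈X (u , p─q⊆p X Y u∈R , w≺u) (proj₂ (∈-─⁻ {q = Y} w∈R))
        ... | inj₁ w∈A = w∉S (A⊆S (x∈p∩q⁺ (w∈A , ∈-─⁺ w∈R w∉U)))
        ... | inj₂ ab  = w∉U (upper⁺ (w∈X , ab))
      small : ∣ S ∣ ≡ m ⊎ W ⊆ S → ∣ R ─ S ∣ ≤ ℓ′ * m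
      small (inj₁ eq) = full-slot ℓ′ (λ x∈ → p─q⊆p R U (S⊆W x∈)) eq ∣R∣≤
      small (inj₂ W⊆S) = ≤-trans (p⊆q⇒∣p∣≤∣q∣ sub′) (≤-trans (size-bound upp) (*-monoˡ-≤ m ℓ≤))
        where
        sub′ : R ─ S ⊆ U
        sub′ {x} x∈ with ∈-─⁻ x∈
        ... | x∈R , x∉S = decidable-stable (x ∈? U) λ x∉U → x∉S (W⊆S (∈-─⁺ x∈R x∉U))

-- Splitting a schedule at the first slot not filled by non-maximal jobs

module Decomposition {n : ℕ} (_≺_ : Fin n → Fin n → Set)
                     (order : IsDecStrictPartialOrder _≡_ _≺_) (m : ℕ) where

  open Scheduling _≺_ order m

  hasMinimal : ∀ X {v} → v ∈ X →
               ∃[ b ] (b ∈ X × (∀ {u} → u ∈ X → ¬ (u ≺ b)) × (b ≡ v ⊎ b ≺ v))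
  hasMinimal X {v} v∈X = go v∈X (spo-wellFounded isStrictPartialOrder v)
    where
    go : ∀ {v} → v ∈ X → Acc _≺_ v →
         ∃[ b ] (b ∈ X × (∀ {u} → u ∈ X → ¬ (u ≺ b)) × (b ≡ v ⊎ b ≺ v))
    go {v} v∈X (acc below) with Finₚ.any? (λ u → (u ∈? X) ×-dec (u ≺? v))
    ... | no none = v , v∈X , (λ u∈ u≺v → none (_ , u∈ , u≺v)) , inj₁ refl
    ... | yes (u , u∈X , u≺v) with go u∈X (below u≺v)
    ...   | b , b∈X , min , inj₁ refl = b , b∈X , min , inj₂ u≺v
    ...   | b , b∈X , min , inj₂ b≺u  = b , b∈X , min , inj₂ (≺-trans b≺u u≺v)

  hasMaximal : ∀ X {v} → v ∈ X → ∃[ b ] (b ∈ X × ¬ NonMaximal X b × (v ≡ b ⊎ v ≺ b))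
  hasMaximal X {v} v∈X = go v∈X (spo-noetherian isStrictPartialOrder v)
    where
    go : ∀ {v} → v ∈ X → Acc (λ x y → y ≺ x) v →
         ∃[ b ] (b ∈ X × ¬ NonMaximal X b × (v ≡ b ⊎ v ≺ b))
    go {v} v∈X (acc above) with nonMaximal? X v
    ... | no none = v , v∈X , none , inj₁ refl
    ... | yes (u , u∈X , v≺u) with go u∈X (above v≺u)
    ...   | b , b∈X , max , inj₁ refl = b , b∈X , max , inj₂ v≺u
    ...   | b , b∈X , max , inj₂ u≺b  = b , b∈X , max , inj₂ (≺-trans v≺u u≺b)

  -- A maximal job never enters the lower part and a minimal one never the upper part. The strict
  -- decrease of both children is what lets n + 1 sweeps suffice.
  ∣lower∣< : ∀ X A → Nonempty X → ∣ lower X A ∣ < ∣ X ∣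
  ∣lower∣< X A (v , v∈X) with hasMaximal X v∈X
  ... | b , b∈X , max , _ = p⊂q⇒∣p∣<∣q∣
    ((λ x∈ → proj₁ (lower⁻ x∈)) , b , b∈X , λ b∈ → max (proj₁ (proj₂ (lower⁻ b∈))))

  ∣upper∣< : ∀ X A → Nonempty X → ∣ upper X A ∣ < ∣ X ∣
  ∣upper∣< X A (v , v∈X) with hasMinimal X v∈X
  ... | b , b∈X , min , _ = p⊂q⇒∣p∣<∣q∣
    ((λ x∈ → proj₁ (upper⁻ x∈)) , b , b∈X ,
     λ b∈ → case proj₂ (upper⁻ b∈) of λ (a , _ , a∈X , a≺b) → min a∈X a≺b)

  -- The exchange behind `saturate`: the delayed job `z` is incomparable to everything in `X`, so it
  -- can run wherever `b` vacates a place.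
  replace : ∀ {ℓ X X′ b z} → Sch ℓ X → b ∈ X → (∀ {u} → u ∈ X → ¬ (u ≺ b)) →
            (∀ {u} → u ∈ X → ¬ (u ≺ z) × ¬ (z ≺ u)) →
            (∀ {x} → x ∈ X′ → (x ∈ X × x ≢ b) ⊎ x ≡ z) → Sch ℓ X′
  replace (finished e) b∈X _ _ _ = ⊥-elim (e (_ , b∈X))
  replace {suc ℓ} {X} {X′} {b} {z} (slot S S⊆X min ≤m r) b∈X min-b free cover with b ∈? S
  ... | yes b∈S = slot S′ (p∩q⊆q _ X′) min′ size (restrict sub r)
    where
    S′ = ((S - b) ∪ ⁅ z ⁆) Subset.∩ X′
    back : ∀ {x} → x ∈ S′ → x ∈ S ⊎ x ≡ z
    back x∈ with ∈-∪⁻ (S - b) ⁅ z ⁆ (p∩q⊆p _ X′ x∈)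
    ... | inj₁ x∈S = inj₁ (p─q⊆p S ⁅ b ⁆ x∈S)
    ... | inj₂ x∈z = inj₂ (x∈⁅y⁆⇒x≡y z x∈z)
    min′ : Minimal S′ X′
    min′ s∈ u∈ u≺s with back s∈ | cover u∈
    ... | inj₁ s∈S  | inj₁ (u∈X , _) = min s∈S u∈X u≺s
    ... | inj₁ s∈S  | inj₂ refl      = proj₂ (free (S⊆X s∈S)) u≺s
    ... | inj₂ refl | inj₁ (u∈X , _) = proj₁ (free u∈X) u≺s
    ... | inj₂ refl | inj₂ refl      = ≺-irrefl refl u≺s
    size : ∣ S′ ∣ ≤ m
    size = ≤-trans (∣p∩q∣≤∣p∣ ((S - b) ∪ ⁅ z ⁆) X′) (≤-trans (∣p-x∪⁅y⁆∣≤ S z b∈S) ≤m)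
    sub : X′ ─ S′ ⊆ X ─ S
    sub {x} x∈ with ∈-─⁻ x∈
    ... | x∈X′ , x∉S′ with cover x∈X′
    ... | inj₂ refl = ⊥-elim (x∉S′ (x∈p∩q⁺ (q⊆p∪q (S - b) ⁅ z ⁆ (x∈⁅x⁆ z) , x∈X′)))
    ... | inj₁ (x∈X , x≢b) = ∈-─⁺ x∈X λ x∈S →
      x∉S′ (x∈p∩q⁺ (p⊆p∪q ⁅ z ⁆ (x∈p∧x≢y⇒x∈p-y x∈S x≢b) , x∈X′))
  ... | no b∉S = slot (S Subset.∩ X′) (p∩q⊆q S X′) min′ (≤-trans (∣p∩q∣≤∣p∣ S X′) ≤m)
    (replace r (∈-─⁺ b∈X b∉S) (λ u∈ → min-b (p─q⊆p X S u∈)) (λ u∈ → free (p─q⊆p X S u∈)) cover′)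
    where
    min′ : Minimal (S Subset.∩ X′) X′
    min′ s∈ u∈ u≺s with p∩q⊆p S X′ s∈ | cover u∈
    ... | s∈S | inj₁ (u∈X , _) = min s∈S u∈X u≺s
    ... | s∈S | inj₂ refl      = proj₂ (free (S⊆X s∈S)) u≺s
    cover′ : ∀ {x} → x ∈ X′ ─ (S Subset.∩ X′) → (x ∈ X ─ S × x ≢ b) ⊎ x ≡ z
    cover′ x∈ with ∈-─⁻ x∈
    ... | x∈X′ , x∉ with cover x∈X′
    ... | inj₁ (x∈X , x≢b) = inj₁ (∈-─⁺ x∈X (λ x∈S → x∉ (x∈p∩q⁺ (x∈S , x∈X′))) , x≢b)
    ... | inj₂ x≡z = inj₂ x≡z

  Available : Subset n → Fin n → Set
  Available X v = v ∈ X × NonMaximal X v × ¬ NonMinimal v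
    where NonMinimal = λ v → ∃[ u ] (u ∈ X × u ≺ v)

  available? : ∀ X v → Dec (Available X v)
  available? X v = (v ∈? X) ×-dec (nonMaximal? X v ×-dec
    ¬? (Finₚ.any? λ u → (u ∈? X) ×-dec (u ≺? v)))

  available : Subset n → Subset n
  available X = tabulateSet (available? X)

  available⁻ : ∀ {X v} → v ∈ available X → Available X v
  available⁻ {X} = ∈-tabulate⁻ (available? X)

  record FirstSlot (ℓ : ℕ) (X : Subset n) : Set where
    field
      jobs-in : Subset n
      within  : jobs-in ⊆ X
      minimal : Minimal jobs-in X
      fits    : ∣ jobs-in ∣ ≤ m
      rest    : Sch ℓ (X ─ jobs-in)

  open FirstSlot

  -- Delaying a maximal job in favour of an available non-maximal one is harmless.
  saturate : ∀ {ℓ X} → FirstSlot ℓ X → Σ[ F ∈ FirstSlot ℓ X ]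
             ((∣ available X ∣ < m × available X ⊆ jobs-in F) ⊎
              (∣ jobs-in F ∣ ≡ m × jobs-in F ⊆ available X))
  saturate {ℓ} {X} F = go _ F ≤-refl
    where
    B = available X
    minB : ∀ {b} → b ∈ B → ∀ {u} → u ∈ X → ¬ (u ≺ b)
    minB b∈ u∈ u≺b = proj₂ (proj₂ (available⁻ b∈)) (_ , u∈ , u≺b)
    -- The fuel counts the available jobs still missing from the first slot; each round admits one
    -- more.
    go : ∀ fuel F → ∣ B ─ jobs-in F ∣ ≤ fuel → Σ[ F ∈ FirstSlot ℓ X ]
         ((∣ B ∣ < m × B ⊆ jobs-in F) ⊎ (∣ jobs-in F ∣ ≡ m × jobs-in F ⊆ B))
    go fuel F le with nonempty? (B ─ jobs-in F)
    ... | no none = F , decide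
      where
      B⊆S : B ⊆ jobs-in F
      B⊆S {x} x∈B = decidable-stable (x ∈? jobs-in F) λ x∉S → none (x , ∈-─⁺ x∈B x∉S)
      decide : (∣ B ∣ < m × B ⊆ jobs-in F) ⊎ (∣ jobs-in F ∣ ≡ m × jobs-in F ⊆ B)
      -- If there are `m` or more available jobs, they leave no place in the slot for others.
      decide with ∣ B ∣ <? m
      ... | yes B<m = inj₁ (B<m , B⊆S)
      ... | no  B≮m = inj₂ (≤-antisym (fits F) (≤-trans (≮⇒≥ B≮m) (p⊆q⇒∣p∣≤∣q∣ B⊆S)) ,
        λ {x} x∈S → decidable-stable (x ∈? B) λ x∉B → B≮m (<-≤-trans
          (p⊂q⇒∣p∣<∣q∣ (B⊆S , x , x∈S , x∉B)) (fits F)))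
    go zero F le | yes (b , b∈) = ⊥-elim (∣p∣≡0⇒Empty le (b , b∈))
    go (suc fuel) F le | yes (b , b∈) with ∈-─⁻ b∈
    ... | b∈B , b∉S with ∣ jobs-in F ∣ <? m
    ... | yes S<m = go fuel F′ (s≤s⁻¹ (<-≤-trans shrink le))
      where
      S = jobs-in F
      F′ : FirstSlot ℓ X
      F′ = record
        { jobs-in = S ∪ ⁅ b ⁆
        ; within  = λ x∈ → case ∈-∪⁻ S ⁅ b ⁆ x∈ of λ where
            (inj₁ x∈S) → within F x∈S
            (inj₂ x∈b) → subst (_∈ X) (sym (x∈⁅y⁆⇒x≡y b x∈b)) (proj₁ (available⁻ b∈B))
        ; minimal = λ s∈ u∈ u≺s → case ∈-∪⁻ S ⁅ b ⁆ s∈ of λ where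
            (inj₁ s∈S) → minimal F s∈S u∈ u≺s
            (inj₂ s∈b) → minB b∈B u∈ (subst (_ ≺_) (x∈⁅y⁆⇒x≡y b s∈b) u≺s)
        ; fits    = ≤-trans (∣p∪q∣≤ S ⁅ b ⁆)
            (subst (_≤ m) (sym (trans (cong (∣ S ∣ +_) (∣⁅x⁆∣≡1 b)) (+-comm _ 1))) S<m)
        ; rest    = restrict (λ x∈ → ∈-─⁺ (proj₁ (∈-─⁻ x∈))
            λ x∈S → proj₂ (∈-─⁻ {q = S ∪ ⁅ b ⁆} x∈) (p⊆p∪q ⁅ b ⁆ x∈S)) (rest F) }
      shrink : ∣ B ─ (S ∪ ⁅ b ⁆) ∣ < ∣ B ─ S ∣
      shrink = p⊂q⇒∣p∣<∣q∣
        ((λ x∈ → ∈-─⁺ {p = B} {S} (proj₁ (∈-─⁻ {q = S ∪ ⁅ b ⁆} x∈))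
           λ x∈S → proj₂ (∈-─⁻ {p = B} {S ∪ ⁅ b ⁆} x∈) (p⊆p∪q ⁅ b ⁆ x∈S)) ,
         b , b∈ , λ b∈′ → proj₂ (∈-─⁻ {q = S ∪ ⁅ b ⁆} b∈′) (q⊆p∪q S ⁅ b ⁆ (x∈⁅x⁆ b)))
    ... | no S≮m with nonempty? (jobs-in F ─ B)
    ... | no none = F , inj₂ (≤-antisym (fits F) (≮⇒≥ S≮m) ,
          λ {x} x∈S → decidable-stable (x ∈? B) λ x∉B → none (x , ∈-─⁺ x∈S x∉B))
    ... | yes (z , z∈) with ∈-─⁻ z∈
    ... | z∈S , z∉B = go fuel F′ (s≤s⁻¹ (<-≤-trans shrink le))
      where
      S  = jobs-in F
      S′ = (S - z) ∪ ⁅ b ⁆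
      -- A job of the first slot is minimal, so it can fail to be available only by being maximal.
      sink : ¬ NonMaximal X z
      sink nm = z∉B (∈-tabulate⁺ (available? X)
        (within F z∈S , nm , λ (u , u∈ , u≺z) → minimal F z∈S u∈ u≺z))
      back : ∀ {x} → x ∈ S′ → x ∈ S ⊎ x ≡ b
      back x∈ with ∈-∪⁻ (S - z) ⁅ b ⁆ x∈
      ... | inj₁ x∈S = inj₁ (p─q⊆p S ⁅ z ⁆ x∈S)
      ... | inj₂ x∈b = inj₂ (x∈⁅y⁆⇒x≡y b x∈b)
      cover : ∀ {x} → x ∈ X ─ S′ → (x ∈ X ─ S × x ≢ b) ⊎ x ≡ z
      cover {x} x∈ with ∈-─⁻ x∈ | x Finₚ.≟ z
      ... | _ | yes x≡z = inj₂ x≡z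
      ... | x∈X , x∉S′ | no x≢z = inj₁
        (∈-─⁺ x∈X (λ x∈S → x∉S′ (p⊆p∪q ⁅ b ⁆ (x∈p∧x≢y⇒x∈p-y x∈S x≢z))) ,
         λ { refl → x∉S′ (q⊆p∪q (S - z) ⁅ b ⁆ (x∈⁅x⁆ b)) })
      b∈X─S : b ∈ X ─ S
      b∈X─S = ∈-─⁺ (proj₁ (available⁻ b∈B)) b∉S
      F′ : FirstSlot ℓ X
      F′ = record
        { jobs-in = S′
        ; within  = λ x∈ → case back x∈ of λ where
            (inj₁ x∈S)  → within F x∈S
            (inj₂ refl) → proj₁ (available⁻ b∈B)
        ; minimal = λ s∈ u∈ u≺s → case back s∈ of λ where
            (inj₁ s∈S)  → minimal F s∈S u∈ u≺s
            (inj₂ refl) → minB b∈B u∈ u≺s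
        ; fits    = ≤-trans (∣p-x∪⁅y⁆∣≤ S b z∈S) (fits F)
        ; rest    = replace (rest F) b∈X─S (λ u∈ → minB b∈B (p─q⊆p X S u∈))
            (λ u∈ → minimal F z∈S (p─q⊆p X S u∈) , λ z≺u → sink (_ , p─q⊆p X S u∈ , z≺u)) cover }
      shrink : ∣ B ─ S′ ∣ < ∣ B ─ S ∣
      shrink = p⊂q⇒∣p∣<∣q∣ (sub , b , b∈ , λ b∈′ →
        proj₂ (∈-─⁻ {q = S′} b∈′) (q⊆p∪q (S - z) ⁅ b ⁆ (x∈⁅x⁆ b)))
        where
        sub : B ─ S′ ⊆ B ─ S
        sub {x} x∈ with ∈-─⁻ x∈
        ... | x∈B , x∉S′ = ∈-─⁺ x∈B λ x∈S → x∉S′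
          (p⊆p∪q ⁅ b ⁆ (x∈p∧x≢y⇒x∈p-y x∈S λ { refl → z∉B x∈B }))

  -- What shows that the recursion with this `A` yields at most `ℓ`: `after` dominates both terms of
  -- the maximum, 1 + f U by `room` and the rounded-up quotient by `capacity`.
  record Split (ℓ : ℕ) (X A : Subset n) : Set where
    field
      {before after last} : ℕ
      lower-part : Sch before (lower X A)
      upper-part : Sch last (upper X A)
      room       : suc last ≤ after
      capacity   : ∣ X ∣ ∸ ∣ lower X A ∣ ≤ after * m
      total      : before + after ≤ ℓ

  -- The form that passes through the induction over slots: `full` records that the lower part fills
  -- its slots completely, from which `capacity` of a `Split` follows by counting.
  record FullSplit (ℓ : ℕ) (X : Subset n) : Set where
    field
      antichain  : Subset n
      small      : ∣ antichain ∣ < m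
      inside-X   : antichain ⊆ X
      before     : ℕ
      last       : ℕ
      lower-part : Sch before (lower X antichain)
      full       : ∣ lower X antichain ∣ ≡ before * m
      upper-part : Sch last (upper X antichain)
      total      : before + suc last ≤ ℓ

  fullSplit : ∀ {ℓ X} → 0 < m → Sch ℓ X → Nonempty X → FullSplit ℓ X
  fullSplit 0<m (finished e) ne = ⊥-elim (e ne)
  fullSplit {suc ℓ} {X} 0<m (slot S S⊆X min ≤m r) ne
    with saturate (record { jobs-in = S ; within = S⊆X ; minimal = min ; fits = ≤m ; rest = r })
  ... | F , inj₁ (B<m , B⊆S) = record
    { antichain  = B
    ; small      = B<m
    ; inside-X   = λ x∈ → proj₁ (available⁻ x∈)
    ; before     = 0
    ; last       = ℓ
    ; lower-part = finished none
    ; full       = Empty⇒∣p∣≡0 none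
    ; upper-part = restrict sub (rest F)
    ; total      = ≤-refl }
    where
    B = available X
    -- A non-maximal job is minimal, thus in `B`, or has a minimal job below it, which is then
    -- non-maximal and in `B`.
    none : Empty (lower X B)
    none (v , v∈) with lower⁻ v∈
    ... | v∈X , nm , v∉B , ¬ab with hasMinimal X v∈X
    ... | b , b∈X , b-min , inj₁ refl =
      v∉B (∈-tabulate⁺ (available? X) (v∈X , nm , λ (u , u∈ , u≺b) → b-min u∈ u≺b))
    ... | b , b∈X , b-min , inj₂ b≺v = ¬ab (b , ∈-tabulate⁺ (available? X)
      (b∈X , (v , v∈X , b≺v) , λ (u , u∈ , u≺b) → b-min u∈ u≺b) , b∈X , b≺v)
    sub : upper X B ⊆ X ─ jobs-in F
    sub v∈ with upper⁻ v∈
    ... | v∈X , a , _ , a∈X , a≺v = ∈-─⁺ v∈X λ v∈S → minimal F v∈S a∈X a≺v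
  ... | F , inj₂ (S≡m , S⊆B) = extendSplit (fullSplit 0<m (rest F) ne′)
    where
    S₁ = jobs-in F
    X₁ = X ─ S₁
    notIn : ∀ {u v} → u ∈ X → u ≺ v → v ∉ S₁
    notIn u∈ u≺v v∈ = minimal F v∈ u∈ u≺v
    -- As `0 < m` the slot holds a job. It is non-maximal, and its successor cannot run in the same
    -- slot.
    ne′ : Nonempty X₁
    ne′ with nonempty? S₁
    ... | no e = ⊥-elim (<-irrefl (trans (sym (Empty⇒∣p∣≡0 e)) S≡m) 0<m)
    ... | yes (s , s∈) with available⁻ (S⊆B s∈)
    ...   | s∈X , (w , w∈X , s≺w) , _ = w , ∈-─⁺ w∈X (notIn s∈X s≺w)
    extendSplit : FullSplit ℓ X₁ → FullSplit (suc ℓ) X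
    extendSplit sp = record
      { antichain  = A
      ; small      = small
      ; inside-X   = λ x∈ → p─q⊆p X S₁ (inside-X x∈)
      ; before     = suc before
      ; last       = last
      ; lower-part = slot S₁ S⊆L (λ s∈ u∈ → minimal F s∈ (proj₁ (lower⁻ u∈))) (fits F)
                (subst (Sch before) (sym L─S) lower-part)
      ; full       = begin
          ∣ lower X A ∣ ≡⟨ sym (∣p─q∣+∣q∣ (lower X A) S₁ S⊆L) ⟩
          ∣ lower X A ─ S₁ ∣ + ∣ S₁ ∣ ≡⟨ cong₂ _+_ (trans (cong ∣_∣ L─S) full) S≡m ⟩
          before * m + m ≡⟨ +-comm (before * m) m ⟩
          m + before * m ∎
      ; upper-part = restrict U⊆ upper-part
      ; total      = s≤s total }
      where
      open FullSplit sp renaming (antichain to A)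
      open ≡-Reasoning
      S⊆L : S₁ ⊆ lower X A
      S⊆L s∈ with available⁻ (S⊆B s∈)
      ... | s∈X , nm , _ = lower⁺ (s∈X , nm , (λ s∈A → proj₂ (∈-─⁻ {q = S₁} (inside-X s∈A)) s∈) ,
        λ (a , _ , a∈X , a≺s) → minimal F s∈ a∈X a≺s)
      ⇒ : lower X A ─ S₁ ⊆ lower X₁ A
      ⇒ v∈ with ∈-─⁻ v∈
      ... | v∈L , v∉S with lower⁻ v∈L
      ... | v∈X , (w , w∈X , v≺w) , v∉A , ¬ab = lower⁺
        (∈-─⁺ v∈X v∉S , (w , ∈-─⁺ w∈X (notIn v∈X v≺w) , v≺w) , v∉A ,
         λ (a , a∈A , a∈X , a≺v) → ¬ab (a , a∈A , p─q⊆p X S₁ a∈X , a≺v))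
      ⇐ : lower X₁ A ⊆ lower X A ─ S₁
      ⇐ v∈ with lower⁻ v∈
      ... | v∈X , (w , w∈X , v≺w) , v∉A , ¬ab = ∈-─⁺ (lower⁺
        (p─q⊆p X S₁ v∈X , (w , p─q⊆p X S₁ w∈X , v≺w) , v∉A ,
         λ (a , a∈A , _ , a≺v) → ¬ab (a , a∈A , inside-X a∈A , a≺v))) (proj₂ (∈-─⁻ {q = S₁} v∈X))
      -- Removing `S₁` makes no job maximal, since a successor of a job of `X` never lies in the
      -- minimal set `S₁`.
      L─S : lower X A ─ S₁ ≡ lower X₁ A
      L─S = ⊆-antisym ⇒ ⇐
      U⊆ : upper X A ⊆ upper X₁ A
      U⊆ v∈ with upper⁻ v∈
      ... | v∈X , a , a∈A , a∈X , a≺v =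
        upper⁺ (∈-─⁺ v∈X (notIn a∈X a≺v) , a , a∈A , inside-X a∈A , a≺v)

  split : ∀ {ℓ X} → 0 < m → Sch ℓ X → Nonempty X → ∃[ A ] (∣ A ∣ < m × Split ℓ X A)
  split {ℓ} {X} 0<m s ne = antichain , small , record
    { lower-part = lower-part
    ; upper-part = upper-part
    ; room       = +-cancelˡ-≤ before _ _ (≤-trans total (≤-reflexive (sym before+)))
    -- The lower part has exactly `before * m` jobs and `X` at most `ℓ * m`, so what remains fits
    -- into `ℓ ∸ before` slots.
    ; capacity   = begin
        ∣ X ∣ ∸ ∣ lower X antichain ∣ ≡⟨ cong (∣ X ∣ ∸_) full ⟩
        ∣ X ∣ ∸ before * m ≤⟨ ∸-monoˡ-≤ (before * m) (size-bound s) ⟩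
        ℓ * m ∸ before * m ≡⟨ sym (*-distribʳ-∸ m ℓ before) ⟩
        (ℓ ∸ before) * m ∎
    ; total      = ≤-reflexive before+ }
    where
    open FullSplit (fullSplit 0<m s ne)
    open ≤-Reasoning
    before+ : before + (ℓ ∸ before) ≡ ℓ
    before+ = m+[n∸m]≡n (≤-trans (m≤m+n before (suc last)) total)

  peel : ∀ {ℓ X} → Sch (suc ℓ) X → Sch ℓ (lower X ⊥)
  peel {zero} {X} (slot S S⊆X min ≤m (finished e)) = finished λ (v , v∈) →
    case lower⁻ v∈ of λ (v∈X , (w , w∈X , v≺w) , _) →
      e (w , ∈-─⁺ w∈X λ w∈S → min w∈S v∈X v≺w)
  peel {suc ℓ} {X} (slot S S⊆X min ≤m r) =
    slot (S Subset.∩ lower X ⊥) (p∩q⊆q S _)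
      (λ s∈ u∈ → min (p∩q⊆p S _ s∈) (proj₁ (lower⁻ u∈)))
      (≤-trans (∣p∩q∣≤∣p∣ S _) ≤m) (restrict sub (peel r))
    where
    sub : lower X ⊥ ─ (S Subset.∩ lower X ⊥) ⊆ lower (X ─ S) ⊥
    sub v∈ with ∈-─⁻ v∈
    ... | v∈L , v∉ with lower⁻ v∈L
    ... | v∈X , (w , w∈X , v≺w) , _ = lower⁺
      (∈-─⁺ v∈X (λ v∈S → v∉ (x∈p∩q⁺ (v∈S , v∈L))) ,
       (w , ∈-─⁺ w∈X (λ w∈S → min w∈S v∈X v≺w) , v≺w) , (λ v∈ → ∉⊥ v∈) , λ (_ , a∈ , _) → ∉⊥ a∈)

  -- With a machine for every job, all maximal jobs share one final slot; so `after` is 1, and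
  -- nothing lies above `⊥`.
  split-⊥ : ∀ {ℓ X} → n ≤ m → Sch ℓ X → Nonempty X → Split ℓ X ⊥
  split-⊥ n≤m (finished e) ne = ⊥-elim (e ne)
  split-⊥ {suc ℓ} {X} n≤m s ne = record
    { lower-part = peel s
    ; upper-part = finished λ (v , v∈) → case proj₂ (upper⁻ v∈) of λ (a , a∈ , _) → ∉⊥ a∈
    ; room       = ≤-refl
    ; capacity   = ≤-trans (m∸n≤m ∣ X ∣ ∣ lower X ⊥ ∣) (≤-trans (∣p∣≤n X)
                     (≤-trans n≤m (≤-reflexive (sym (+-identityʳ m)))))
    ; total      = ≤-reflexive (+-comm ℓ 1) }

-- Feasible schedules as inductive ones

module Correspondence (I : Instance) where

  open Instance I renaming (jobs to n; machines to m)
  open Scheduling _≺_ isOrder m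

  -- Feasibility relative to a subset of the jobs, so that induction can take away the first slot.
  record Timetable (M : ℕ) (X : Subset n) : Set where
    field
      at         : Fin M → Subset n
      separate   : ∀ {i j v} → v ∈ at i → v ∈ at j → i ≡ j
      sound      : ∀ {i v} → v ∈ at i → v ∈ X
      complete   : ∀ {v} → v ∈ X → ∃[ i ] v ∈ at i
      bounded    : ∀ i → ∣ at i ∣ ≤ m
      precedence : ∀ {u v i j} → u ∈ at i → v ∈ at j → u ≺ v → i Fin.< j

  toTimetable : ∀ {M X} → Sch M X → Timetable M X
  toTimetable (finished e) = record
    { at = λ () ; separate = λ { {()} } ; sound = λ { {()} } ; complete = λ v∈ → ⊥-elim (e (_ , v∈))
    ; bounded = λ () ; precedence = λ { {i = ()} } }
  toTimetable {suc M} {X} (slot S S⊆X min ≤m r) = record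
    { at = at′ ; separate = λ {i} → sep {i} ; sound = λ {i} → snd {i}
    ; complete = cmp ; bounded = bnd ; precedence = λ {_} {_} {i} → prec {i = i} }
    where
    open Timetable (toTimetable r)
    at′ : Fin (suc M) → Subset n
    at′ zero    = S
    at′ (suc i) = at i
    sep : ∀ {i j v} → v ∈ at′ i → v ∈ at′ j → i ≡ j
    sep {zero}  {zero}  _  _  = refl
    sep {zero}  {suc j} v∈ w∈ = ⊥-elim (proj₂ (∈-─⁻ {q = S} (sound w∈)) v∈)
    sep {suc i} {zero}  v∈ w∈ = ⊥-elim (proj₂ (∈-─⁻ {q = S} (sound v∈)) w∈)
    sep {suc i} {suc j} v∈ w∈ = cong suc (separate v∈ w∈)
    snd : ∀ {i v} → v ∈ at′ i → v ∈ X
    snd {zero}  v∈ = S⊆X v∈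
    snd {suc i} v∈ = p─q⊆p X S (sound v∈)
    cmp : ∀ {v} → v ∈ X → ∃[ i ] v ∈ at′ i
    cmp {v} v∈ with v ∈? S
    ... | yes v∈S = zero , v∈S
    ... | no  v∉S with complete (∈-─⁺ v∈ v∉S)
    ...   | i , v∈i = suc i , v∈i
    bnd : ∀ i → ∣ at′ i ∣ ≤ m
    bnd zero    = ≤m
    bnd (suc i) = bounded i
    prec : ∀ {u v i j} → u ∈ at′ i → v ∈ at′ j → u ≺ v → i Fin.< j
    prec {i = zero}  {zero}  u∈ v∈ u≺v = ⊥-elim (min v∈ (S⊆X u∈) u≺v)
    prec {i = zero}  {suc j} u∈ v∈ u≺v = s≤s z≤n
    prec {i = suc i} {zero}  u∈ v∈ u≺v = ⊥-elim (min v∈ (snd {suc i} u∈) u≺v)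
    prec {i = suc i} {suc j} u∈ v∈ u≺v = s≤s (precedence u∈ v∈ u≺v)

  fromTimetable : ∀ {M X} → Timetable M X → Sch M X
  fromTimetable {zero}  T = finished λ (v , v∈) → case Timetable.complete T v∈ of λ ()
  fromTimetable {suc M} {X} T = slot (at zero) sound first (bounded zero) (fromTimetable (record
    { at         = λ i → at (suc i)
    ; separate   = λ v∈ w∈ → Finₚ.suc-injective (separate v∈ w∈)
    ; sound      = λ v∈ → ∈-─⁺ (sound v∈) λ v∈′ → case separate v∈ v∈′ of λ ()
    ; complete   = λ v∈ → cmp (∈-─⁻ v∈)
    ; bounded    = λ i → bounded (suc i)
    ; precedence = λ u∈ v∈ u≺v → s≤s⁻¹ (precedence u∈ v∈ u≺v) }))
    where
    open Timetable T
    first : Minimal (at zero) X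
    first s∈ u∈ u≺s with complete u∈
    ... | i , u∈i = case precedence u∈i s∈ u≺s of λ ()
    cmp : ∀ {v} → v ∈ X × v ∉ at zero → ∃[ i ] v ∈ at (suc i)
    cmp (v∈ , v∉) with complete v∈
    ... | zero  , v∈0 = ⊥-elim (v∉ v∈0)
    ... | suc i , v∈i = i , v∈i

  Sch⇒HasSchedule : ∀ {M} → Sch M ⊤ → HasSchedule I M
  Sch⇒HasSchedule s = at , record
    { disjoint   = λ i j i≢j (v , v∈) → i≢j (separate (p∩q⊆p (at i) (at j) v∈) (p∩q⊆q (at i) (at j) v∈))
    ; covering   = λ v → complete ∈⊤
    ; capacity   = bounded
    ; precedence = precedence }
    where open Timetable (toTimetable s)

  HasSchedule⇒Sch : ∀ {M} → HasSchedule I M → Sch M ⊤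
  HasSchedule⇒Sch (T , feasible) = fromTimetable (record
    { at         = T
    ; separate   = λ {i} {j} v∈ w∈ → decidable-stable (i Finₚ.≟ j)
                     λ i≢j → disjoint i j i≢j (_ , x∈p∩q⁺ (v∈ , w∈))
    ; sound      = λ _ → ∈⊤
    ; complete   = λ {v} _ → covering v
    ; bounded    = capacity
    ; precedence = precedence })
    where open IsFeasible feasible

-- Counting the sets met by the recursion

unique-length : ∀ {A : Set} {xs ys : List A} → Unique xs → (∀ {x} → x ∈ₗ xs → x ∈ₗ ys) →
                length xs ≤ length ys
unique-length [] _ = z≤n
unique-length {A} {x ∷ xs} {ys} (x∉xs ∷ u) sub with ∈-∃++ (sub (Any.here refl))
... | as , bs , refl = ≤-trans (s≤s (unique-length u sub′))
  (≤-reflexive (begin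
    suc (length (as ++ bs)) ≡⟨ cong suc (Listₚ.length-++ as) ⟩
    suc (length as + length bs) ≡⟨ sym (+-suc (length as) (length bs)) ⟩
    length as + suc (length bs) ≡⟨ sym (Listₚ.length-++ as) ⟩
    length (as ++ x ∷ bs) ∎))
  where
  open ≡-Reasoning
  sub′ : ∀ {y} → y ∈ₗ xs → y ∈ₗ as ++ bs
  sub′ {y} y∈ with ∈-++⁻ as (sub (Any.there y∈))
  ... | inj₁ y∈as = ∈-++⁺ˡ y∈as
  ... | inj₂ (Any.here refl) = ⊥-elim (All.lookup x∉xs y∈ refl)
  ... | inj₂ (Any.there y∈bs) = ∈-++⁺ʳ as y∈bs

-- Pascal's recursion, made for counting. The program produces the same sets as `grown`, in another
-- order, and only the lengths have to be compared.
smallSets : ∀ v → ℕ → List (Subset v)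
smallSets zero    j       = [] ∷ []
smallSets (suc v) zero    = List.map (false ∷_) (smallSets v zero)
smallSets (suc v) (suc j) =
  List.map (false ∷_) (smallSets v (suc j)) ++ List.map (true ∷_) (smallSets v j)

∈-smallSets : ∀ {v} (A : Subset v) j → ∣ A ∣ ≤ j → A ∈ₗ smallSets v j
∈-smallSets []          j       le       = Any.here refl
∈-smallSets (false ∷ A) zero    le       = ∈-map⁺ (false ∷_) (∈-smallSets A zero le)
∈-smallSets (false ∷ A) (suc j) le       = ∈-++⁺ˡ (∈-map⁺ (false ∷_) (∈-smallSets A (suc j) le))
∈-smallSets (true ∷ A)  (suc j) (s≤s le) =
  ∈-++⁺ʳ (List.map (false ∷_) (smallSets _ (suc j))) (∈-map⁺ (true ∷_) (∈-smallSets A j le))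

∣smallSets∣≥1 : ∀ v j → 1 ≤ length (smallSets v j)
∣smallSets∣≥1 zero    j       = ≤-refl
∣smallSets∣≥1 (suc v) zero    =
  subst (1 ≤_) (sym (Listₚ.length-map (false ∷_) (smallSets v 0))) (∣smallSets∣≥1 v 0)
∣smallSets∣≥1 (suc v) (suc j) = subst (1 ≤_)
  (sym (Listₚ.length-++ (List.map (false ∷_) (smallSets v (suc j)))))
  (≤-trans (subst (1 ≤_) (sym (Listₚ.length-map (false ∷_) (smallSets v (suc j)))) (∣smallSets∣≥1 v (suc j)))
           (m≤m+n _ _))

-- The order in which the program lists the sets of at most K elements.

grow : ∀ {v} → ℕ → List (Subset v) → List (Subset (suc v))
grow K As = List.map (false ∷_) As ++ List.map (true ∷_) (List.filter (λ A → ∣ A ∣ <? K) As)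

grown : ∀ v → ℕ → List (Subset v)
grown zero    K = [] ∷ []
grown (suc v) K = grow K (grown v K)

∈-grown : ∀ {v K} (A : Subset v) → ∣ A ∣ ≤ K → A ∈ₗ grown v K
∈-grown []          le = Any.here refl
∈-grown (false ∷ A) le = ∈-++⁺ˡ (∈-map⁺ (false ∷_) (∈-grown A le))
∈-grown {suc v} {K} (true ∷ A) le = ∈-++⁺ʳ (List.map (false ∷_) (grown v K))
  (∈-map⁺ (true ∷_) (∈-filter⁺ (λ A → ∣ A ∣ <? K) (∈-grown A (<⇒≤ le)) le))

grown-small : ∀ {v K} {A : Subset v} → A ∈ₗ grown v K → ∣ A ∣ ≤ K
grown-small {zero}  (Any.here refl) = z≤n
grown-small {suc v} {K} A∈ with ∈-++⁻ (List.map (false ∷_) (grown v K)) A∈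
... | inj₁ A∈₁ with ∈-map⁻ (false ∷_) A∈₁
...   | A′ , A′∈ , refl = grown-small A′∈
grown-small {suc v} {K} A∈ | inj₂ A∈₂ with ∈-map⁻ (true ∷_) A∈₂
...   | A′ , A′∈ , refl = proj₂ (∈-filter⁻ (λ A → ∣ A ∣ <? K) {xs = grown v K} A′∈)

grown-unique : ∀ v K → Unique (grown v K)
grown-unique zero    K = All.[] ∷ []
grown-unique (suc v) K = Uniqueₚ.++⁺
  (Uniqueₚ.map⁺ (λ { refl → refl }) (grown-unique v K))
  (Uniqueₚ.map⁺ (λ { refl → refl }) (Uniqueₚ.filter⁺ (λ A → ∣ A ∣ <? K) (grown-unique v K)))
  λ (p , q) → case ∈-map⁻ (false ∷_) p , ∈-map⁻ (true ∷_) q of λ { ((_ , _ , refl) , (_ , _ , ())) }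

∣grown∣≤ : ∀ v K → length (grown v K) ≤ length (smallSets v K)
∣grown∣≤ v K = unique-length (grown-unique v K) (λ {A} A∈ → ∈-smallSets A K (grown-small A∈))

-- The loops that build the list carry the single bound `lists`, which must therefore cover all
-- intermediate lists.
∣grown∣-mono : ∀ {v w} K → v ≤ w → length (grown v K) ≤ length (grown w K)
∣grown∣-mono K v≤w = go (≤⇒≤′ v≤w)
  where
  go : ∀ {v w} → v ≤′ w → length (grown v K) ≤ length (grown w K)
  go ≤′-refl = ≤-refl
  go {v} {suc w} (≤′-step v≤w) = ≤-trans (go v≤w) (begin
    length (grown w K) ≡⟨ sym (Listₚ.length-map (false ∷_) (grown w K)) ⟩
    length (List.map (false ∷_) (grown w K)) ≤⟨ m≤m+n _ (length added) ⟩
    length (List.map (false ∷_) (grown w K)) + length added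
                ≡⟨ sym (Listₚ.length-++ (List.map (false ∷_) (grown w K))) ⟩
    length (grown (suc w) K) ∎)
    where
    open ≤-Reasoning
    added : List (Subset (suc w))
    added = List.map (true ∷_) (List.filter (λ A → ∣ A ∣ <? K) (grown w K))

length-product : ∀ {A B C : Set} (f : A → B → C) xs ys →
                 length (List.cartesianProductWith f xs ys) ≡ length xs * length ys
length-product f []       ys = refl
length-product f (x ∷ xs) ys = trans (Listₚ.length-++ (List.map (f x) ys))
  (cong₂ _+_ (Listₚ.length-map (f x) ys) (length-product f xs ys))

-- Small families of sets closed under the recursion

module Families {n : ℕ} (_≺_ : Fin n → Fin n → Set)
                (order : IsDecStrictPartialOrder _≡_ _≺_) (m : ℕ) where

  open Scheduling _≺_ order m
  open Decomposition _≺_ order m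

  -- Membership is a predicate because closure is proved from a description of a set, not from its
  -- place in a list; the list serves to bound the length of the queue.
  record Family (As : List (Subset n)) (bound : ℕ) : Set₁ where
    field
      Member       : Subset n → Set
      top          : Member ⊤
      lower-closed : ∀ {X A} → A ∈ₗ As → Member X → Member (lower X A)
      upper-closed : ∀ {X A} → A ∈ₗ As → Member X → Member (upper X A)
      members      : List (Subset n)
      enumerated   : ∀ {X} → Member X → X ∈ₗ members
      bounded      : length members ≤ bound

  above : Subset n → Subset n
  above B = tabulateSet (λ v → Finₚ.any? λ b → (b ∈? B) ×-dec (b ≺? v))

  above⁻ : ∀ {B v} → v ∈ above B → ∃[ b ] (b ∈ B × b ≺ v)
  above⁻ {B} = ∈-tabulate⁻ (λ v → Finₚ.any? λ b → (b ∈? B) ×-dec (b ≺? v))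

  above⁺ : ∀ {B v} → ∃[ b ] (b ∈ B × b ≺ v) → v ∈ above B
  above⁺ {B} = ∈-tabulate⁺ (λ v → Finₚ.any? λ b → (b ∈? B) ×-dec (b ≺? v))

  below? : ∀ Z v → Dec (∃[ z ] (z ∈ Z × (v ≡ z ⊎ v ≺ z)))
  below? Z v = Finₚ.any? λ z → (z ∈? Z) ×-dec ((v Finₚ.≟ z) ⊎-dec (v ≺? z))

  below : Subset n → Subset n
  below Z = tabulateSet (below? Z)

  maximals : Subset n → Subset n
  maximals X = tabulateSet (λ v → (v ∈? X) ×-dec ¬? (nonMaximal? X v))

  maximals⁻ : ∀ {X v} → v ∈ maximals X → v ∈ X × ¬ NonMaximal X v
  maximals⁻ {X} = ∈-tabulate⁻ (λ v → (v ∈? X) ×-dec ¬? (nonMaximal? X v))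

  module Layers (s k : ℕ) where

    -- Candidates for `base` after at most `d` passages to the lower part, starting from everything
    -- or from a down-set generated by at most `s` jobs. The layers are cumulative, so the last one
    -- contains them all.
    layer : ℕ → List (Subset n)
    layer zero    = ⊤ ∷ List.map below (smallSets n s)
    layer (suc d) = layer d ++ List.cartesianProductWith lower (layer d) (smallSets n k)

    caps : List (Subset n)
    caps = ⊤ ∷ List.map above (smallSets n k)

    ∣layer∣ : ∀ d → length (layer d) ≡ suc (length (smallSets n s)) * suc (length (smallSets n k)) ^ d
    ∣layer∣ zero    = trans (cong suc (Listₚ.length-map below (smallSets n s))) (sym (*-identityʳ _))
    ∣layer∣ (suc d) = begin
      length (layer (suc d)) ≡⟨ Listₚ.length-++ (layer d) ⟩
      length (layer d) + _ ≡⟨ cong (length (layer d) +_)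
                (length-product lower (layer d) (smallSets n k)) ⟩
      length (layer d) + length (layer d) * b ≡⟨ cong (λ l → l + l * b) (∣layer∣ d) ⟩
      a * suc b ^ d + a * suc b ^ d * b ≡⟨ regroup a (suc b ^ d) b ⟩
      a * suc b ^ suc d ∎
      where
      open ≡-Reasoning
      a = suc (length (smallSets n s))
      b = length (smallSets n k)
      regroup : ∀ a x b → a * x + a * x * b ≡ a * (suc b * x)
      regroup = solve-∀

    layer-mono : ∀ {d e X} → d ≤′ e → X ∈ₗ layer d → X ∈ₗ layer e
    layer-mono ≤′-refl       X∈ = X∈
    layer-mono (≤′-step d≤e) X∈ = ∈-++⁺ˡ (layer-mono d≤e X∈)

    -- In `fuel`, each passage to the lower part is paid for by `suc s` jobs lost from `base`. The
    -- extra `suc s` on the right pays for the first passage after a renaming, which may lose few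
    -- jobs.
    record Named (X : Subset n) : Set where
      field
        depth     : ℕ
        base cap  : Subset n
        in-layer  : base ∈ₗ layer depth
        in-caps   : cap ∈ₗ caps
        base-down : ∀ {u v} → v ∈ base → u ≺ v → u ∈ base
        cap-up    : ∀ {u v} → u ∈ cap → u ≺ v → v ∈ cap
        fuel      : depth * suc s + ∣ base ∣ ≤ n + suc s
        to        : ∀ {v} → v ∈ X → v ∈ base × v ∈ cap
        from      : ∀ {v} → v ∈ base → v ∈ cap → v ∈ X

    top-named : Named ⊤
    top-named = record
      { depth = 0 ; base = ⊤ ; cap = ⊤ ; in-layer = Any.here refl ; in-caps = Any.here refl
      ; base-down = λ _ _ → ∈⊤ ; cap-up = λ _ _ → ∈⊤
      ; fuel = ≤-trans (∣p∣≤n (⊤ {n})) (m≤m+n n (suc s)) ; to = λ _ → ∈⊤ , ∈⊤ ; from = λ _ _ → ∈⊤ }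

    -- The old cap disappears: it is closed upwards and contains A ∩ X, hence everything above A ∩
    -- X. Nested passages to the upper part thus need one cap only.
    upper-named : ∀ {X A} → ∣ A ∣ ≤ k → Named X → Named (upper X A)
    upper-named {X} {A} ∣A∣≤k N = record
      { depth = depth ; base = base ; cap = above B ; in-layer = in-layer
      ; in-caps = Any.there (∈-map⁺ above (∈-smallSets B k (≤-trans (∣p∩q∣≤∣p∣ A X) ∣A∣≤k)))
      ; base-down = base-down
      ; cap-up = λ u∈ u≺v → case above⁻ u∈ of λ (b , b∈ , b≺u) → above⁺ (b , b∈ , ≺-trans b≺u u≺v)
      ; fuel = fuel
      ; to = λ v∈ → case upper⁻ v∈ of λ (v∈X , a , a∈A , a∈X , a≺v) →
          proj₁ (to v∈X) , above⁺ (a , x∈p∩q⁺ (a∈A , a∈X) , a≺v)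
      ; from = λ v∈E v∈B → case above⁻ v∈B of λ (b , b∈ , b≺v) →
          let b∈A = p∩q⊆p A X b∈ ; b∈X = p∩q⊆q A X b∈ in
          upper⁺ (from v∈E (cap-up (proj₂ (to b∈X)) b≺v) , b , b∈A , b∈X , b≺v) }
      where
      open Named N
      B = A Subset.∩ X

    -- `lower` acts on the base alone, because the successors that a job of `X` has in the base lie
    -- in the cap and hence in `X`. The set `A` must be cut down to `X`: its jobs in the base but
    -- outside the cap could remove jobs that `lower X A` retains.
    descend : ∀ {X A} → ∣ A ∣ ≤ k → (N : Named X) →
              suc (Named.depth N) * suc s + ∣ lower (Named.base N) (A Subset.∩ X) ∣ ≤ n + suc s →
              Named (lower X A)
    descend {X} {A} ∣A∣≤k N fuel′ = record
      { depth = suc depth ; base = lower base B ; cap = cap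
      ; in-layer = ∈-++⁺ʳ (layer depth) (∈-cartesianProductWith⁺ lower in-layer
          (∈-smallSets B k (≤-trans (∣p∩q∣≤∣p∣ A X) ∣A∣≤k)))
      ; in-caps = in-caps
      ; base-down = down ; cap-up = cap-up ; fuel = fuel′ ; to = to′ ; from = from′ }
      where
      open Named N
      B = A Subset.∩ X
      B⊆base : B ⊆ base
      B⊆base b∈ = proj₁ (to (p∩q⊆q A X b∈))
      down : ∀ {u v} → v ∈ lower base B → u ≺ v → u ∈ lower base B
      down {u} {v} v∈ u≺v with lower⁻ v∈
      ... | v∈E , _ , v∉B , ¬ab = lower⁺ (base-down v∈E u≺v , (v , v∈E , u≺v) ,
        (λ u∈B → ¬ab (u , u∈B , B⊆base u∈B , u≺v)) ,
        λ (b , b∈ , b∈E , b≺u) → ¬ab (b , b∈ , b∈E , ≺-trans b≺u u≺v))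
      to′ : ∀ {v} → v ∈ lower X A → v ∈ lower base B × v ∈ cap
      to′ v∈ with lower⁻ v∈
      ... | v∈X , (w , w∈X , v≺w) , v∉A , ¬ab = lower⁺ (proj₁ (to v∈X) ,
        (w , proj₁ (to w∈X) , v≺w) , (λ v∈B → v∉A (p∩q⊆p A X v∈B)) ,
        λ (b , b∈ , _ , b≺v) → ¬ab (b , p∩q⊆p A X b∈ , p∩q⊆q A X b∈ , b≺v)) , proj₂ (to v∈X)
      from′ : ∀ {v} → v ∈ lower base B → v ∈ cap → v ∈ lower X A
      from′ v∈ v∈S with lower⁻ v∈
      ... | v∈E , (w , w∈E , v≺w) , v∉B , ¬ab = let v∈X = from v∈E v∈S in lower⁺ (v∈X ,
        (w , from w∈E (cap-up v∈S v≺w) , v≺w) , (λ v∈A → v∉B (x∈p∩q⁺ (v∈A , v∈X))) ,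
        λ (a , a∈A , a∈X , a≺v) → ¬ab (a , x∈p∩q⁺ (a∈A , a∈X) , proj₁ (to a∈X) , a≺v))

    lower-named : ∀ {X A} → ∣ A ∣ ≤ k → Named X → Named (lower X A)
    lower-named {X} {A} ∣A∣≤k N with ∣ maximals X ∣ ≤? s
    -- The maximal jobs of `X` are maximal in the base as well, the cap being closed upwards. The
    -- base loses all of them, which are more than `s`.
    ... | no many = descend ∣A∣≤k N (begin
      (suc s + depth * suc s) + ∣ lower base B ∣ ≡⟨ regroup (suc s) (depth * suc s) _ ⟩
      depth * suc s + (∣ lower base B ∣ + suc s) ≤⟨ +-monoʳ-≤ (depth * suc s) lost ⟩
      depth * suc s + ∣ base ∣ ≤⟨ fuel ⟩
      n + suc s ∎)
      where
      open Named N
      open ≤-Reasoning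
      B = A Subset.∩ X
      M = maximals X
      sub : lower base B ⊆ base ─ M
      sub v∈ with lower⁻ v∈
      ... | v∈E , (w , w∈E , v≺w) , _ = ∈-─⁺ v∈E λ v∈M → case maximals⁻ v∈M of λ (v∈X , max) →
        max (w , from w∈E (cap-up (proj₂ (to v∈X)) v≺w) , v≺w)
      regroup : ∀ a b c → (a + b) + c ≡ b + (c + a)
      regroup = solve-∀
      lost : ∣ lower base B ∣ + suc s ≤ ∣ base ∣
      lost = begin
        ∣ lower base B ∣ + suc s ≤⟨ +-mono-≤ (p⊆q⇒∣p∣≤∣q∣ sub) (≰⇒> many) ⟩
        ∣ base ─ M ∣ + ∣ M ∣ ≡⟨ ∣p─q∣+∣q∣ base M (λ v∈ → proj₁ (to (proj₁ (maximals⁻ v∈)))) ⟩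
        ∣ base ∣ ∎
    -- The down-set generated by the maximal jobs of `X` meets the cap in the same set as the base
    -- does: it contains `X`, and it is contained in the base, which is closed downwards. So `X` is
    -- given depth 0 before it descends.
    ... | yes few = descend ∣A∣≤k renamed (begin
      suc s + 0 + ∣ E ∣ ≡⟨ cong (_+ ∣ E ∣) (+-identityʳ (suc s)) ⟩
      suc s + ∣ E ∣ ≤⟨ +-monoʳ-≤ (suc s) (∣p∣≤n E) ⟩
      suc s + n ≡⟨ +-comm (suc s) n ⟩
      n + suc s ∎)
      where
      open Named N
      open ≤-Reasoning
      M = maximals X
      E = lower (below M) (A Subset.∩ X)
      below⁻ : ∀ {v} → v ∈ below M → ∃[ z ] (z ∈ M × (v ≡ z ⊎ v ≺ z))
      below⁻ = ∈-tabulate⁻ (below? M)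
      below⁺ : ∀ {v} → ∃[ z ] (z ∈ M × (v ≡ z ⊎ v ≺ z)) → v ∈ below M
      below⁺ = ∈-tabulate⁺ (below? M)
      renamed : Named X
      renamed = record
        { depth = 0 ; base = below M ; cap = cap
        ; in-layer = Any.there (∈-map⁺ below (∈-smallSets M s few))
        ; in-caps = in-caps
        ; base-down = λ v∈ u≺v → case below⁻ v∈ of λ where
            (z , z∈ , inj₁ refl) → below⁺ (z , z∈ , inj₂ u≺v)
            (z , z∈ , inj₂ v≺z)  → below⁺ (z , z∈ , inj₂ (≺-trans u≺v v≺z))
        ; cap-up = cap-up
        ; fuel = ≤-trans (∣p∣≤n (below M)) (m≤m+n n (suc s))
        ; to = λ v∈X → case hasMaximal X v∈X of λ (z , z∈X , max , v≼z) →
            below⁺ (z , ∈-tabulate⁺ (λ v → (v ∈? X) ×-dec ¬? (nonMaximal? X v)) (z∈X , max) , v≼z) ,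
            proj₂ (to v∈X)
        ; from = λ v∈E v∈S → case below⁻ v∈E of λ where
            (z , z∈ , inj₁ refl) → proj₁ (maximals⁻ z∈)
            (z , z∈ , inj₂ v≺z)  → from (base-down (proj₁ (to (proj₁ (maximals⁻ z∈)))) v≺z) v∈S }

    layered : ∀ h → (∀ d → d * suc s ≤ n + suc s → d ≤ h) →
              Family (grown n k) (suc (length (smallSets n s)) * suc (length (smallSets n k)) ^ h
                * suc (length (smallSets n k)))
    layered h deep = record
      { Member       = Named
      ; top          = top-named
      ; lower-closed = λ A∈ → lower-named (grown-small A∈)
      ; upper-closed = λ A∈ → upper-named (grown-small A∈)
      ; members      = List.cartesianProductWith Subset._∩_ (layer h) caps
      ; enumerated   = λ {X} N → let open Named N in
          subst (_∈ₗ List.cartesianProductWith Subset._∩_ (layer h) caps)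
            (⊆-antisym (λ v∈ → from (p∩q⊆p base cap v∈) (p∩q⊆q base cap v∈)) (λ v∈ → x∈p∩q⁺ (to v∈)))
            (∈-cartesianProductWith⁺ Subset._∩_
              (layer-mono (≤⇒≤′ (deep depth (≤-trans (m≤m+n _ _) fuel))) in-layer) in-caps)
      ; bounded      = ≤-reflexive (trans (length-product Subset._∩_ (layer h) caps)
          (cong₂ _*_ (∣layer∣ h) (cong suc (Listₚ.length-map above (smallSets n k))))) }

  module Levels where

    -- The jobs left after deleting the maximal ones `i` times: all that is met when `⊥` is the only
    -- choice of A.
    level : ℕ → Subset n
    level zero    = ⊤
    level (suc i) = lower (level i) ⊥

    ∣level∣ : ∀ i → i ≤ n → ∣ level i ∣ + i ≤ n
    ∣level∣ zero    _   = ≤-trans (≤-reflexive (+-identityʳ _)) (∣p∣≤n (⊤ {n}))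
    ∣level∣ (suc i) i<n with nonempty? (level i)
    ... | yes ne = ≤-trans (≤-reflexive (+-suc _ i))
      (≤-trans (+-monoˡ-≤ i (∣lower∣< (level i) ⊥ ne)) (∣level∣ i (<⇒≤ i<n)))
    ... | no  e  = subst (_≤ n)
      (sym (cong (_+ suc i) (Empty⇒∣p∣≡0 (λ (v , v∈) → e (v , proj₁ (lower⁻ v∈)))))) i<n

    grown-0 : ∀ {v} {A : Subset v} → A ∈ₗ grown v 0 → A ≡ ⊥
    grown-0 A∈ = Empty-unique (∣p∣≡0⇒Empty (grown-small A∈))

    upper-⊥ : ∀ X → upper X ⊥ ≡ ⊥
    upper-⊥ X = Empty-unique λ (v , v∈) → case proj₂ (upper⁻ v∈) of λ (a , a∈ , _) → ∉⊥ a∈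

    lower-Empty : ∀ {X} A → Empty X → lower X A ≡ ⊥
    lower-Empty A e = Empty-unique λ (v , v∈) → e (v , proj₁ (lower⁻ v∈))

    level-n : ∀ {i} → n ≤ i → level i ≡ ⊥
    level-n {i} n≤i with m≤n⇒m<n∨m≡n n≤i
    ... | inj₂ refl = Empty-unique (∣p∣≡0⇒Empty (+-cancelʳ-≤ n _ 0 (∣level∣ n ≤-refl)))
    level-n {suc i} n≤i | inj₁ (s≤s n≤i′) = trans (cong (λ X → lower X ⊥) (level-n n≤i′))
      (lower-Empty ⊥ (λ (v , v∈) → ∉⊥ v∈))

    levelled : Family (grown n 0) (suc n)
    levelled = record
      { Member       = λ X → ∃[ i ] (i ≤ n × X ≡ level i)
      ; top          = 0 , z≤n , refl
      ; lower-closed = λ { A∈ (i , i≤n , refl) → low A∈ i≤n }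
      -- Upper parts are empty, and so is `level n`, which is counted already.
      ; upper-closed = λ {X} A∈ _ → n , ≤-refl ,
          trans (cong (upper X) (grown-0 A∈)) (trans (upper-⊥ X) (sym (level-n ≤-refl)))
      ; members      = List.applyUpTo level (suc n)
      ; enumerated   = λ { (i , i≤n , refl) → ∈-applyUpTo⁺ level (s≤s i≤n) }
      ; bounded      = ≤-reflexive (Listₚ.length-applyUpTo level (suc n)) }
      where
      low : ∀ {A i} → A ∈ₗ grown n 0 → i ≤ n → ∃[ j ] (j ≤ n × lower (level i) A ≡ level j)
      low {A} {i} A∈ i≤n with m≤n⇒m<n∨m≡n i≤n
      ... | inj₁ i<n  = suc i , i<n , cong (lower (level i)) (grown-0 A∈)
      ... | inj₂ refl = n , ≤-refl , trans (cong (λ X → lower X A) (level-n ≤-refl))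
        (trans (lower-Empty A λ (v , v∈) → ∉⊥ v∈) (sym (level-n ≤-refl)))

-- The program

-- Registers: 0 n, 1 m, 2 and 3 the powers 2 ^ v and 2 ^ v ∸ 1 (v = n after
-- initialisation), 4 the constant 1, 5 and 6 address and length of the list
-- of antichains, 7 the table indexed by codes, 8 and 9 address and length of
-- the queue, 10 to 16 X, A, lower X A, upper X A and the sizes of lower X A,
-- upper X A and X, 17 the bound on the size of A; all others are temporary.

-- The digit that overflows when register 20 is doubled moves to register 21. Subtracting register
-- 3, which is 2 ^ v ∸ 1, leaves a nonzero rest exactly for values of at least 2 ^ v.
popBit : Cmd
popBit = 20 ≔ 20 ⊕ 20 ▸ 22 ≔ 20 ⊖ 3 ▸ cond 22 (20 ≔ 20 ⊖ 2 ▸ 21 ≔ const 1) (21 ≔ const 0)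

-- For the job `v` of the outer loop, register 31 counts its successors in X and register 32 its
-- predecessors in A ∩ X. The addresses 37 and 38 follow row and column `v` of the matrix by adding
-- 1 and n, as the machine cannot multiply.
scanBody : Cmd
scanBody =
  20 ≔ reg 33 ▸ popBit ▸ 33 ≔ reg 20 ▸ 35 ≔ reg 21 ▸
  20 ≔ reg 34 ▸ popBit ▸ 34 ≔ reg 20 ▸ 36 ≔ reg 21 ▸
  40 ≔ load 37 ▸ 41 ≔ load 38 ▸
  cond 35 (31 ≔ 31 ⊕ 40 ▸ cond 36 (32 ≔ 32 ⊕ 41) nop) nop ▸
  37 ≔ 37 ⊕ 4 ▸ 38 ≔ 38 ⊕ 0 ▸ 39 ≔ 39 ⊖ 4

scan : Cmd
scan =
  31 ≔ const 0 ▸ 32 ≔ const 0 ▸ 33 ≔ reg 10 ▸ 34 ≔ reg 11 ▸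
  37 ≔ reg 28 ▸ 38 ≔ reg 29 ▸ 39 ≔ reg 0 ▸ loop jobs 39 scanBody

-- The test for a predecessor in A comes first, since jobs above A are kept out of the lower part.
classify : Cmd
classify =
  12 ≔ 12 ⊕ 12 ▸ 13 ≔ 13 ⊕ 13 ▸
  cond 26 (16 ≔ 16 ⊕ 4 ▸
           cond 32 (13 ≔ 13 ⊕ 4 ▸ 15 ≔ 15 ⊕ 4)
                   (cond 31 (cond 27 nop (12 ≔ 12 ⊕ 4 ▸ 14 ≔ 14 ⊕ 4)) nop))
          nop

childrenBody : Cmd
childrenBody =
  20 ≔ reg 24 ▸ popBit ▸ 24 ≔ reg 20 ▸ 26 ≔ reg 21 ▸
  20 ≔ reg 25 ▸ popBit ▸ 25 ≔ reg 20 ▸ 27 ≔ reg 21 ▸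
  scan ▸ classify ▸ 29 ≔ 29 ⊕ 4 ▸ 28 ≔ 28 ⊕ 0 ▸ 30 ≔ 30 ⊖ 4

children : Cmd
children =
  12 ≔ const 0 ▸ 13 ≔ const 0 ▸ 14 ≔ const 0 ▸ 15 ≔ const 0 ▸ 16 ≔ const 0 ▸
  24 ≔ reg 10 ▸ 25 ≔ reg 11 ▸ 28 ≔ const 0 ▸ 29 ≔ const 0 ▸ 30 ≔ reg 0 ▸
  loop jobs 30 childrenBody

1≤2^ : ∀ k → 1 ≤ 2 ^ k
1≤2^ k = m^n>0 2 k

record Constants (n : ℕ) (σ : State) : Set where
  field
    c0 : regs σ 0 ≡ n
    c2 : regs σ 2 ≡ 2 ^ n
    c3 : regs σ 3 ≡ 2 ^ n ∸ 1
    c4 : regs σ 4 ≡ 1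

still-below : ∀ {u k n} → u + suc k ≡ n → u < n
still-below {u} {k} eq = subst (u <_) eq (subst (u <_) (sym (+-suc u k)) (s≤s (m≤m+n u k)))

-- Computing both children of a set

module Children (ρ : Sizes) where

  open Logic ρ

  popBit-spec : ∀ {k} (X : Subset k) u {σ} → u < k →
                regs σ 2 ≡ 2 ^ k → regs σ 3 ≡ 2 ^ k ∸ 1 → regs σ 20 ≡ shift X u →
                Run popBit σ (λ τ → regs τ 20 ≡ shift X (suc u) × regs τ 21 ≡ bit X u)
  popBit-spec {k} X u {σ} u<k e2 e3 e20 = set▸ (set▸ (branch high low))
    where
    p = 2 ^ k
    s = regs σ 20
    s+s≡ : s + s ≡ bit X u * p + shift X (suc u)
    s+s≡ = trans (cong₂ _+_ e20 e20) (double-shift X u u<k)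
    high : s + s ∸ regs σ 3 ≢ 0 → Run _ _ _
    high nz with bit01 X u
    ... | inj₂ b≡1 = set▸ (set
      (trans (cong₂ _∸_ s+s≡p (trans e2 (sym (+-identityʳ p)))) (m+n∸m≡n (p + 0) _) , sym b≡1))
      where
      s+s≡p : s + s ≡ p + 0 + shift X (suc u)
      s+s≡p = trans s+s≡ (cong (λ b → b * p + shift X (suc u)) b≡1)
    ... | inj₁ b≡0 = ⊥-elim (nz (trans (cong₂ _∸_ (trans s+s≡ (cong (λ b → b * p + shift X (suc u)) b≡0)) e3)
      (m≤n⇒m∸n≡0 (m<n⇒m≤n∸1 (shift< X (suc u))))))
      where
      m<n⇒m≤n∸1 : ∀ {a b} → a < b → a ≤ b ∸ 1
      m<n⇒m≤n∸1 (s≤s le) = le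
    low : s + s ∸ regs σ 3 ≡ 0 → Run _ _ _
    low z with bit01 X u
    ... | inj₁ b≡0 = set (trans s+s≡ (cong (λ b → b * p + shift X (suc u)) b≡0) , sym b≡0)
    ... | inj₂ b≡1 = ⊥-elim (<⇒≱ (s≤s (m∸n≡0⇒m≤n z)) (begin
      suc (regs σ 3) ≡⟨ cong suc e3 ⟩
      suc (p ∸ 1) ≡⟨ m+[n∸m]≡n (1≤2^ k) ⟩
      p ≤⟨ m≤m+n p _ ⟩
      p + (0 + shift X (suc u)) ≡⟨ sym (+-assoc p 0 _) ⟩
      1 * p + shift X (suc u) ≡⟨ cong (λ b → b * p + shift X (suc u)) (sym b≡1) ⟩
      bit X u * p + shift X (suc u) ≡⟨ sym s+s≡ ⟩
      s + s ∎))
      where open ≤-Reasoning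

  module _ {n : ℕ} (n≤ : n ≤ #jobs ρ) (X A : Subset n) where

    successors predecessors : (ℕ → ℕ) → ℕ → ℕ → ℕ
    successors   M v u = bit X u * M (v * n + u)
    predecessors M v u = bit X u * bit A u * M (u * n + v)

    record Scanned (M : ℕ → ℕ) (v : ℕ) (k : ℕ) (σ : State) : Set where
      field
        u    : ℕ
        left : u + k ≡ n
        r31  : regs σ 31 ≡ ∑ (successors M v) u
        r32  : regs σ 32 ≡ ∑ (predecessors M v) u
        r33  : regs σ 33 ≡ shift X u
        r34  : regs σ 34 ≡ shift A u
        r37  : regs σ 37 ≡ v * n + u
        r38  : regs σ 38 ≡ u * n + v

    tally : ∀ {σ M v u} → regs σ 35 ≡ bit X u → regs σ 36 ≡ bit A u →
            regs σ 40 ≡ M (v * n + u) → regs σ 41 ≡ M (u * n + v) →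
            Run (cond 35 (31 ≔ 31 ⊕ 40 ▸ cond 36 (32 ≔ 32 ⊕ 41) nop) nop) σ
                (λ τ → regs τ 31 ≡ regs σ 31 + successors M v u ×
                       regs τ 32 ≡ regs σ 32 + predecessors M v u)
    tally {σ} {M} {v} {u} e35 e36 e40 e41 with bit01 X u
    ... | inj₁ x≡0 rewrite x≡0 = branch (λ nz → ⊥-elim (nz e35))
      λ _ → stop (sym (+-identityʳ _) , sym (+-identityʳ _))
    ... | inj₂ x≡1 rewrite x≡1 = branch
      (λ _ → set▸ (branch
        (λ nz → set (cong (regs σ 31 +_) (trans e40 (sym (+-identityʳ _))) ,
          cong (regs σ 32 +_) (trans e41 (one nz))))
        (λ z → stop (cong (regs σ 31 +_) (trans e40 (sym (+-identityʳ _))) ,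
          trans (sym (+-identityʳ _)) (cong (λ b → regs σ 32 + (b + 0) * M (u * n + v)) (trans (sym z) e36))))))
      (λ z → case trans (sym z) e35 of λ ())
      where
      one : regs σ 36 ≢ 0 → M (u * n + v) ≡ (bit A u + 0) * M (u * n + v)
      one nz with bit01 A u
      ... | inj₁ a≡0 = ⊥-elim (nz (trans e36 a≡0))
      ... | inj₂ a≡1 rewrite a≡1 = sym (+-identityʳ _)

    scan-spec : ∀ {σ v} → Constants n σ → regs σ 10 ≡ code X → regs σ 11 ≡ code A →
                regs σ 28 ≡ v * n → regs σ 29 ≡ v →
                Run scan σ (λ τ → regs τ 31 ≡ ∑ (successors (mem σ) v) n ×
                regs τ 32 ≡ ∑ (predecessors (mem σ) v) n)
    scan-spec {σ} {v} C e10 e11 e28 e29 =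
      set▸ $ set▸ $ set▸ $ set▸ $ set▸ $ set▸ $ set▸ $ weaken
        (for (Scanned (mem σ) v) step n≤ c0 (record
          { u = 0 ; left = refl ; r31 = refl ; r32 = refl ; r33 = e10 ; r34 = e11
          ; r37 = trans e28 (sym (+-identityʳ _)) ; r38 = e29 }))
        λ _ → finish
      where
      open Constants C
      finish : ∀ {τ} → Scanned (mem σ) v 0 τ →
               regs τ 31 ≡ ∑ (successors (mem σ) v) n × regs τ 32 ≡ ∑ (predecessors (mem σ) v) n
      finish {τ} S = subst (λ w → regs τ 31 ≡ ∑ (successors (mem σ) v) w ×
                regs τ 32 ≡ ∑ (predecessors (mem σ) v) w)
                (trans (sym (+-identityʳ u)) left) (r31 , r32)
        where open Scanned S
      step : ∀ k {τ} → Frame scanBody _ τ → regs τ 39 ≡ suc k → Scanned (mem σ) v (suc k) τ →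
             Run scanBody τ (λ τ → regs τ 39 ≡ k × Scanned (mem σ) v k τ)
      step k {τ} f e39 S =
        set▸ $ popBit-spec X u (still-below left)
          (carry f 2 c2) (carry f 3 c3) r33
        then λ g (s20 , s21) → set▸ $ set▸ $ set▸ $ popBit-spec A u (still-below left)
          (carry g 2 (carry f 2 c2))
          (carry g 3 (carry f 3 c3)) (carry g 34 r34)
        then λ h (t20 , t21) →
          let unchanged = trans (keptMem h refl) (trans (keptMem g refl) (keptMem f refl)) in
          set▸ $ set▸ $ set▸ $ set▸ $ tally {M = mem σ} {v} {u}
            (carry h 35 s21) t21
            (cong₂ (λ M a → M a) unchanged (carry h 37 (carry g 37 r37)))
            (cong₂ (λ M a → M a) unchanged (carry h 38 (carry g 38 r38)))
        then λ i (u31 , u32) →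
          let one = carry i 4 (carry h 4 (carry g 4 (carry f 4 c4)))
          in set▸ $ set▸ $ set
            ( cong₂ _∸_ (carry i 39 (carry h 39 (carry g 39 e39))) one
            , record
              { u = suc u ; left = trans (sym (+-suc u k)) left
              ; r31 = trans u31 (cong (_+ _) (carry h 31 (carry g 31 r31)))
              ; r32 = trans u32 (cong (_+ _) (carry h 32 (carry g 32 r32)))
              ; r33 = carry i 33 (carry h 33 s20)
              ; r34 = carry i 34 t20
              ; r37 = trans (cong₂ _+_ (carry i 37 (carry h 37 (carry g 37 r37))) one)
                (trans (+-assoc (v * n) u 1) (cong (v * n +_) (+-comm u 1)))
              ; r38 = trans (cong₂ _+_ (carry i 38 (carry h 38 (carry g 38 r38)))
                (carry i 0 (carry h 0 (carry g 0 (carry f 0 c0)))))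
                (trans (+-comm (u * n + v) n) (sym (+-assoc n (u * n) v))) } )
        where open Scanned S

module Recursion (ρ : Sizes) {n : ℕ} (n≤ : n ≤ #jobs ρ) (_≺_ : Fin n → Fin n → Set)
                 (order : IsDecStrictPartialOrder _≡_ _≺_) (m : ℕ) where

  open Logic ρ
  open Children ρ
  open Scheduling _≺_ order m

  Adjacent : (ℕ → ℕ) → Set
  Adjacent M = ∀ (v u : Fin n) → M (toℕ v * n + toℕ u) ≡ (if does (v ≺? u) then 1 else 0)

  adjacent⁺ : ∀ {M v u} → Adjacent M → v ≺ u → M (toℕ v * n + toℕ u) ≡ 1
  adjacent⁺ {v = v} {u} adj v≺u =
    trans (adj v u) (cong (λ b → if b then 1 else 0) (dec-true (v ≺? u) v≺u))

  adjacent⁻ : ∀ {M v u} → Adjacent M → M (toℕ v * n + toℕ u) ≢ 0 → v ≺ u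
  adjacent⁻ {v = v} {u} adj nz = decidable-stable (v ≺? u) λ v⊀u →
    nz (trans (adj v u) (cong (λ b → if b then 1 else 0) (dec-false (v ≺? u) v⊀u)))

  module _ (X A : Subset n) where

    factorˡ : ∀ {a b} → a * b ≢ 0 → a ≢ 0
    factorˡ nz refl = nz refl

    factorʳ : ∀ a {b} → a * b ≢ 0 → b ≢ 0
    factorʳ a nz refl = nz (*-zeroʳ a)

    successors⇒ : ∀ {M v} → Adjacent M → ∑ (successors n≤ X A M (toℕ v)) n ≢ 0 → NonMaximal X v
    successors⇒ {M} {v} adj nz with ∑≢0⇒∃ _ n nz
    ... | u , u<n , nz′ rewrite sym (Finₚ.toℕ-fromℕ< u<n) =
      fromℕ< u<n , bit⇒∈ _ (factorˡ nz′) , adjacent⁻ {M} adj (factorʳ (bit X (toℕ (fromℕ< u<n))) nz′)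

    successors⇐ : ∀ {M v} → Adjacent M → NonMaximal X v → ∑ (successors n≤ X A M (toℕ v)) n ≢ 0
    successors⇐ {M} adj (w , w∈X , v≺w) = ∃⇒∑≢0 _ n (Finₚ.toℕ<n w)
      λ z → case trans (sym z) (cong₂ _*_ (∈⇒bit w∈X) (adjacent⁺ {M} adj v≺w)) of λ ()

    predecessors⇒ : ∀ {M v} → Adjacent M → ∑ (predecessors n≤ X A M (toℕ v)) n ≢ 0 → Above A X v
    predecessors⇒ {M} {v} adj nz with ∑≢0⇒∃ _ n nz
    ... | u , u<n , nz′ rewrite sym (Finₚ.toℕ-fromℕ< u<n) =
      u′ , bit⇒∈ u′ (factorʳ (bit X (toℕ u′)) (factorˡ nz′)) , bit⇒∈ u′ (factorˡ (factorˡ nz′)) ,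
      adjacent⁻ {M} adj (factorʳ (bit X (toℕ u′) * bit A (toℕ u′)) nz′)
      where u′ = fromℕ< u<n

    predecessors⇐ : ∀ {M v} → Adjacent M → Above A X v → ∑ (predecessors n≤ X A M (toℕ v)) n ≢ 0
    predecessors⇐ {M} adj (a , a∈A , a∈X , a≺v) = ∃⇒∑≢0 _ n (Finₚ.toℕ<n a)
      λ z → case trans (sym z) (cong₂ _*_ (cong₂ _*_ (∈⇒bit a∈X) (∈⇒bit a∈A)) (adjacent⁺ {M} adj a≺v)) of λ ()

    classify-spec : ∀ {σ M} (v : Fin n) → Adjacent M → regs σ 4 ≡ 1 →
      regs σ 26 ≡ bit X (toℕ v) → regs σ 27 ≡ bit A (toℕ v) →
      regs σ 31 ≡ ∑ (successors n≤ X A M (toℕ v)) n →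
      regs σ 32 ≡ ∑ (predecessors n≤ X A M (toℕ v)) n →
      Run classify σ (λ τ → regs τ 12 ≡ regs σ 12 + regs σ 12 + bit (lower X A) (toℕ v)
                × regs τ 13 ≡ regs σ 13 + regs σ 13 + bit (upper X A) (toℕ v)
                × regs τ 14 ≡ regs σ 14 + bit (lower X A) (toℕ v)
                × regs τ 15 ≡ regs σ 15 + bit (upper X A) (toℕ v)
                × regs τ 16 ≡ regs σ 16 + bit X (toℕ v))
    classify-spec {σ} {M} v adj e4 e26 e27 e31 e32 = set▸ $ set▸ $ branch
      (λ in-X → set▸ $ branch
        (λ ab → let v∈U = ∈-X in-X , above-A ab in
          set▸ (set (unlike (λ v∈L → proj₂ (proj₂ (proj₂ (lower⁻ v∈L))) (above-A ab)) , like (upper⁺ v∈U)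
                    , unlike (λ v∈L → proj₂ (proj₂ (proj₂ (lower⁻ v∈L))) (above-A ab)) , like (upper⁺ v∈U)
                    , like (∈-X in-X))))
        (λ ¬ab → let v∉U = λ v∈U → not-above ¬ab (proj₂ (upper⁻ {X} {A} v∈U)) in branch
          (λ nm → branch
            (λ in-A → let v∉L = λ v∈L → proj₁ (proj₂ (proj₂ (lower⁻ {X} {A} v∈L)))
                              (bit⇒∈ v λ z → in-A (trans e27 z)) in
              stop (unlike v∉L , unlike v∉U , unlike v∉L , unlike v∉U , like (∈-X in-X)))
            (λ ¬A → let v∈L = lower⁺ (∈-X in-X , successors⇒ {M} adj (λ z → nm (trans e31 z)) ,
                          (λ v∈A → case trans (sym ¬A) (trans e27 (∈⇒bit v∈A)) of λ ()) , not-above ¬ab) in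
              set▸ (set (like v∈L , unlike v∉U , like v∈L , unlike v∉U , like (∈-X in-X)))))
          (λ ¬nm → let v∉L = λ v∈L → successors⇐ {M} adj (proj₁ (proj₂ (lower⁻ {X} {A} v∈L)))
                           (trans (sym e31) ¬nm) in
            stop (unlike v∉L , unlike v∉U , unlike v∉L , unlike v∉U , like (∈-X in-X)))))
      (λ ¬X → let v∉X = λ v∈X → case trans (sym ¬X) (trans e26 (∈⇒bit v∈X)) of λ () in
        stop (unlike (λ v∈ → v∉X (proj₁ (lower⁻ v∈))) , unlike (λ v∈ → v∉X (proj₁ (upper⁻ v∈))) ,
              unlike (λ v∈ → v∉X (proj₁ (lower⁻ v∈))) , unlike (λ v∈ → v∉X (proj₁ (upper⁻ v∈))) , unlike v∉X))
      where
      ∈-X : regs σ 26 ≢ 0 → v ∈ X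
      ∈-X nz = bit⇒∈ v λ z → nz (trans e26 z)
      above-A : regs σ 32 ≢ 0 → Above A X v
      above-A nz = predecessors⇒ {M} adj λ z → nz (trans e32 z)
      not-above : regs σ 32 ≡ 0 → ¬ Above A X v
      not-above z ab = predecessors⇐ {M} adj ab (trans (sym e32) z)
      like : ∀ {Z a} → v ∈ Z → a + regs σ 4 ≡ a + bit Z (toℕ v)
      like {a = a} v∈Z = cong (a +_) (trans e4 (sym (∈⇒bit v∈Z)))
      unlike : ∀ {Z a} → v ∉ Z → a ≡ a + bit Z (toℕ v)
      unlike {a = a} v∉Z = trans (sym (+-identityʳ a)) (cong (a +_) (sym (∉⇒bit v v∉Z)))

    record Computed (k : ℕ) (σ : State) : Set where
      field
        v    : ℕ
        left : v + k ≡ n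
        r12  : regs σ 12 ≡ horner (bit (lower X A)) v
        r13  : regs σ 13 ≡ horner (bit (upper X A)) v
        r14  : regs σ 14 ≡ ∑ (bit (lower X A)) v
        r15  : regs σ 15 ≡ ∑ (bit (upper X A)) v
        r16  : regs σ 16 ≡ ∑ (bit X) v
        r24  : regs σ 24 ≡ shift X v
        r25  : regs σ 25 ≡ shift A v
        r28  : regs σ 28 ≡ v * n
        r29  : regs σ 29 ≡ v

    record Result (σ : State) : Set where
      field
        r12  : regs σ 12 ≡ code (lower X A)
        r13  : regs σ 13 ≡ code (upper X A)
        r14  : regs σ 14 ≡ ∣ lower X A ∣
        r15  : regs σ 15 ≡ ∣ upper X A ∣
        r16  : regs σ 16 ≡ ∣ X ∣

    children-spec : ∀ {σ} → Constants n σ → Adjacent (mem σ) →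
                    regs σ 10 ≡ code X → regs σ 11 ≡ code A → Run children σ Result
    children-spec {σ} C adj e10 e11 =
      set▸ $ set▸ $ set▸ $ set▸ $ set▸ $ set▸ $ set▸ $ set▸ $ set▸ $ set▸ $ weaken
        (for Computed step n≤ c0 (record
          { v = 0 ; left = refl ; r12 = refl ; r13 = refl ; r14 = refl ; r15 = refl ; r16 = refl
          ; r24 = e10 ; r25 = e11 ; r28 = refl ; r29 = refl }))
        (λ _ → finish)
      where
      open Constants C
      finish : ∀ {τ} → Computed 0 τ → Result τ
      finish K with trans (sym (+-identityʳ (Computed.v K))) (Computed.left K)
      ... | refl = record
        { r12 = trans r12 (horner-code (lower X A)) ; r13 = trans r13 (horner-code (upper X A))
        ; r14 = trans r14 (∑-size (lower X A)) ; r15 = trans r15 (∑-size (upper X A))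
        ; r16 = trans r16 (∑-size X) }
        where open Computed K
      step : ∀ k {τ} → Frame childrenBody _ τ → regs τ 30 ≡ suc k → Computed (suc k) τ →
             Run childrenBody τ (λ τ → regs τ 30 ≡ k × Computed k τ)
      step k {τ} f e30 K =
        set▸ $ popBit-spec X v v<n (carry f 2 c2) (carry f 3 c3) r24
        then λ g (s20 , s21) → set▸ $ set▸ $ set▸ $ popBit-spec A v v<n
          (carry g 2 (carry f 2 c2))
          (carry g 3 (carry f 3 c3)) (carry g 25 r25)
        then λ {τ₂} h (t20 , t21) → set▸ $ set▸ $ scan-spec n≤ X A
          (record { c0 = carry h 0 (carry g 0 (carry f 0 c0))
                  ; c2 = carry h 2 (carry g 2 (carry f 2 c2))
                  ; c3 = carry h 3 (carry g 3 (carry f 3 c3))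
                  ; c4 = carry h 4 (carry g 4 (carry f 4 c4)) })
          (carry h 10 (carry g 10 (carry f 10 e10)))
          (carry h 11 (carry g 11 (carry f 11 e11)))
          (carry h 28 (carry g 28 r28))
          (carry h 29 (carry g 29 r29))
        then λ i (u31 , u32) →
          let unchanged = trans (keptMem h refl) (trans (keptMem g refl) (keptMem f refl))
              one = carry i 4 (carry h 4 (carry g 4 (carry f 4 c4)))
          in classify-spec {M = mem τ₂} v′ (subst Adjacent (sym unchanged) adj) one
            (trans (carry i 26 (carry h 26 s21)) (cong (bit X) (sym toℕ-v′)))
            (trans (carry i 27 t21) (cong (bit A) (sym toℕ-v′)))
            (trans u31 (cong (λ w → ∑ (successors n≤ X A (mem τ₂) w) n) (sym toℕ-v′)))
            (trans u32 (cong (λ w → ∑ (predecessors n≤ X A (mem τ₂) w) n) (sym toℕ-v′)))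
        then λ j (u12 , u13 , u14 , u15 , u16) →
          let one′ = carry j 4 one
          in set▸ $ set▸ $ set
            ( cong₂ _∸_ (carry j 30 (carry i 30 (carry h 30 (carry g 30 e30)))) one′
            , record
              { v = suc v ; left = trans (sym (+-suc v k)) left
              ; r12 = trans u12 (cong₂ (λ a w → a + a + bit (lower X A) w)
                  (carry i 12 (carry h 12 (carry g 12 r12))) toℕ-v′)
              ; r13 = trans u13 (cong₂ (λ a w → a + a + bit (upper X A) w)
                  (carry i 13 (carry h 13 (carry g 13 r13))) toℕ-v′)
              ; r14 = trans u14 (cong₂ (λ a w → a + bit (lower X A) w)
                  (carry i 14 (carry h 14 (carry g 14 r14))) toℕ-v′)
              ; r15 = trans u15 (cong₂ (λ a w → a + bit (upper X A) w)
                  (carry i 15 (carry h 15 (carry g 15 r15))) toℕ-v′)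
              ; r16 = trans u16 (cong₂ (λ a w → a + bit X w)
                  (carry i 16 (carry h 16 (carry g 16 r16))) toℕ-v′)
              ; r24 = carry j 24 (carry i 24 (carry h 24 s20))
              ; r25 = carry j 25 (carry i 25 t20)
              ; r28 = trans (cong₂ _+_
                  (carry j 28 (carry i 28 (carry h 28 (carry g 28 r28))))
                  (carry j 0 (carry i 0 (carry h 0 (carry g 0 (carry f 0 c0))))))
                  (+-comm (v * n) n)
              ; r29 = trans (cong₂ _+_
                  (carry j 29 (carry i 29 (carry h 29 (carry g 29 r29)))) one′)
                  (+-comm v 1) } )
        where
        open Computed K
        v<n = still-below left
        v′ = fromℕ< v<n
        toℕ-v′ = Finₚ.toℕ-fromℕ< v<n

-- Commands that update the table

divideUp : Cmd
-- Repeated truncated subtraction of register 1, which holds m, counts up to the rounded-up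
-- quotient. As m ≥ 1, at most n rounds are needed.
divideUp = 42 ≔ const 0 ▸ 43 ≔ 16 ⊖ 14 ▸ loop jobs 43 (43 ≔ 43 ⊖ 1 ▸ 42 ≔ 42 ⊕ 4)

insert : Cmd
insert =
  46 ≔ 7 ⊕ 44 ▸ 47 ≔ load 46 ▸
  cond 47 nop (47 ≔ 45 ⊕ 4 ▸ [ 46 ]≔ 47 ▸ 46 ≔ 8 ⊕ 9 ▸ [ 46 ]≔ 44 ▸ 9 ≔ 9 ⊕ 4)

-- Stored values exceed makespans by one, and the offsets fit without correction: that of the upper
-- part is the slot in 1 + f U, that of the lower part becomes the offset of the new value.
relax : Cmd
relax =
  46 ≔ 7 ⊕ 12 ▸ 48 ≔ load 46 ▸ 46 ≔ 7 ⊕ 13 ▸ 49 ≔ load 46 ▸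
  47 ≔ 42 ⊖ 49 ▸ 49 ≔ 49 ⊕ 47 ▸ 48 ≔ 48 ⊕ 49 ▸
  46 ≔ 7 ⊕ 10 ▸ 47 ≔ load 46 ▸ 48 ≔ 47 ⊖ 48 ▸ 47 ≔ 47 ⊖ 48 ▸ [ 46 ]≔ 47

visit : Cmd
visit = children ▸ divideUp ▸ 44 ≔ reg 12 ▸ 45 ≔ reg 14 ▸ insert ▸
        44 ≔ reg 13 ▸ 45 ≔ reg 15 ▸ insert ▸ relax

visitAllBody : Cmd
visitAllBody = 11 ≔ load 53 ▸ visit ▸ 53 ≔ 53 ⊕ 4 ▸ 52 ≔ 52 ⊖ 4

visitAll : Cmd
visitAll = 52 ≔ reg 6 ▸ 53 ≔ reg 5 ▸ loop lists 52 visitAllBody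

sweepBody : Cmd
sweepBody = 46 ≔ 8 ⊕ 50 ▸ 10 ≔ load 46 ▸ visitAll ▸ 50 ≔ 50 ⊕ 4 ▸ 51 ≔ 9 ⊖ 50

-- The remaining length is recomputed in every round, so sets queued during a sweep are visited in
-- the same sweep. Hence the first sweep already closes the queue under children.
sweep : Cmd
sweep = 50 ≔ const 0 ▸ 51 ≔ 9 ⊖ 50 ▸ loop sets 51 sweepBody

sweepsBody : Cmd
sweepsBody = sweep ▸ 54 ≔ 54 ⊖ 4

sweeps : Cmd
sweeps = 54 ≔ 0 ⊕ 4 ▸ loop (jobs ⊞ con 1) 54 sweepsBody

-- The value `false` certifies that memory and registers 0 to 9 are untouched, and with them the
-- represented table.
quiet : Cmd → Bool
quiet c = stores c ∨ (writes c 0 ∨ (writes c 1 ∨ (writes c 2 ∨ (writes c 3 ∨ (writes c 4 ∨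
          (writes c 5 ∨ (writes c 6 ∨ (writes c 7 ∨ (writes c 8 ∨ writes c 9)))))))))

_≟ₛ_ : ∀ {k} (X Y : Subset k) → Dec (X ≡ Y)
_≟ₛ_ = Vecₚ.≡-dec Boolₚ._≟_

Stored : ∀ {k} → (ℕ → ℕ) → ℕ → List (Subset k) → Set
Stored M a []       = 0 ≡ 0
Stored M a (X ∷ Xs) = M a ≡ code X × Stored M (suc a) Xs

stored-cong : ∀ {k M M′ a} (Xs : List (Subset k)) →
              (∀ b → a ≤ b → b < a + length Xs → M′ b ≡ M b) → Stored M a Xs → Stored M′ a Xs
stored-cong []       same s       = refl
stored-cong {a = a} (X ∷ Xs) same (e , s) =
  trans (same a ≤-refl (m<m+n a (s≤s z≤n))) e ,
  stored-cong Xs (λ b a<b b< → same b (<⇒≤ a<b) (≤-trans b< (≤-reflexive (sym (+-suc a _))))) s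

stored-snoc : ∀ {k M a} (Xs : List (Subset k)) {Y} → Stored M a Xs →
              M (a + length Xs) ≡ code Y → Stored M a (Xs ++ Y ∷ [])
stored-snoc {M = M} {a} []       s       e = trans (cong M (sym (+-identityʳ a))) e , refl
stored-snoc {M = M} {a} (X ∷ Xs) (e , s) e′ =
  e , stored-snoc Xs s (trans (cong M (sym (+-suc a (length Xs)))) e′)

stored-at : ∀ {k M a} (Xs : List (Subset k)) {Y Ys} → Stored M a (Xs ++ Y ∷ Ys) →
            M (a + length Xs) ≡ code Y
stored-at {M = M} {a} []       (e , _) = trans (cong M (+-identityʳ a)) e
stored-at {M = M} {a} (X ∷ Xs) (_ , s) = trans (cong M (+-suc a (length Xs))) (stored-at Xs s)

∸-decreases : ∀ {r m} → 0 < m → r ≢ 0 → r ∸ m < r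
∸-decreases {zero}          _ nz = ⊥-elim (nz refl)
∸-decreases {suc r} {suc m} _ _  = s≤s (m∸n≤m r m)

cell<n² : ∀ {n} (v u : Fin n) → toℕ v * n + toℕ u < n * n
cell<n² {n} v u = begin-strict
  toℕ v * n + toℕ u <⟨ +-monoʳ-< (toℕ v * n) (Finₚ.toℕ<n u) ⟩
  toℕ v * n + n     ≡⟨ +-comm (toℕ v * n) n ⟩
  suc (toℕ v) * n   ≤⟨ *-monoˡ-≤ n (Finₚ.toℕ<n v) ⟩
  n * n             ∎
  where open ≤-Reasoning

-- Tables and sweeps, independently of the machine

record Ceil (m d q : ℕ) : Set where
  field
    covers  : d ≤ q * m
    minimal : ∀ ℓ → d ≤ ℓ * m → q ≤ ℓ

module Tables {n : ℕ} (_≺_ : Fin n → Fin n → Set)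
              (order : IsDecStrictPartialOrder _≡_ _≺_) (m : ℕ) where

  open Scheduling _≺_ order m

  -- value X is 0 if X is not in the queue, and one more than the best known
  -- makespan of X otherwise.

  record Table : Set where
    field
      queue : List (Subset n)
      value : Subset n → ℕ

  open Table public

  assignTo : Subset n → ℕ → (Subset n → ℕ) → Subset n → ℕ
  assignTo Y k f X with X ≟ₛ Y
  ... | yes _ = k
  ... | no  _ = f X

  assignTo-same : ∀ Y {k f} → assignTo Y k f Y ≡ k
  assignTo-same Y with Y ≟ₛ Y
  ... | yes _ = refl
  ... | no  ≢ = ⊥-elim (≢ refl)

  insertSet : Subset n → Table → Table
  insertSet Y T with value T Y
  ... | suc _ = T
  ... | zero  = record { queue = queue T ++ Y ∷ [] ; value = assignTo Y (suc ∣ Y ∣) (value T) }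

  insertSet-old : ∀ {Y T} → value T Y ≢ 0 → insertSet Y T ≡ T
  insertSet-old {Y} {T} nz with value T Y
  ... | suc _ = refl
  ... | zero  = ⊥-elim (nz refl)

  insertSet-new : ∀ {Y T} → value T Y ≡ 0 →
    insertSet Y T ≡ record { queue = queue T ++ Y ∷ [] ; value = assignTo Y (suc ∣ Y ∣) (value T) }
  insertSet-new {Y} {T} z with value T Y
  insertSet-new {Y} {T} () | suc _
  ... | zero = refl

  empty start : Table
  empty = record { queue = [] ; value = λ _ → 0 }
  start = insertSet ⊤ empty

  -- A minimum is computed as a ∸ (a ∸ b) and a maximum as c + (q ∸ c).
  bid relaxed : ℕ → Subset n → Subset n → Table → ℕ
  bid q X A T = value T (lower X A) + (value T (upper X A) + (q ∸ value T (upper X A)))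
  relaxed q X A T = value T X ∸ (value T X ∸ bid q X A T)

  relaxSet : ℕ → Subset n → Subset n → Table → Table
  relaxSet q X A T = record { queue = queue T ; value = assignTo X (relaxed q X A T) (value T) }

  visited : ℕ → Subset n → Subset n → Table → Table
  visited q X A T = relaxSet q X A (insertSet (upper X A) (insertSet (lower X A) T))

  -- A relation and not a function: the quotient `q` enters through its defining property, as the
  -- division loop delivers it.
  data Visits (X : Subset n) : List (Subset n) → Table → Table → Set where
    []  : ∀ {T} → Visits X [] T T
    _∷_ : ∀ {A As q T T′} → Ceil m (∣ X ∣ ∸ ∣ lower X A ∣) q →
          Visits X As (visited q X A T) T′ → Visits X (A ∷ As) T T′

  -- `done` is the visited prefix. Each constructor consults the current queue, because visits may
  -- have appended to it.
  data Sweep (As : List (Subset n)) : List (Subset n) → Table → Table → Set where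
    end  : ∀ {done T} → queue T ≡ done → Sweep As done T T
    next : ∀ {done T T′ T″ X Ys} → queue T ≡ done ++ X ∷ Ys → Visits X As T T′ →
           Sweep As (done ++ X ∷ []) T′ T″ → Sweep As done T T″

  data Sweeps (As : List (Subset n)) : ℕ → Table → Table → Set where
    []  : ∀ {T} → Sweeps As 0 T T
    _∷_ : ∀ {k T T′ T″} → Sweep As [] T T′ → Sweeps As k T′ T″ → Sweeps As (suc k) T T″

-- Tables in memory

module Implementation (ρ : Sizes) {n : ℕ} (n≤ : n ≤ #jobs ρ) (_≺_ : Fin n → Fin n → Set)
  (order : IsDecStrictPartialOrder _≡_ _≺_) (m : ℕ) (0<m : 0 < m)
  (As : List (Subset n)) (#As : length As ≤ #lists ρ) (base dict : ℕ)
  (dict≡ : dict ≡ base + length As) (n²≤base : n * n ≤ base) where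

  open Logic ρ
  open Children ρ
  open Scheduling _≺_ order m
  open Recursion ρ n≤ _≺_ order m
  open Tables _≺_ order m

  -- Memory holds the matrix, the list `As`, one cell per code and finally the queue, behind which
  -- there is room to grow. Indexing by register contents instead of a state makes assignments to
  -- other registers vanish by computation.
  record Represented (T : Table) (a0 a1 a2 a3 a4 a5 a6 a7 a8 a9 : ℕ) (M : ℕ → ℕ) : Set where
    field
      r0 : a0 ≡ n
      r1 : a1 ≡ m
      r2 : a2 ≡ 2 ^ n
      r3 : a3 ≡ 2 ^ n ∸ 1
      r4 : a4 ≡ 1
      r5 : a5 ≡ base
      r6 : a6 ≡ length As
      r7 : a7 ≡ dict
      r8 : a8 ≡ dict + 2 ^ n
      r9 : a9 ≡ length (queue T)
      adjacent : Adjacent M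
      listed   : Stored M base As
      valued   : ∀ X → M (dict + code X) ≡ value T X
      queued   : Stored M (dict + 2 ^ n) (queue T)

  open Represented

  Represents : Table → State → Set
  Represents T σ = Represented T (regs σ 0) (regs σ 1) (regs σ 2) (regs σ 3) (regs σ 4)
                     (regs σ 5) (regs σ 6) (regs σ 7) (regs σ 8) (regs σ 9) (mem σ)

  represents-frame : ∀ {c σ τ T} → quiet c ≡ false → Frame c σ τ → Represents T σ → Represents T τ
  represents-frame {c} {σ} {τ} {T} q f R = record
    { r0 = trans (kept f 0 q0) (r0 R) ; r1 = trans (kept f 1 (∨-falseˡ q1)) (r1 R)
    ; r2 = trans (kept f 2 (∨-falseˡ q2)) (r2 R) ; r3 = trans (kept f 3 (∨-falseˡ q3)) (r3 R)
    ; r4 = trans (kept f 4 (∨-falseˡ q4)) (r4 R) ; r5 = trans (kept f 5 (∨-falseˡ q5)) (r5 R)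
    ; r6 = trans (kept f 6 (∨-falseˡ q6)) (r6 R) ; r7 = trans (kept f 7 (∨-falseˡ q7)) (r7 R)
    ; r8 = trans (kept f 8 (∨-falseˡ q8)) (r8 R) ; r9 = trans (kept f 9 (∨-falseʳ {writes c 8} q8)) (r9 R)
    ; adjacent = subst Adjacent M≡ (adjacent R)
    ; listed   = subst (λ M → Stored M base As) M≡ (listed R)
    ; valued   = subst (λ M → ∀ X → M (dict + code X) ≡ value T X) M≡ (valued R)
    ; queued   = subst (λ M → Stored M (dict + 2 ^ n) (queue T)) M≡ (queued R) }
    where
    M≡ = sym (keptMem f (∨-falseˡ q))
    qs = ∨-falseʳ {stores c} q
    q0 = ∨-falseˡ {writes c 0} qs
    q1 = ∨-falseʳ {writes c 0} qs
    q2 = ∨-falseʳ {writes c 1} q1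
    q3 = ∨-falseʳ {writes c 2} q2
    q4 = ∨-falseʳ {writes c 3} q3
    q5 = ∨-falseʳ {writes c 4} q4
    q6 = ∨-falseʳ {writes c 5} q5
    q7 = ∨-falseʳ {writes c 6} q6
    q8 = ∨-falseʳ {writes c 7} q7

  base≤dict : base ≤ dict
  base≤dict = ≤-trans (m≤m+n base _) (≤-reflexive (sym dict≡))

  adjacent-cong : ∀ {M M′} → (∀ a → a < dict → M′ a ≡ M a) → Adjacent M → Adjacent M′
  adjacent-cong same adj v u =
    trans (same _ (<-≤-trans (cell<n² v u) (≤-trans n²≤base base≤dict))) (adj v u)

  listed-cong : ∀ {M M′} → (∀ a → a < dict → M′ a ≡ M a) → Stored M base As → Stored M′ base As
  listed-cong same = stored-cong As (λ b _ b< → same b (subst (b <_) (sym dict≡) b<))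

  entry : ∀ (X : Subset n) → dict + code X < dict + 2 ^ n
  entry X = +-monoʳ-< dict (code< X)

  insert-spec : ∀ {σ T} Y → Represents T σ → regs σ 44 ≡ code Y → regs σ 45 ≡ ∣ Y ∣ →
                Run insert σ (Represents (insertSet Y T))
  insert-spec {σ} {T} Y R e44 e45 = set▸ $ set▸ $ branch
    (λ nz → stop (subst (λ T → Represents T σ)
      (sym (insertSet-old λ z → nz (trans value≡ z))) R))
    (λ z → let new = trans (sym value≡) z in
      set▸ $ put▸ $ set▸ $ put▸ $ set $ subst (λ T′ → Represented T′ (regs σ 0) (regs σ 1) (regs σ 2)
          (regs σ 3) (regs σ 4) (regs σ 5) (regs σ 6) (regs σ 7) (regs σ 8) (regs σ 9 + regs σ 4) M₂)
        (sym (insertSet-new {Y} {T} new)) (record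
        { r0 = r0 R ; r1 = r1 R ; r2 = r2 R ; r3 = r3 R ; r4 = r4 R ; r5 = r5 R ; r6 = r6 R ; r7 = r7 R
        ; r8 = r8 R
        ; r9 = trans (cong₂ _+_ (r9 R) (r4 R)) (sym (Listₚ.length-++ (queue T)))
        ; adjacent = adjacent-cong low (adjacent R)
        ; listed = listed-cong low (listed R)
        ; valued = vals
        ; queued = stored-snoc (queue T) (stored-cong (queue T) old (queued R)) fresh }))
    where
    L = dict + 2 ^ n
    value≡ : mem σ (regs σ 7 + regs σ 44) ≡ value T Y
    value≡ = trans (cong (mem σ) (cong₂ _+_ (r7 R) e44)) (valued R Y)
    M₁ M₂ : ℕ → ℕ
    M₁ = mem σ [ regs σ 7 + regs σ 44 ↦ regs σ 45 + regs σ 4 ]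
    M₂ = M₁ [ regs σ 8 + regs σ 9 ↦ regs σ 44 ]
    slot≡ : regs σ 7 + regs σ 44 ≡ dict + code Y
    slot≡ = cong₂ _+_ (r7 R) e44
    tail≡ : regs σ 8 + regs σ 9 ≡ L + length (queue T)
    tail≡ = cong₂ _+_ (r8 R) (r9 R)
    below-tail : ∀ {a} → a < L + length (queue T) → M₂ a ≡ M₁ a
    below-tail a< = update-other M₁ λ a≡ → <⇒≢ a< (trans a≡ tail≡)
    low : ∀ a → a < dict → M₂ a ≡ mem σ a
    low a a< = trans (below-tail (<-≤-trans a< (≤-trans (m≤m+n dict _) (m≤m+n L _))))
      (update-other (mem σ) λ a≡ → <⇒≢ (<-≤-trans a< (m≤m+n dict (code Y))) (trans a≡ slot≡))
    old : ∀ b → L ≤ b → b < L + length (queue T) → M₂ b ≡ mem σ b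
    old b L≤ b< = trans (below-tail b<)
      (update-other (mem σ) λ b≡ → <⇒≢ (<-≤-trans (entry Y) L≤) (sym (trans b≡ slot≡)))
    fresh : M₂ (L + length (queue T)) ≡ code Y
    fresh = trans (cong M₂ (sym tail≡)) (trans (update-same M₁ (regs σ 8 + regs σ 9)) e44)
    vals : ∀ X → M₂ (dict + code X) ≡ assignTo Y (suc ∣ Y ∣) (value T) X
    vals X with X ≟ₛ Y
    ... | yes refl = trans (below-tail (<-≤-trans (entry X) (m≤m+n L _)))
      (trans (cong M₁ (sym slot≡)) (trans (update-same (mem σ) (regs σ 7 + regs σ 44))
        (trans (cong₂ _+_ e45 (r4 R)) (+-comm ∣ Y ∣ 1))))
    ... | no X≢Y = trans (below-tail (<-≤-trans (entry X) (m≤m+n L _)))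
      (trans (update-other (mem σ) λ a≡ →
        X≢Y (code-injective X Y (+-cancelˡ-≡ dict (code X) (code Y) (trans a≡ slot≡))))
             (valued R X))

  relax-spec : ∀ {σ T q} X A → Represents T σ → regs σ 10 ≡ code X → regs σ 42 ≡ q →
               regs σ 12 ≡ code (lower X A) → regs σ 13 ≡ code (upper X A) →
               Run relax σ (Represents (relaxSet q X A T))
  relax-spec {σ} {T} {q} X A R e10 e42 e12 e13 =
    set▸ $ set▸ $ set▸ $ set▸ $ set▸ $ set▸ $ set▸ $ set▸ $ set▸ $ set▸ $ set▸ $ put $ record
      { r0 = r0 R ; r1 = r1 R ; r2 = r2 R ; r3 = r3 R ; r4 = r4 R ; r5 = r5 R ; r6 = r6 R ; r7 = r7 R
      ; r8 = r8 R ; r9 = r9 R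
      ; adjacent = adjacent-cong low (adjacent R)
      ; listed = listed-cong low (listed R)
      ; valued = vals
      ; queued = stored-cong (queue T) high (queued R) }
    where
    slot≡ : regs σ 7 + regs σ 10 ≡ dict + code X
    slot≡ = cong₂ _+_ (r7 R) e10
    a = mem σ (regs σ 7 + regs σ 10)
    b = mem σ (regs σ 7 + regs σ 12)
    c = mem σ (regs σ 7 + regs σ 13)
    new = a ∸ (a ∸ (b + (c + (regs σ 42 ∸ c))))
    a≡ : a ≡ value T X
    a≡ = trans (cong (mem σ) slot≡) (valued R X)
    b≡ : b ≡ value T (lower X A)
    b≡ = trans (cong (mem σ) (cong₂ _+_ (r7 R) e12)) (valued R (lower X A))
    c≡ : c ≡ value T (upper X A)
    c≡ = trans (cong (mem σ) (cong₂ _+_ (r7 R) e13)) (valued R (upper X A))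
    new≡ : new ≡ relaxed q X A T
    new≡ = cong₂ (λ a e → a ∸ (a ∸ e)) a≡ (cong₂ _+_ b≡ (cong₂ (λ c q → c + (q ∸ c)) c≡ e42))
    low : ∀ a → a < dict → (mem σ [ regs σ 7 + regs σ 10 ↦ new ]) a ≡ mem σ a
    low a a< = update-other (mem σ) λ a≡ → <⇒≢ (<-≤-trans a< (m≤m+n dict (code X))) (trans a≡ slot≡)
    high : ∀ b → dict + 2 ^ n ≤ b → b < dict + 2 ^ n + length (queue T) →
           (mem σ [ regs σ 7 + regs σ 10 ↦ new ]) b ≡ mem σ b
    high b L≤ _ = update-other (mem σ) λ b≡ → <⇒≢ (<-≤-trans (entry X) L≤) (sym (trans b≡ slot≡))
    vals : ∀ Z → (mem σ [ regs σ 7 + regs σ 10 ↦ new ]) (dict + code Z) ≡ assignTo X (relaxed q X A T) (value T) Z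
    vals Z with Z ≟ₛ X
    ... | yes refl = trans (cong (mem σ [ regs σ 7 + regs σ 10 ↦ new ]) (sym slot≡))
      (trans (update-same (mem σ) (regs σ 7 + regs σ 10)) new≡)
    ... | no Z≢X = trans (update-other (mem σ) λ a≡ →
      Z≢X (code-injective Z X (+-cancelˡ-≡ dict (code Z) (code X) (trans a≡ slot≡))))
      (valued R Z)

  divideUp-spec : ∀ {σ} → regs σ 1 ≡ m → regs σ 4 ≡ 1 → regs σ 16 ≤ n →
                  Run divideUp σ (λ τ → Ceil m (regs σ 16 ∸ regs σ 14) (regs τ 42))
  divideUp-spec {σ} e1 e4 le = set▸ $ set▸ $ while J _ step (regs σ 16 ∸ regs σ 14)
    (≤-trans (m∸n≤m (regs σ 16) (regs σ 14)) (≤-trans le n≤))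
    (record { rest≤ = ≤-refl ; exact = λ _ → refl ; over = ≤-refl ; least = λ _ _ → z≤n })
    where
    d = regs σ 16 ∸ regs σ 14
    record J (k : ℕ) (τ : State) : Set where
      field
        rest≤ : regs τ 43 ≤ k
        -- As long as something is left no subtraction has been truncated; the last round may leave
        -- only the inequality `over`.
        exact : regs τ 43 ≢ 0 → d ≡ regs τ 42 * m + regs τ 43
        over  : d ≤ regs τ 42 * m + regs τ 43
        least : ∀ ℓ → d ≤ ℓ * m → regs τ 42 ≤ ℓ
    step : ∀ k {τ} → Frame (43 ≔ 43 ⊖ 1 ▸ 42 ≔ 42 ⊕ 4) _ τ → J k τ →
           (regs τ 43 ≡ 0 × Ceil m d (regs τ 42)) ⊎
           (regs τ 43 ≢ 0 × ∃[ k′ ] (k ≡ suc k′ × Run (43 ≔ 43 ⊖ 1 ▸ 42 ≔ 42 ⊕ 4) τ (J k′)))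
    step k {τ} f j with regs τ 43 ≟ 0
    ... | yes z = inj₁ (z , record
      { covers = ≤-trans over (≤-reflexive (trans (cong (regs τ 42 * m +_) z) (+-identityʳ _)))
      ; minimal = least })
      where open J j
    step zero {τ} f j | no nz = ⊥-elim (nz (n≤0⇒n≡0 (J.rest≤ j)))
    step (suc k) {τ} f j | no nz = inj₂ (nz , k , refl , (set▸ $ set $ record
      { rest≤ = s≤s⁻¹ (≤-trans (subst (λ m′ → r ∸ m′ < r) (sym m≡) (∸-decreases 0<m nz)) rest≤)
      ; exact = λ nz′ → trans (exact nz) (sym (trans (shifted) (cong (q * m +_)
          (m+[n∸m]≡n (≰⇒≥ {r} {m} (λ r≤m → nz′ (trans (cong (r ∸_) m≡) (m≤n⇒m∸n≡0 r≤m))))))))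
      ; over  = ≤-trans over (≤-trans (+-monoʳ-≤ (q * m) (m≤n+m∸n r m)) (≤-reflexive (sym shifted)))
      ; least = λ ℓ le → subst (_≤ ℓ) (trans (+-comm 1 q) (cong (q +_) (sym one)))
          (*-cancelʳ-< m q ℓ (<-≤-trans (subst (q * m <_) (sym (exact nz)) (m<m+n (q * m) (n≢0⇒n>0 nz))) le)) }))
      where
      open J j
      r = regs τ 43
      q = regs τ 42
      m≡ : regs τ 1 ≡ m
      m≡ = carry f 1 e1
      one : regs τ 4 ≡ 1
      one = carry f 4 e4
      shifted : (q + regs τ 4) * m + (r ∸ regs τ 1) ≡ q * m + (m + (r ∸ m))
      shifted = trans (cong₂ (λ x y → (q + x) * m + (r ∸ y)) one m≡) (regroup q m (r ∸ m))
        where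
        regroup : ∀ q m x → (q + 1) * m + x ≡ q * m + (m + x)
        regroup = solve-∀

  visit-spec : ∀ {σ T} X A → Represents T σ → regs σ 10 ≡ code X → regs σ 11 ≡ code A →
               Run visit σ (λ τ → ∃[ q ] (Ceil m (∣ X ∣ ∸ ∣ lower X A ∣) q × Represents (visited q X A T) τ))
  visit-spec {σ} {T} X A R e10 e11 =
    children-spec X A (record { c0 = r0 R ; c2 = r2 R ; c3 = r3 R ; c4 = r4 R }) (adjacent R) e10 e11
    then λ {τ₁} f res → let open Result res ; R₁ = represents-frame refl f R in
    divideUp-spec (r1 R₁) (r4 R₁) (≤-trans (≤-reflexive r16) (∣p∣≤n X))
    then λ {τ₂} g ceil → let R₂ = represents-frame refl g R₁ in
    set▸ $ set▸ $ insert-spec (lower X A) R₂ (carry g 12 r12) (carry g 14 r14)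
    then λ h R₃ → set▸ $ set▸ $ insert-spec (upper X A) R₃
      (carry h 13 (carry g 13 r13))
      (carry h 15 (carry g 15 r15))
    then λ i R₄ → weaken (relax-spec X A R₄
      (carry i 10 (carry h 10 (carry g 10 (carry f 10 e10))))
      (carry i 42 (kept h 42 refl))
      (carry i 12 (carry h 12 (carry g 12 r12)))
      (carry i 13 (carry h 13 (carry g 13 r13))))
    λ _ R₅ → regs τ₂ 42 , subst (λ d → Ceil m d (regs τ₂ 42)) (cong₂ _∸_ r16 r14) (ceil) , R₅

  visitAll-spec : ∀ {σ T} X → Represents T σ → regs σ 10 ≡ code X →
                  Run visitAll σ (λ τ → ∃[ T′ ] (Visits X As T T′ × Represents T′ τ))
  visitAll-spec {σ} {T} X R e10 = set▸ $ set▸ $ weaken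
    (for J step #As (r6 R) (record
      { todo = As ; now = T ; length≡ = refl ; stored = λ s → subst (λ a → Stored _ a As) (sym (r5 R)) s
      ; history = λ v → v ; rep = R }))
    (λ _ j → finish j)
    where
    record J (k : ℕ) (τ : State) : Set where
      no-eta-equality; pattern
      field
        todo    : List (Subset n)
        now     : Table
        length≡ : length todo ≡ k
        stored  : ∀ {M} → Stored M base As → Stored M (regs τ 53) todo
        history : ∀ {T′} → Visits X todo now T′ → Visits X As T T′
        rep     : Represents now τ
    finish : ∀ {τ} → J 0 τ → ∃[ T′ ] (Visits X As T T′ × Represents T′ τ)
    finish record { todo = [] ; now = now ; history = history ; rep = rep } = now , history [] , rep
    step : ∀ k {τ} → Frame visitAllBody _ τ → regs τ 52 ≡ suc k → J (suc k) τ →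
           Run visitAllBody τ (λ τ → regs τ 52 ≡ k × J k τ)
    step k {τ} f e52 record { todo = A ∷ As′ ; now = now ; length≡ = refl ; stored = stored
                ; history = history ; rep = rep } =
      set▸ $ visit-spec X A rep (carry f 10 e10) (proj₁ (stored (listed rep)))
      then λ g (q , ceil , R′) → set▸ $ set
        ( cong₂ _∸_ (carry g 52 e52) (r4 R′)
        , record { todo = As′ ; now = visited q X A now ; length≡ = refl
                 ; stored = λ {M} s → subst (λ a → Stored M a As′)
                     (sym (trans (cong₂ _+_ (kept g 53 refl) (r4 R′)) (+-comm (regs τ 53) 1))) (proj₂ (stored s))
                 ; history = λ v → history (ceil ∷ v) ; rep = R′ } )

  module _ (Good : Table → Set)
           (good-visits : ∀ {X T T′} → X ∈ₗ queue T → Good T → Visits X As T T′ → Good T′)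
           (good-extends : ∀ {X T T′} → Good T → Visits X As T T′ → ∃[ Ys ] queue T′ ≡ queue T ++ Ys)
           (good-bounded : ∀ {T} → Good T → length (queue T) ≤ #sets ρ) where

    -- The number of rounds is not known in advance. `Good` stands for any invariant that limits the
    -- queue, and the places still free under this limit, plus those not yet visited, form the
    -- measure.
    sweep-spec : ∀ {σ T} → Represents T σ → Good T →
                 Run sweep σ (λ τ → ∃[ T′ ] (Sweep As [] T T′ × Good T′ × Represents T′ τ))
    sweep-spec {σ} {T} R good₀ = set▸ $ set▸ $ while J _ step (#sets ρ) ≤-refl (record
      { now = T ; done = [] ; todo = queue T ; queue≡ = refl ; fuel = refl ; r50 = refl
      ; r51 = r9 R ; history = λ s → s ; good = good₀ ; rep = R })
      where
      record J (k : ℕ) (τ : State) : Set where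
        no-eta-equality; pattern
        field
          now       : Table
          done todo : List (Subset n)
          queue≡    : queue now ≡ done ++ todo
          fuel      : length done + k ≡ #sets ρ
          r50       : regs τ 50 ≡ length done
          r51       : regs τ 51 ≡ length (queue now) ∸ length done
          history   : ∀ {T′} → Sweep As done now T′ → Sweep As [] T T′
          good      : Good now
          rep       : Represents now τ
      step : ∀ k {τ} → Frame sweepBody _ τ → J k τ →
             (regs τ 51 ≡ 0 × ∃[ T′ ] (Sweep As [] T T′ × Good T′ × Represents T′ τ)) ⊎
             (regs τ 51 ≢ 0 × ∃[ k′ ] (k ≡ suc k′ × Run sweepBody τ (J k′)))
      step k {τ} f record { now = now ; done = done ; todo = [] ; queue≡ = queue≡ ; r51 = r51
                ; history = history ; good = good ; rep = rep } =
        inj₁ (trans r51 (m≤n⇒m∸n≡0 (≤-reflexive len)) , now , history (end done≡) , good , rep)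
        where
        done≡ = trans queue≡ (Listₚ.++-identityʳ done)
        len   = cong length done≡
      step k {τ} f record { now = now ; done = done ; todo = X ∷ todo ; queue≡ = queue≡ ; fuel = fuel ; r50 = r50
                ; r51 = r51 ; history = history ; good = good ; rep = rep } =
        continue k fuel
        where
        done<queue : length done < length (queue now)
        done<queue = subst (length done <_)
          (sym (trans (cong length queue≡) (Listₚ.length-++ done))) (m<m+n (length done) (s≤s z≤n))
        continue : ∀ k → length done + k ≡ #sets ρ → (regs τ 51 ≡ 0 × _) ⊎
                   (regs τ 51 ≢ 0 × ∃[ k′ ] (k ≡ suc k′ × Run sweepBody τ (J k′)))
        continue zero fuel = ⊥-elim (<⇒≱ done<queue
          (≤-trans (good-bounded good) (≤-reflexive (trans (sym fuel) (+-identityʳ _)))))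
        continue (suc k) fuel = inj₂ ((λ z → <⇒≱ done<queue (m∸n≡0⇒m≤n (trans (sym r51) z))) , k , refl ,
          (set▸ $ set▸ $ visitAll-spec X rep
            (trans (cong (mem τ) (cong₂ _+_ (r8 rep) r50))
              (stored-at done (subst (Stored (mem τ) (dict + 2 ^ n)) queue≡ (queued rep))))
          then λ g (T′ , vs , R′) →
            let (Ys , ext) = good-extends good vs
                len : length (done ++ X ∷ []) ≡ suc (length done)
                len = trans (Listₚ.length-++ done) (+-comm (length done) 1)
                e50 = trans (cong₂ _+_ (carry g 50 r50) (r4 R′)) (sym (Listₚ.length-++ done))
            in set▸ $ set $ record
              { now = T′ ; done = done ++ X ∷ [] ; todo = todo ++ Ys
              ; queue≡ = trans ext (trans (cong (_++ Ys) queue≡)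
                  (trans (Listₚ.++-assoc done (X ∷ todo) Ys) (sym (Listₚ.++-assoc done (X ∷ []) (todo ++ Ys)))))
              ; fuel = trans (cong (_+ k) len) (trans (sym (+-suc (length done) k)) fuel)
              ; r50 = e50
              ; r51 = cong₂ _∸_ (r9 R′) e50
              ; history = λ s → history (next queue≡ vs s)
              ; good = good-visits (subst (X ∈ₗ_) (sym queue≡) (∈-++⁺ʳ done (Any.here refl))) good vs
              ; rep = R′ }))

    sweeps-spec : ∀ {σ T} → Represents T σ → Good T →
                  Run sweeps σ (λ τ → ∃[ T′ ] (Sweeps As (n + 1) T T′ × Good T′ × Represents T′ τ))
    sweeps-spec {σ} {T} R good = set▸ $ weaken
      (for J step {n + 1} (+-monoˡ-≤ 1 n≤) (cong₂ _+_ (r0 R) (r4 R)) (T , (λ s → s) , good , R))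
      λ { _ (T′ , history , good′ , R′) → T′ , history [] , good′ , R′ }
      where
      J : ℕ → State → Set
      J k τ = ∃[ T′ ] ((∀ {T″} → Sweeps As k T′ T″ → Sweeps As (n + 1) T T″) × Good T′ × Represents T′ τ)
      step : ∀ k {τ} → Frame sweepsBody _ τ → regs τ 54 ≡ suc k → J (suc k) τ →
             Run sweepsBody τ (λ τ → regs τ 54 ≡ k × J k τ)
      step k f e54 (T₁ , history , good₁ , R₁) =
        sweep-spec R₁ good₁
        then λ g (T₂ , s , good₂ , R₂) → set
          (cong₂ _∸_ (carry g 54 e54) (r4 R₂) , T₂ , (λ ss → history (s ∷ ss)) , good₂ , R₂)

-- Exactness of the values after the sweeps

module Correctness {n : ℕ} (_≺_ : Fin n → Fin n → Set)
  (order : IsDecStrictPartialOrder _≡_ _≺_) (m : ℕ) (0<m : 0 < m) where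

  open Scheduling _≺_ order m
  open Decomposition _≺_ order m
  open Families _≺_ order m
  open Tables _≺_ order m

  -- One minimal job per slot: this justifies the entry that a new set receives.
  sequential : ∀ k X → ∣ X ∣ ≤ k → Sch k X
  sequential zero X le = finished (∣p∣≡0⇒Empty le)
  sequential (suc k) X le with nonempty? X
  ... | no e = extend (z≤n {suc k}) (finished e)
  ... | yes (v , v∈X) with hasMinimal X v∈X
  ...   | b , b∈X , min , _ = slot ⁅ b ⁆ (λ x∈ → subst (_∈ X) (sym (x∈⁅y⁆⇒x≡y b x∈)) b∈X)
    (λ s∈ u∈ u≺s → min u∈ (subst (_ ≺_) (x∈⁅y⁆⇒x≡y b s∈) u≺s))
    (≤-trans (≤-reflexive (∣⁅x⁆∣≡1 b)) 0<m)
    (sequential k (X - b) (s≤s⁻¹ (≤-trans (x∈p⇒∣p-x∣<∣p∣ b∈X) le)))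

  record _⊑_ (T T′ : Table) : Set where
    field
      appended : List (Subset n)
      extends  : queue T′ ≡ queue T ++ appended
      improves : ∀ {X} → value T X ≢ 0 → value T′ X ≤ value T X × value T′ X ≢ 0

  open _⊑_

  ⊑-refl : ∀ {T} → T ⊑ T
  ⊑-refl {T} = record
    { appended = [] ; extends = sym (Listₚ.++-identityʳ (queue T)) ; improves = λ nz → ≤-refl , nz }

  ⊑-trans : ∀ {T T′ T″} → T ⊑ T′ → T′ ⊑ T″ → T ⊑ T″
  ⊑-trans {T} p q = record
    { appended = appended p ++ appended q
    ; extends  = trans (extends q) (trans (cong (_++ appended q) (extends p))
        (Listₚ.++-assoc (queue T) (appended p) (appended q)))
    ; improves = λ nz → let (le , nz′) = improves p nz ; (le′ , nz″) = improves q nz′ in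
        ≤-trans le′ le , nz″ }

  ⊑-queue : ∀ {T T′ X} → T ⊑ T′ → X ∈ₗ queue T → X ∈ₗ queue T′
  ⊑-queue p X∈ = subst (_ ∈ₗ_) (sym (extends p)) (∈-++⁺ˡ X∈)

  ⊑-insert : ∀ Y T → T ⊑ insertSet Y T
  ⊑-insert Y T with value T Y in eq
  ... | suc _ = ⊑-refl
  ... | zero  = record { appended = Y ∷ [] ; extends = refl ; improves = imp }
    where
    imp : ∀ {X} → value T X ≢ 0 →
          assignTo Y (suc ∣ Y ∣) (value T) X ≤ value T X × assignTo Y (suc ∣ Y ∣) (value T) X ≢ 0
    imp {X} nz with X ≟ₛ Y
    ... | yes refl = ⊥-elim (nz eq)
    ... | no  _    = ≤-refl , nz

  min≤ˡ : ∀ a e → a ∸ (a ∸ e) ≤ a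
  min≤ˡ a e = m∸n≤m a (a ∸ e)

  min≤ʳ : ∀ a e → a ∸ (a ∸ e) ≤ e
  min≤ʳ a e with ≤-total e a
  ... | inj₁ e≤a = ≤-reflexive (m∸[m∸n]≡n e≤a)
  ... | inj₂ a≤e = ≤-trans (min≤ˡ a e) a≤e

  min≡ : ∀ a e → a ∸ (a ∸ e) ≡ a ⊎ a ∸ (a ∸ e) ≡ e
  min≡ a e with ≤-total e a
  ... | inj₁ e≤a = inj₂ (m∸[m∸n]≡n e≤a)
  ... | inj₂ a≤e = inj₁ (cong (a ∸_) (m≤n⇒m∸n≡0 a≤e))

  relaxed≢0 : ∀ {q X A T} → value T X ≢ 0 → value T (lower X A) ≢ 0 → relaxed q X A T ≢ 0
  relaxed≢0 {q} {X} {A} {T} x≢0 l≢0 z with min≡ (value T X) (bid q X A T)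
  ... | inj₁ e = x≢0 (trans (sym e) z)
  ... | inj₂ e = l≢0 (m+n≡0⇒m≡0 _ (trans (sym e) z))

  ⊑-relax : ∀ {q X A T} → value T (lower X A) ≢ 0 → T ⊑ relaxSet q X A T
  ⊑-relax {q} {X} {A} {T} l≢0 = record
    { appended = [] ; extends = sym (Listₚ.++-identityʳ (queue T)) ; improves = imp }
    where
    imp : ∀ {Z} → value T Z ≢ 0 → value (relaxSet q X A T) Z ≤ value T Z × value (relaxSet q X A T) Z ≢ 0
    imp {Z} nz with Z ≟ₛ X
    ... | yes refl = min≤ˡ (value T X) (bid q X A T) , relaxed≢0 {q} {X} {A} {T} nz l≢0
    ... | no  _    = ≤-refl , nz

  insert-value≢0 : ∀ Y T → value (insertSet Y T) Y ≢ 0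
  insert-value≢0 Y T with value T Y in eq
  ... | suc _ = λ z → case trans (sym eq) z of λ ()
  ... | zero  = λ z → case trans (sym (assignTo-same Y {f = value T})) z of λ ()

  ⊑-visited : ∀ q X A T → T ⊑ visited q X A T
  ⊑-visited q X A T = ⊑-trans (⊑-insert (lower X A) T) (⊑-trans (⊑-insert (upper X A) T₁)
    (⊑-relax {q} {X} {A} {insertSet (upper X A) T₁}
      (proj₂ (improves (⊑-insert (upper X A) T₁) {lower X A} (insert-value≢0 (lower X A) T)))))
    where T₁ = insertSet (lower X A) T

  ⊑-visits : ∀ {X As T T′} → Visits X As T T′ → T ⊑ T′
  ⊑-visits [] = ⊑-refl
  ⊑-visits {X} (_∷_ {A} {q = q} {T} _ vs) = ⊑-trans (⊑-visited q X A T) (⊑-visits vs)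

  -- One half of exactness. The other half, `sound` in `Good`, holds throughout, while this one is
  -- reached only after enough sweeps.
  Best : Table → Subset n → Set
  Best T X = ∀ {ℓ} → Sch ℓ X → value T X ≤ suc ℓ

  best-mono : ∀ {T T′ X} → T ⊑ T′ → value T X ≢ 0 → Best T X → Best T′ X
  best-mono p nz b s = ≤-trans (proj₁ (improves p nz)) (b s)

  module Search (As : List (Subset n)) {bound : ℕ} (family : Family As bound)
    (small : ∀ {A} → A ∈ₗ As → ∣ A ∣ ≤ m)
    (splits : ∀ {ℓ X} → Nonempty X → Sch ℓ X → ∃[ A ] (A ∈ₗ As × Split ℓ X A)) where

    open Family family

    record Good (T : Table) : Set where
      field
        unique  : Unique (queue T)
        member  : ∀ {X} → X ∈ₗ queue T → Member X
        known   : ∀ {X} → value T X ≢ 0 → X ∈ₗ queue T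
        queued  : ∀ {X} → X ∈ₗ queue T → value T X ≢ 0
        sound   : ∀ {X ℓ} → value T X ≡ suc ℓ → Sch ℓ X
        trivial : ∀ X → value T X ≤ suc ∣ X ∣

    open Good

    good-insert : ∀ {Y T} → Member Y → Good T → Good (insertSet Y T)
    good-insert {Y} {T} Y∈ G with value T Y in eq
    ... | suc _ = G
    ... | zero  = record
      { unique  = Uniqueₚ.++⁺ (unique G) (All.[] ∷ []) λ { (Y∈q , Any.here refl) → queued G Y∈q eq }
      ; member  = λ X∈ → mem′ (∈-++⁻ (queue T) X∈)
      ; known   = kn
      ; queued  = λ X∈ → qd (∈-++⁻ (queue T) X∈)
      ; sound   = snd
      ; trivial = triv }
      where
      f = assignTo Y (suc ∣ Y ∣) (value T)
      mem′ : ∀ {X} → X ∈ₗ queue T ⊎ X ∈ₗ Y ∷ [] → Member X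
      mem′ (inj₁ X∈)             = member G X∈
      mem′ (inj₂ (Any.here refl)) = Y∈
      kn : ∀ {X} → f X ≢ 0 → X ∈ₗ queue T ++ Y ∷ []
      kn {X} nz with X ≟ₛ Y
      ... | yes refl = ∈-++⁺ʳ (queue T) (Any.here refl)
      ... | no  _    = ∈-++⁺ˡ (known G nz)
      qd : ∀ {X} → X ∈ₗ queue T ⊎ X ∈ₗ Y ∷ [] → f X ≢ 0
      qd {X} X∈ z with X ≟ₛ Y
      qd {X} X∈ () | yes _
      qd {X} (inj₁ X∈) z               | no _   = queued G X∈ z
      qd {X} (inj₂ (Any.here X≡Y)) z   | no X≢Y = X≢Y X≡Y
      snd : ∀ {X ℓ} → f X ≡ suc ℓ → Sch ℓ X
      snd {X} e with X ≟ₛ Y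
      snd {X} refl | yes refl = sequential ∣ X ∣ X ≤-refl
      ... | no _ = sound G e
      triv : ∀ X → f X ≤ suc ∣ X ∣
      triv X with X ≟ₛ Y
      ... | yes refl = ≤-refl
      ... | no  _    = trivial G X

    relaxed-sound : ∀ {q X A T ℓ} → A ∈ₗ As → Good T → Ceil m (∣ X ∣ ∸ ∣ lower X A ∣) q →
                    lower X A ∈ₗ queue T → upper X A ∈ₗ queue T → relaxed q X A T ≡ suc ℓ → Sch ℓ X
    relaxed-sound {q} {X} {A} {T} {ℓ} A∈ G ceil l∈ u∈ eq
      with min≡ (value T X) (bid q X A T)
    ... | inj₁ e = sound G (trans (sym e) eq)
    ... | inj₂ e with value T (lower X A) in eqˡ | value T (upper X A) in eqᵘ
    ...   | zero  | _      = ⊥-elim (queued G l∈ eqˡ)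
    ...   | suc k | zero   = ⊥-elim (queued G u∈ eqᵘ)
    -- The bid is suc (k + (suc ℓ′ + (q ∸ suc ℓ′))), so `assemble` allows ℓ′ + (q ∸ suc ℓ′) slots
    -- after the one that takes A.
    ...   | suc k | suc ℓ′ = subst (λ j → Sch j X) (suc-injective (trans (sym e) eq))
      (assemble (small A∈) (sound G eqˡ) (sound G eqᵘ) (m≤m+n ℓ′ _)
        (≤-trans (Ceil.covers ceil) (*-monoˡ-≤ m (m≤n+m∸n q (suc ℓ′)))))

    good-relax : ∀ {q X A T} → A ∈ₗ As → Good T → Ceil m (∣ X ∣ ∸ ∣ lower X A ∣) q →
                 X ∈ₗ queue T → lower X A ∈ₗ queue T → upper X A ∈ₗ queue T → Good (relaxSet q X A T)
    good-relax {q} {X} {A} {T} A∈ G ceil X∈ l∈ u∈ = record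
      { unique = unique G ; member = member G ; known = kn ; queued = qd ; sound = snd ; trivial = triv }
      where
      kn : ∀ {Z} → value (relaxSet q X A T) Z ≢ 0 → Z ∈ₗ queue T
      kn {Z} nz with Z ≟ₛ X
      ... | yes refl = X∈
      ... | no  _    = known G nz
      qd : ∀ {Z} → Z ∈ₗ queue T → value (relaxSet q X A T) Z ≢ 0
      qd {Z} Z∈ with Z ≟ₛ X
      ... | yes refl = relaxed≢0 {q} {X} {A} {T} (queued G X∈) (queued G l∈)
      ... | no  _    = queued G Z∈
      snd : ∀ {Z ℓ} → value (relaxSet q X A T) Z ≡ suc ℓ → Sch ℓ Z
      snd {Z} e with Z ≟ₛ X
      ... | yes refl = relaxed-sound {q} {X} {A} {T} A∈ G ceil l∈ u∈ e
      ... | no  _    = sound G e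
      triv : ∀ Z → value (relaxSet q X A T) Z ≤ suc ∣ Z ∣
      triv Z with Z ≟ₛ X
      ... | yes refl = ≤-trans (min≤ˡ (value T X) (bid q X A T)) (trivial G X)
      ... | no  _    = trivial G Z

    module _ {q X A T} (A∈ : A ∈ₗ As) (G : Good T) (X∈ : X ∈ₗ queue T)
             (ceil : Ceil m (∣ X ∣ ∸ ∣ lower X A ∣) q) where

      private
        T₁ = insertSet (lower X A) T
        T₂ = insertSet (upper X A) T₁
        G₁ = good-insert (lower-closed A∈ (member G X∈)) G
        G₂ = good-insert (upper-closed A∈ (member G X∈)) G₁
        T⊑T₂ = ⊑-trans (⊑-insert (lower X A) T) (⊑-insert (upper X A) T₁)

      lower-queued : lower X A ∈ₗ queue (visited q X A T)
      lower-queued = ⊑-queue (⊑-insert (upper X A) T₁) (known G₁ (insert-value≢0 (lower X A) T))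

      upper-queued : upper X A ∈ₗ queue (visited q X A T)
      upper-queued = known G₂ (insert-value≢0 (upper X A) T₁)

      good-visited : Good (visited q X A T)
      good-visited = good-relax A∈ G₂ ceil (⊑-queue T⊑T₂ X∈) lower-queued upper-queued

    visit-improves : ∀ {q X A T ℓ} → A ∈ₗ As → Good T → X ∈ₗ queue T →
      Ceil m (∣ X ∣ ∸ ∣ lower X A ∣) q → value T (lower X A) ≢ 0 → value T (upper X A) ≢ 0 →
      Best T (lower X A) → Best T (upper X A) → Split ℓ X A → value (visited q X A T) X ≤ suc ℓ
    visit-improves {q} {X} {A} {T} {ℓ} A∈ G X∈ ceil l≢0 u≢0 bestˡ bestᵘ sp
      rewrite insertSet-old {lower X A} {T} l≢0 | insertSet-old {upper X A} {T} u≢0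
            | assignTo-same X {relaxed q X A T} {value T} = begin
      relaxed q X A T ≤⟨ min≤ʳ (value T X) (bid q X A T) ⟩
      value T (lower X A) + (c + (q ∸ c)) ≤⟨ +-mono-≤ (bestˡ lower-part) (joined after c≤ q≤) ⟩
      suc (before + after) ≤⟨ s≤s total ⟩
      suc ℓ ∎
      where
      open Split sp
      open ≤-Reasoning
      c = value T (upper X A)
      c≤ : c ≤ after
      c≤ = ≤-trans (bestᵘ upper-part) room
      q≤ : q ≤ after
      q≤ = Ceil.minimal ceil after capacity
      joined : ∀ a → c ≤ a → q ≤ a → c + (q ∸ c) ≤ a
      joined a c≤a q≤a with ≤-total c q
      ... | inj₁ c≤q = ≤-trans (≤-reflexive (m+[n∸m]≡n c≤q)) q≤a
      ... | inj₂ q≤c = ≤-trans (≤-reflexive (trans (cong (c +_) (m≤n⇒m∸n≡0 q≤c)) (+-identityʳ c))) c≤a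

    good-visits : ∀ {X As′ T T′} → (∀ {A} → A ∈ₗ As′ → A ∈ₗ As) → X ∈ₗ queue T → Good T →
                  Visits X As′ T T′ → Good T′
    good-visits sub X∈ G [] = G
    good-visits {X} sub X∈ G (_∷_ {A} {q = q} {T} ceil vs) = good-visits (λ A∈ → sub (Any.there A∈))
      (⊑-queue (⊑-visited q X A T) X∈) (good-visited (sub (Any.here refl)) G X∈ ceil) vs

    visits-children : ∀ {X As′ T T′ A} → (∀ {A} → A ∈ₗ As′ → A ∈ₗ As) → X ∈ₗ queue T → Good T →
                      Visits X As′ T T′ → A ∈ₗ As′ → lower X A ∈ₗ queue T′ × upper X A ∈ₗ queue T′
    visits-children {X} sub X∈ G (_∷_ {A} {q = q} {T} ceil vs) (Any.here refl) =
      ⊑-queue (⊑-visits vs) (lower-queued (sub (Any.here refl)) G X∈ ceil) ,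
      ⊑-queue (⊑-visits vs) (upper-queued (sub (Any.here refl)) G X∈ ceil)
    visits-children {X} sub X∈ G (_∷_ {A} {q = q} {T} ceil vs) (Any.there A∈) =
      visits-children (λ A∈ → sub (Any.there A∈)) (⊑-queue (⊑-visited q X A T) X∈)
        (good-visited (sub (Any.here refl)) G X∈ ceil) vs A∈

    visits-improve : ∀ {X As′ T T′ A ℓ} → (∀ {A} → A ∈ₗ As′ → A ∈ₗ As) → X ∈ₗ queue T → Good T →
      Visits X As′ T T′ → A ∈ₗ As′ → value T (lower X A) ≢ 0 → value T (upper X A) ≢ 0 →
      Best T (lower X A) → Best T (upper X A) → Split ℓ X A → value T′ X ≤ suc ℓ
    visits-improve {X} sub X∈ G (_∷_ {A} {q = q} {T} ceil vs) (Any.here refl) l≢0 u≢0 bˡ bᵘ sp =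
      ≤-trans (proj₁ (improves (⊑-visits vs) (proj₂ (improves (⊑-visited q X A T) (queued G X∈)))))
              (visit-improves {q} (sub (Any.here refl)) G X∈ ceil l≢0 u≢0 bˡ bᵘ sp)
    visits-improve {X} {A = B} sub X∈ G (_∷_ {A} {q = q} {T} ceil vs) (Any.there B∈) l≢0 u≢0 bˡ bᵘ sp =
      visits-improve (λ A∈ → sub (Any.there A∈)) (⊑-queue p X∈) (good-visited (sub (Any.here refl)) G X∈ ceil)
        vs B∈ (proj₂ (improves p l≢0)) (proj₂ (improves p u≢0))
        (best-mono {X = lower X B} p l≢0 bˡ) (best-mono {X = upper X B} p u≢0 bᵘ) sp
      where p = ⊑-visited q X A T

    Children : Table → Subset n → Set
    Children T X = ∀ {A} → A ∈ₗ As → lower X A ∈ₗ queue T × upper X A ∈ₗ queue T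

    -- After r sweeps the table is closed and the values of sets of fewer
    -- than r elements are final.

    Stage : ℕ → Table → Set
    Stage r T = r ≡ 0 ⊎ (∀ {X} → X ∈ₗ queue T → Children T X × (∣ X ∣ < r → Best T X))

    visits-closed : ∀ {X As′ T T′} → (∀ {A} → A ∈ₗ As′ → A ∈ₗ As) → X ∈ₗ queue T → Good T →
                    Children T X → Visits X As′ T T′ → queue T′ ≡ queue T
    visits-closed sub X∈ G ch [] = refl
    visits-closed {X} {T = T} sub X∈ G ch (_∷_ {A} {q = q} ceil vs) =
      trans (visits-closed (λ A∈ → sub (Any.there A∈)) (⊑-queue (⊑-visited q X A T) X∈)
              (good-visited (sub (Any.here refl)) G X∈ ceil)
              (λ B∈ → ⊑-queue (⊑-visited q X A T) (proj₁ (ch B∈)) , ⊑-queue (⊑-visited q X A T) (proj₂ (ch B∈))) vs)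
            same
      where
      same : queue (visited q X A T) ≡ queue T
      same rewrite insertSet-old {lower X A} {T} (queued G (proj₁ (ch (sub (Any.here refl)))))
                 | insertSet-old {upper X A} {T} (queued G (proj₂ (ch (sub (Any.here refl))))) = refl

    stage-visits : ∀ {r X T T′} → X ∈ₗ queue T → Good T → Stage r T → Visits X As T T′ → Stage r T′
    stage-visits X∈ G (inj₁ z) vs = inj₁ z
    stage-visits {T = T} {T′} X∈ G (inj₂ st) vs = inj₂ λ {Z} Z∈ →
      let Z∈T = subst (Z ∈ₗ_) (visits-closed (λ A∈ → A∈) X∈ G (proj₁ (st X∈)) vs) Z∈
          ⊑T′ = ⊑-visits vs in
      (λ A∈ → ⊑-queue ⊑T′ (proj₁ (proj₁ (st Z∈T) A∈)) , ⊑-queue ⊑T′ (proj₂ (proj₁ (st Z∈T) A∈))) ,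
      λ lt → best-mono {X = Z} ⊑T′ (queued G Z∈T) (proj₂ (st Z∈T) lt)

    -- If `X` has at most `r` jobs then its children have fewer than `r`, so their values are final
    -- already, and the visit with the `A` of an optimal split hands this on to `X`.
    visits-best : ∀ {r X T T′} → X ∈ₗ queue T → Good T → Stage r T → Visits X As T T′ →
                  ∣ X ∣ ≤ r → Best T′ X
    visits-best {r} {X} {T} {T′} X∈ G st vs le {ℓ} s with nonempty? X
    -- The empty set has no split to appeal to; its entry is at most 1 by `trivial`.
    ... | no e = ≤-trans (proj₁ (improves (⊑-visits vs) (queued G X∈))) (≤-trans (trivial G X)
      (≤-trans (≤-reflexive (cong suc (Empty⇒∣p∣≡0 e))) (s≤s z≤n)))
    ... | yes ne with splits ne s | st
    -- During the first sweep `r` is 0, which admits only the empty set.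
    ...   | A , A∈ , sp | inj₁ refl = ⊥-elim (∣p∣≡0⇒Empty le ne)
    ...   | A , A∈ , sp | inj₂ st′ with proj₁ (st′ X∈) A∈
    ...     | l∈ , u∈ = visits-improve (λ A∈ → A∈) X∈ G vs A∈ (queued G l∈) (queued G u∈)
      (proj₂ (st′ l∈) (<-≤-trans (∣lower∣< X A ne) le))
      (proj₂ (st′ u∈) (<-≤-trans (∣upper∣< X A ne) le)) sp

    -- `fine` says of the visited prefix what `Stage (suc r)` says of the whole queue. `Stage r` is
    -- maintained alongside, because every visit refers to it.
    good-sweep : ∀ {r done T T′} → Good T → Stage r T →
      (∀ {X} → X ∈ₗ done → X ∈ₗ queue T × Children T X × (∣ X ∣ ≤ r → Best T X)) →
      Sweep As done T T′ → Good T′ × Stage (suc r) T′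
    good-sweep G st fine (end refl) =
      G , inj₂ λ X∈ → let (_ , ch , best) = fine X∈ in ch , λ lt → best (s≤s⁻¹ lt)
    good-sweep {r} {done} {T} G st fine (next {T′ = T′} {X = X} {Ys} eq vs sw) =
      good-sweep (good-visits (λ A∈ → A∈) X∈ G vs) (stage-visits X∈ G st vs)
        (λ Z∈ → fine′ (∈-++⁻ done Z∈)) sw
      where
      X∈ : X ∈ₗ queue T
      X∈ = subst (X ∈ₗ_) (sym eq) (∈-++⁺ʳ done (Any.here refl))
      ⊑T′ = ⊑-visits vs
      fine′ : ∀ {Z} → Z ∈ₗ done ⊎ Z ∈ₗ X ∷ [] → Z ∈ₗ queue T′ × Children T′ Z × (∣ Z ∣ ≤ r → Best T′ Z)
      fine′ {Z} (inj₁ Z∈) with fine Z∈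
      ... | Z∈q , ch , best = ⊑-queue ⊑T′ Z∈q ,
        (λ A∈ → ⊑-queue ⊑T′ (proj₁ (ch A∈)) , ⊑-queue ⊑T′ (proj₂ (ch A∈))) ,
        λ le → best-mono {X = Z} ⊑T′ (queued G Z∈q) (best le)
      fine′ (inj₂ (Any.here refl)) = ⊑-queue ⊑T′ X∈ , visits-children (λ A∈ → A∈) X∈ G vs ,
        visits-best X∈ G st vs

    good-sweeps : ∀ {r k T T′} → Good T → Stage r T → Sweeps As k T T′ → Good T′ × Stage (k + r) T′
    good-sweeps G st [] = G , st
    good-sweeps {r} {suc k} {T′ = T″} G st (sw ∷ sws) with good-sweep G st (λ ()) sw
    ... | G′ , st′ with good-sweeps G′ st′ sws
    ...   | G″ , st″ = G″ , subst (λ j → Stage j T″) (+-suc k r) st″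

    good-start : Good start
    good-start = good-insert top (record
      { unique = [] ; member = λ () ; known = λ nz → ⊥-elim (nz refl) ; queued = λ ()
      ; sound = λ () ; trivial = λ _ → z≤n })

    good-bounded : ∀ {T} → Good T → length (queue T) ≤ bound
    good-bounded G = ≤-trans (unique-length (unique G) (λ X∈ → enumerated (member G X∈))) bounded

    optimal : ∀ {T} → Sweeps As (n + 1) start T → Sch (value T ⊤ ∸ 1) ⊤ × (∀ {ℓ} → Sch ℓ ⊤ → value T ⊤ ∸ 1 ≤ ℓ)
    optimal {T} sws with good-sweeps good-start (inj₁ refl) sws
    ... | G , st with ⊤∈ G
      where
      ⊤∈ : Good T → ⊤ ∈ₗ queue T
      ⊤∈ G = ⊑-queue (⊑-sweeps sws) (known good-start (insert-value≢0 ⊤ empty))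
        where
        ⊑-sweep : ∀ {done T T′} → Sweep As done T T′ → T ⊑ T′
        ⊑-sweep (end _)       = ⊑-refl
        ⊑-sweep (next _ vs s) = ⊑-trans (⊑-visits vs) (⊑-sweep s)
        ⊑-sweeps : ∀ {k T T′} → Sweeps As k T T′ → T ⊑ T′
        ⊑-sweeps []       = ⊑-refl
        ⊑-sweeps (s ∷ ss) = ⊑-trans (⊑-sweep s) (⊑-sweeps ss)
    ... | ⊤∈ with value T ⊤ in eq | st
    ... | zero  | _ = ⊥-elim (queued G ⊤∈ eq)
    ... | suc ℓ | inj₁ z = case trans (sym (trans (+-identityʳ (n + 1)) (+-comm n 1))) z of λ ()
    ... | suc ℓ | inj₂ st′ = sound G eq , λ s → s≤s⁻¹ (subst (_≤ suc _) eq
      (proj₂ (st′ ⊤∈) (subst (∣ ⊤ {n} ∣ <_) (sym (trans (+-identityʳ (n + 1)) (+-comm n 1))) (s≤s (∣p∣≤n (⊤ {n})))) s))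

-- Initialisation and the whole program

squareBody countBody appendBody growBody : Cmd
squareBody = 5 ≔ 5 ⊕ 0 ▸ 55 ≔ 55 ⊖ 4
countBody  = popBit ▸ 60 ≔ 60 ⊕ 21 ▸ 61 ≔ 61 ⊖ 4
-- Prefixing a set by `false` keeps its code, so the list for one more element arises in place: only
-- the sets prefixed by `true` are appended, as 2 ^ v plus the old code. Register 57 starts from the
-- old length, hence appended entries are not visited again.
appendBody =
  59 ≔ load 58 ▸ 20 ≔ reg 59 ▸ 60 ≔ const 0 ▸ 61 ≔ reg 56 ▸ loop jobs 61 countBody ▸
  62 ≔ 17 ⊖ 60 ▸ cond 62 (59 ≔ 59 ⊕ 2 ▸ 63 ≔ 5 ⊕ 6 ▸ [ 63 ]≔ 59 ▸ 6 ≔ 6 ⊕ 4) nop ▸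
  58 ≔ 58 ⊕ 4 ▸ 57 ≔ 57 ⊖ 4
growBody =
  57 ≔ reg 6 ▸ 58 ≔ reg 5 ▸ loop lists 57 appendBody ▸
  2 ≔ 2 ⊕ 2 ▸ 3 ≔ 2 ⊖ 4 ▸ 56 ≔ 56 ⊕ 4 ▸ 55 ≔ 55 ⊖ 4

square sizeBound antichains finish main : Cmd
square     = 4 ≔ const 1 ▸ 5 ≔ const 0 ▸ 55 ≔ reg 0 ▸ loop jobs 55 squareBody
-- The operands are registers, so this is m ∸ n. The bound m ∸ 1 reflects that a split uses fewer
-- than m jobs for A.
sizeBound  = 18 ≔ 1 ⊖ 0 ▸ cond 18 (17 ≔ const 0) (17 ≔ 1 ⊖ 4)
antichains = 6 ≔ const 1 ▸ 2 ≔ const 1 ▸ 3 ≔ const 0 ▸ 56 ≔ const 0 ▸ 55 ≔ reg 0 ▸ loop jobs 55 growBody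
-- Register 3 holds 2 ^ n ∸ 1, the code of `⊤`; the last subtraction removes the offset of the
-- stored value.
finish     = 46 ≔ 7 ⊕ 3 ▸ 47 ≔ load 46 ▸ 0 ≔ 47 ⊖ 4
main       = square ▸ sizeBound ▸ antichains ▸ 7 ≔ 5 ⊕ 6 ▸ 8 ≔ 7 ⊕ 2 ▸ 9 ≔ const 0 ▸
             44 ≔ reg 3 ▸ 45 ≔ reg 0 ▸ insert ▸ sweeps ▸ finish

maxSize : ℕ → ℕ → ℕ
maxSize n m with m ∸ n
... | zero  = m ∸ 1
... | suc _ = 0

stored-prefix : ∀ {k M a} (Xs : List (Subset k)) {Ys} → Stored M a (Xs ++ Ys) → Stored M a Xs
stored-prefix []       s       = refl
stored-prefix (X ∷ Xs) (e , s) = e , stored-prefix Xs s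

stored-map-false : ∀ {k M a} (Xs : List (Subset k)) → Stored M a Xs → Stored M a (List.map (false ∷_) Xs)
stored-map-false []       s       = refl
stored-map-false (X ∷ Xs) (e , s) = e , stored-map-false Xs s

module Listing (ρ : Sizes) {n : ℕ} (n≤ : n ≤ #jobs ρ) (K base : ℕ)
               (#lists≥ : length (grown n K) ≤ #lists ρ) where

  open Logic ρ
  open Children ρ

  few? : ∀ {v} (A : Subset v) → Dec (∣ A ∣ < K)
  few? A = ∣ A ∣ <? K

  -- `below` protects the matrix, and the zeros promised by `beyond` later serve as the empty table.
  record Layout {v} (As : List (Subset v)) (M₀ M : ℕ → ℕ) (count : ℕ) : Set where
    field
      counted : count ≡ length As
      stored  : Stored M base As
      below   : ∀ a → a < base → M a ≡ M₀ a
      beyond  : ∀ a → base + length As ≤ a → M a ≡ 0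

  open Layout

  count-spec : ∀ {v} (A : Subset v) {σ} → v ≤ n → regs σ 2 ≡ 2 ^ v → regs σ 3 ≡ 2 ^ v ∸ 1 → regs σ 4 ≡ 1 →
               regs σ 20 ≡ code A → regs σ 60 ≡ 0 → regs σ 61 ≡ v →
               Run (loop jobs 61 countBody) σ (λ τ → regs τ 60 ≡ ∣ A ∣)
  count-spec {v} A {σ} v≤n e2 e3 e4 e20 e60 e61 = weaken
    (for J step (≤-trans v≤n n≤) e61 (0 , refl , e20 , e60))
    λ _ (u , left , _ , r60) → trans r60
      (trans (cong (∑ (bit A)) (trans (sym (+-identityʳ u)) left)) (∑-size A))
    where
    J : ℕ → State → Set
    J k τ = ∃[ u ] (u + k ≡ v × regs τ 20 ≡ shift A u × regs τ 60 ≡ ∑ (bit A) u)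
    step : ∀ k {τ} → Frame countBody σ τ → regs τ 61 ≡ suc k → J (suc k) τ →
           Run countBody τ (λ τ → regs τ 61 ≡ k × J k τ)
    step k f r61 (u , left , r20 , r60) =
      popBit-spec A u (still-below left) (carry f 2 e2) (carry f 3 e3) r20
      then λ g (s20 , s21) → set▸ $ set
        ( cong₂ _∸_ (carry g 61 r61) (carry g 4 (carry f 4 e4))
        , suc u , trans (sym (+-suc u k)) left , s20 , cong₂ _+_ (carry g 60 r60) s21 )

  record Ready (σ : State) (v : ℕ) : Set where
    field
      c2  : regs σ 2 ≡ 2 ^ v
      c3  : regs σ 3 ≡ 2 ^ v ∸ 1
      c4  : regs σ 4 ≡ 1
      c5  : regs σ 5 ≡ base
      c17 : regs σ 17 ≡ K
      c56 : regs σ 56 ≡ v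

  partial : ∀ {v} → List (Subset v) → List (Subset v) → List (Subset (suc v))
  partial As done = List.map (false ∷_) As ++ List.map (true ∷_) (List.filter few? done)

  module _ {v} (v≤n : v ≤ n) (As : List (Subset v)) {M₀ : ℕ → ℕ} where

    entry≡ : ∀ {M done A todo} → As ≡ done ++ A ∷ todo → Stored M base (partial As done) →
             M (base + length done) ≡ code A
    entry≡ {M} {done} {A} {todo} eq s = trans
      (cong (λ l → M (base + l)) (sym (Listₚ.length-map (false ∷_) done)))
      (stored-at (List.map (false ∷_) done)
        (subst (Stored M base) (trans (cong (List.map (false ∷_)) eq) (Listₚ.map-++ (false ∷_) done (A ∷ todo)))
          (stored-prefix (List.map (false ∷_) As) s)))

    push : ∀ {σ A done todo} → Ready σ v → As ≡ done ++ A ∷ todo →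
           Layout (partial As done) M₀ (mem σ) (regs σ 6) → regs σ 59 ≡ code A → regs σ 62 ≡ K ∸ ∣ A ∣ →
           Run (cond 62 (59 ≔ 59 ⊕ 2 ▸ 63 ≔ 5 ⊕ 6 ▸ [ 63 ]≔ 59 ▸ 6 ≔ 6 ⊕ 4) nop) σ
               (λ τ → Layout (partial As (done ++ A ∷ [])) M₀ (mem τ) (regs τ 6))
    push {σ} {A} {done} {todo} rd eq L e59 e62 = branch
      (λ nz → set▸ $ set▸ $ put▸ $ set $ added (m∸n≢0⇒n<m (λ z → nz (trans e62 z))))
      (λ z → stop (subst (λ Bs → Layout Bs M₀ (mem σ) (regs σ 6)) (sym (dropped (λ lt →
        <⇒≱ lt (m∸n≡0⇒m≤n (trans (sym e62) z))))) L))
      where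
      open Ready rd
      filtered : ∀ {Bs} → List.filter few? (A ∷ []) ≡ Bs →
                 partial As (done ++ A ∷ []) ≡ partial As done ++ List.map (true ∷_) Bs
      filtered {Bs} e = begin
        F ++ List.map (true ∷_) (List.filter few? (done ++ A ∷ []))
          ≡⟨ cong (λ l → F ++ List.map (true ∷_) l)
               (trans (Listₚ.filter-++ few? done (A ∷ [])) (cong (List.filter few? done ++_) e)) ⟩
        F ++ List.map (true ∷_) (List.filter few? done ++ Bs)
          ≡⟨ cong (F ++_) (Listₚ.map-++ (true ∷_) (List.filter few? done) Bs) ⟩
        F ++ (List.map (true ∷_) (List.filter few? done) ++ List.map (true ∷_) Bs)
          ≡⟨ sym (Listₚ.++-assoc F _ _) ⟩
        partial As done ++ List.map (true ∷_) Bs ∎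
        where
        open ≡-Reasoning
        F = List.map (false ∷_) As
      dropped : ¬ (∣ A ∣ < K) → partial As (done ++ A ∷ []) ≡ partial As done
      dropped no-few = trans (filtered (Listₚ.filter-reject few? no-few)) (Listₚ.++-identityʳ _)
      end = regs σ 5 + regs σ 6
      item = regs σ 59 + regs σ 2
      M′ = mem σ [ end ↦ item ]
      end≡ : end ≡ base + length (partial As done)
      end≡ = cong₂ _+_ c5 (counted L)
      item≡ : item ≡ code (true ∷ A)
      item≡ = trans (cong₂ _+_ e59 c2) (+-comm (code A) (2 ^ v))
      len+1 : length (partial As done ++ (true ∷ A) ∷ []) ≡ length (partial As done) + 1
      len+1 = Listₚ.length-++ (partial As done)
      added : ∣ A ∣ < K → Layout (partial As (done ++ A ∷ [])) M₀ M′ (regs σ 6 + regs σ 4)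
      added few = subst (λ Bs → Layout Bs M₀ M′ (regs σ 6 + regs σ 4))
        (sym (filtered (Listₚ.filter-accept few? few))) (record
        { counted = trans (cong₂ _+_ (counted L) c4) (sym len+1)
        ; stored  = stored-snoc (partial As done)
            (stored-cong (partial As done)
              (λ b _ b< → update-other (mem σ) λ b≡ → <⇒≢ b< (trans b≡ end≡)) (stored L))
            (trans (cong M′ (sym end≡)) (trans (update-same (mem σ) end) item≡))
        ; below   = λ a a< → trans (update-other (mem σ) λ a≡ →
            <⇒≢ (<-≤-trans a< (m≤m+n base (length (partial As done)))) (trans a≡ end≡)) (below L a a<)
        ; beyond  = λ a le →
            let len = length (partial As done)
                le′ = ≤-trans (≤-reflexive (trans (+-assoc base len 1) (cong (base +_) (sym len+1)))) le in
            trans (update-other (mem σ) λ a≡ →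
                <⇒≢ (≤-trans (≤-reflexive (+-comm 1 (base + len))) le′) (sym (trans a≡ end≡)))
              (beyond L a (≤-trans (m≤m+n _ 1) le′)) })

    append-spec : ∀ {σ} → Ready σ v → length As ≤ #lists ρ → Layout As M₀ (mem σ) (regs σ 6) →
                  regs σ 57 ≡ length As → regs σ 58 ≡ base →
                  Run (loop lists 57 appendBody) σ (λ τ → Layout (grow K As) M₀ (mem τ) (regs τ 6))
    append-spec {σ} rd le L e57 e58 = weaken
      (for J step le e57 (record
        { done = [] ; todo = As ; split≡ = refl ; length≡ = refl
        ; r58 = trans e58 (sym (+-identityʳ base))
        ; layout = subst (λ Bs → Layout Bs M₀ (mem σ) (regs σ 6)) (sym (Listₚ.++-identityʳ _)) (record
            { counted = trans (counted L) (sym (Listₚ.length-map (false ∷_) As))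
            ; stored = stored-map-false As (stored L)
            ; below = below L
            ; beyond = λ a le → beyond L a (subst (λ l → base + l ≤ a) (Listₚ.length-map (false ∷_) As) le) }) }))
      (λ _ → conclude)
      where
      open Ready rd
      record J (k : ℕ) (τ : State) : Set where
        no-eta-equality; pattern
        field
          done todo : List (Subset v)
          split≡    : As ≡ done ++ todo
          length≡   : length todo ≡ k
          r58       : regs τ 58 ≡ base + length done
          layout    : Layout (partial As done) M₀ (mem τ) (regs τ 6)
      conclude : ∀ {τ} → J 0 τ → Layout (grow K As) M₀ (mem τ) (regs τ 6)
      conclude {τ} record { done = done ; todo = [] ; split≡ = split≡ ; layout = layout } =
        subst (λ Bs → Layout (partial As Bs) M₀ (mem τ) (regs τ 6))
          (sym (trans split≡ (Listₚ.++-identityʳ done))) layout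
      step : ∀ k {τ} → Frame appendBody σ τ → regs τ 57 ≡ suc k → J (suc k) τ →
             Run appendBody τ (λ τ → regs τ 57 ≡ k × J k τ)
      step k {τ} f r57 record { done = done ; todo = A ∷ todo ; split≡ = split≡ ; length≡ = refl
                ; r58 = r58 ; layout = layout } =
        let here≡ = trans (cong (mem τ) r58) (entry≡ split≡ (stored layout)) in
        set▸ $ set▸ $ set▸ $ set▸ $ count-spec A v≤n (carry f 2 c2) (carry f 3 c3)
          (carry f 4 c4) here≡ refl (carry f 56 c56)
        then λ {τ₁} g r60 → set▸ $ push {todo = todo}
          (record { c2 = carry g 2 (carry f 2 c2)
                  ; c3 = carry g 3 (carry f 3 c3)
                  ; c4 = carry g 4 (carry f 4 c4)
                  ; c5 = carry g 5 (carry f 5 c5)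
                  ; c17 = carry g 17 (carry f 17 c17)
                  ; c56 = carry g 56 (carry f 56 c56) })
          split≡ (subst₂ (λ M c → Layout (partial As done) M₀ M c) (sym (keptMem g refl)) (sym (kept g 6 refl)) layout)
          (carry g 59 here≡)
          (cong₂ _∸_ (carry g 17 (carry f 17 c17)) r60)
        then λ h layout′ →
          let one = carry h 4 (carry g 4 (carry f 4 c4)) in
          set▸ $ set
            ( cong₂ _∸_ (carry h 57 (carry g 57 r57)) one
            , record
              { done = done ++ A ∷ [] ; todo = todo
              ; split≡ = trans split≡ (sym (Listₚ.++-assoc done (A ∷ []) todo))
              ; length≡ = refl
              ; r58 = trans (cong₂ _+_ (carry h 58 (carry g 58 r58)) one)
                  (trans (+-assoc base (length done) 1) (cong (base +_) (sym (Listₚ.length-++ done))))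
              ; layout = layout′ } )

  antichains-spec : ∀ {σ} → regs σ 0 ≡ n → regs σ 4 ≡ 1 → regs σ 5 ≡ base → regs σ 17 ≡ K →
                    (∀ a → base ≤ a → mem σ a ≡ 0) →
                    Run antichains σ (λ τ → Ready τ n × Layout (grown n K) (mem σ) (mem τ) (regs τ 6))
  antichains-spec {σ} e0 e4 e5 e17 clear = set▸ $ set▸ $ set▸ $ set▸ $ set▸ $ weaken
    (for J step n≤ e0 (0 , refl ,
      record { c2 = refl ; c3 = refl ; c4 = e4 ; c5 = e5 ; c17 = e17 ; c56 = refl } ,
      record { counted = refl ; stored = clear base ≤-refl , refl ; below = λ _ _ → refl
             ; beyond = λ a le → clear a (≤-trans (m≤m+n base 1) le) }))
    λ _ → conclude
    where
    J : ℕ → State → Set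
    J k τ = ∃[ v ] (v + k ≡ n × Ready τ v × Layout (grown v K) (mem σ) (mem τ) (regs τ 6))
    conclude : ∀ {τ} → J 0 τ → Ready τ n × Layout (grown n K) (mem σ) (mem τ) (regs τ 6)
    conclude (v , left , rd , L) with trans (sym (+-identityʳ v)) left
    ... | refl = rd , L
    step : ∀ k {τ} → Frame growBody _ τ → regs τ 55 ≡ suc k → J (suc k) τ →
           Run growBody τ (λ τ → regs τ 55 ≡ k × J k τ)
    step k {τ} f r55 (v , left , rd , L) = set▸ $ set▸ $
      append-spec (<⇒≤ (still-below left)) (grown v K)
        (record { c2 = c2 ; c3 = c3 ; c4 = c4 ; c5 = c5 ; c17 = c17 ; c56 = c56 })
        (≤-trans (∣grown∣-mono K (<⇒≤ (still-below left))) #lists≥) L (counted L) c5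
      then λ g L′ →
        let one = carry g 4 c4
            pow = trans (cong₂ _+_ (carry g 2 c2) (carry g 2 c2)) (sym (double v)) in
        set▸ $ set▸ $ set▸ $ set
          ( cong₂ _∸_ (carry g 55 r55) one
          , suc v , trans (sym (+-suc v k)) left
          , record { c2 = pow ; c3 = cong₂ _∸_ pow one ; c4 = one ; c5 = carry g 5 c5
                   ; c17 = carry g 17 c17
                   ; c56 = trans (cong₂ _+_ (carry g 56 c56) one) (+-comm v 1) }
          , L′ )
      where open Ready rd

module Input (I : Instance) where

  open Instance I renaming (jobs to n)

  input-adjacent : ∀ (v u : Fin n) → inputMem I (toℕ v * n + toℕ u) ≡ (if does (v ≺? u) then 1 else 0)
  input-adjacent v u with (toℕ v * n + toℕ u) <? n * n
  ... | yes lt = cong (adjacency I) (trans (cong (Fin.remQuot n) at) (Finₚ.remQuot-combine v u))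
    where
    at : fromℕ< lt ≡ Fin.combine v u
    at = Finₚ.toℕ-injective (trans (Finₚ.toℕ-fromℕ< lt)
      (sym (trans (Finₚ.toℕ-combine v u) (cong (_+ toℕ u) (*-comm n (toℕ v))))))
  ... | no ¬lt = ⊥-elim (¬lt (cell<n² v u))

  input-clear : ∀ a → n * n ≤ a → inputMem I a ≡ 0
  input-clear a le with a <? n * n
  ... | yes lt = ⊥-elim (<⇒≱ lt le)
  ... | no  _  = refl

module Execution (I : Instance) (ρ : Sizes) (n≤ : Instance.jobs I ≤ #jobs ρ) where

  open Instance I renaming (jobs to n; machines to m)
  open Input I
  open Logic ρ

  K : ℕ
  K = maxSize n m

  As : List (Subset n)
  As = grown n K

  open Tables _≺_ isOrder m

  square-spec : Run square (input I) (λ τ → regs τ 4 ≡ 1 × regs τ 5 ≡ n * n)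
  square-spec = set▸ $ set▸ $ set▸ $ weaken (for J step n≤ refl (refl , 0 , refl , refl)) λ {τ} _ → conclude {τ}
    where
    J : ℕ → State → Set
    J k τ = regs τ 4 ≡ 1 × ∃[ u ] (u + k ≡ n × regs τ 5 ≡ u * n)
    conclude : ∀ {τ} → J 0 τ → regs τ 4 ≡ 1 × regs τ 5 ≡ n * n
    conclude {τ} (r4 , u , left , r5) = r4 , trans r5 (cong (_* n) (trans (sym (+-identityʳ u)) left))
    step : ∀ k {τ} → Frame squareBody _ τ → regs τ 55 ≡ suc k → J (suc k) τ →
           Run squareBody τ (λ τ → regs τ 55 ≡ k × J k τ)
    step k f r55 (r4 , u , left , r5) = set▸ $ set
      ( cong₂ _∸_ r55 r4 , r4 , suc u , trans (sym (+-suc u k)) left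
      , trans (cong₂ _+_ r5 (kept f 0 refl)) (+-comm (u * n) n) )

  sizeBound-spec : ∀ {σ} → regs σ 0 ≡ n → regs σ 1 ≡ m → regs σ 4 ≡ 1 →
                   Run sizeBound σ (λ τ → regs τ 17 ≡ K)
  sizeBound-spec {σ} e0 e1 e4 = set▸ $ branch
    (λ nz → set (sym (large nz))) (λ z → set (trans (cong₂ _∸_ e1 e4) (sym (small z))))
    where
    large : regs σ 1 ∸ regs σ 0 ≢ 0 → maxSize n m ≡ 0
    large nz with m ∸ n in eq
    ... | zero  = ⊥-elim (nz (trans (cong₂ _∸_ e1 e0) eq))
    ... | suc _ = refl
    small : regs σ 1 ∸ regs σ 0 ≡ 0 → maxSize n m ≡ m ∸ 1
    small z with m ∸ n in eq
    ... | zero  = refl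
    ... | suc _ = case trans (sym z) (trans (cong₂ _∸_ e1 e0) eq) of λ ()

  module _ (0<m : 0 < m) (#As : length As ≤ #lists ρ) (Good : Table → Set)
           (good-start : Good start)
           (good-visits : ∀ {X T T′} → X ∈ₗ queue T → Good T → Visits X As T T′ → Good T′)
           (good-extends : ∀ {X T T′} → Good T → Visits X As T T′ → ∃[ Ys ] queue T′ ≡ queue T ++ Ys)
           (good-bounded : ∀ {T} → Good T → length (queue T) ≤ #sets ρ) where

    open Listing ρ n≤ K (n * n) #As
    open Implementation ρ n≤ _≺_ isOrder m 0<m As #As (n * n) (n * n + length As) refl ≤-refl

    main-spec : Run main (input I) (λ τ → ∃[ T ] (Sweeps As (n + 1) start T × regs τ 0 ≡ value T ⊤ ∸ 1))
    main-spec =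
      square-spec
      then λ f (r4 , r5) → let unchanged = keptMem f refl in
      sizeBound-spec (kept f 0 refl) (kept f 1 refl) r4
      then λ g r17 → antichains-spec
        (carry g 0 (kept f 0 refl)) (carry g 4 r4) (carry g 5 r5) r17
        (λ a le → trans (cong (λ M → M a) (trans (keptMem g refl) unchanged)) (input-clear a le))
      then λ {τ₃} h (rd , L) → let open Ready rd in
      set▸ $ set▸ $ set▸ $ set▸ $ set▸ $ insert-spec {T = empty} ⊤
        (record
        { r0 = carry h 0 (carry g 0 (kept f 0 refl))
        ; r1 = carry h 1 (carry g 1 (kept f 1 refl))
        ; r2 = c2 ; r3 = c3 ; r4 = c4 ; r5 = c5 ; r6 = Layout.counted L
        ; r7 = cong₂ _+_ c5 (Layout.counted L)
        ; r8 = cong₂ _+_ (cong₂ _+_ c5 (Layout.counted L)) c2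
        ; r9 = refl
        ; adjacent = λ v u → trans (Layout.below L _ (cell<n² v u))
            (trans (cong (λ M → M (toℕ v * n + toℕ u)) (trans (keptMem g refl) unchanged)) (input-adjacent v u))
        ; listed = Layout.stored L
        ; valued = λ X → Layout.beyond L _ (m≤m+n _ (code X))
        ; queued = refl })
        (trans c3 (sym (code-⊤ n)))
        (carry h 0 (carry g 0 (carry f 0 (sym (∣⊤∣≡n n)))))
      then λ _ R → sweeps-spec Good good-visits good-extends good-bounded R good-start
      then λ {τ} _ (T , ss , _ , R′) → set▸ $ set▸ $ set
        (T , ss , cong₂ _∸_ (trans (cong (mem τ) (cong₂ _+_ (Represented.r7 R′)
          (trans (Represented.r3 R′) (sym (code-⊤ n))))) (Represented.valued R′ ⊤)) (Represented.r4 R′))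

-- Running time

n<2^n : ∀ n → n < 2 ^ n
n<2^n zero    = ≤-refl
n<2^n (suc n) = begin-strict
  suc n ≤⟨ n<2^n n ⟩
  2 ^ n <⟨ m<m+n (2 ^ n) (1≤2^ n) ⟩
  2 ^ n + 2 ^ n ≡⟨ sym (double n) ⟩
  2 ^ suc n ∎
  where open ≤-Reasoning

*-interchange : ∀ a b c d → a * b * (c * d) ≡ a * c * (b * d)
*-interchange = solve-∀

^-distribʳ-* : ∀ a b k → (a * b) ^ k ≡ a ^ k * b ^ k
^-distribʳ-* a b zero    = refl
^-distribʳ-* a b (suc k) = trans (cong (a * b *_) (^-distribʳ-* a b k)) (*-interchange a b (a ^ k) (b ^ k))

1^ : ∀ k → 1 ^ k ≡ 1
1^ = ^-zeroˡ

^2-cancel-≤ : ∀ {x y} → x ^ 2 ≤ y ^ 2 → x ≤ y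
^2-cancel-≤ {x} {y} le with x ≤? y
... | yes x≤y = x≤y
... | no  x≰y = ⊥-elim (<⇒≱ (^-monoˡ-< 2 (≰⇒> x≰y)) le)

record Root (k : ℕ) : Set where
  field
    root     : ℕ
    root²≤   : root * root ≤ k
    <root+1² : k < suc root * suc root

isqrt : ∀ k → Root k
isqrt zero    = record { root = 0 ; root²≤ = z≤n ; <root+1² = s≤s z≤n }
isqrt (suc k) with isqrt k
... | record { root = s ; root²≤ = lo ; <root+1² = hi } with suc s * suc s ≤? suc k
...   | yes le = record
  { root = suc s ; root²≤ = le
  ; <root+1² = ≤-trans (s≤s hi) (*-mono-< (n<1+n (suc s)) (n<1+n (suc s))) }
...   | no ¬le = record { root = s ; root²≤ = m≤n⇒m≤1+n lo ; <root+1² = ≰⇒> ¬le }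

-- (1 + 1/n)^m ≥ 1 + m/n and (1 − 1/(n+1))^k ≥ 1 − k/(n+1), cleared of
-- denominators.

bernoulli : ∀ n m → (n + m) * n ^ m ≤ n * suc n ^ m
bernoulli n zero = ≤-reflexive (cong (_* 1) (+-identityʳ n))
bernoulli n (suc m) = begin
  (n + suc m) * (n * n ^ m) ≡⟨ regroup n m (n ^ m) ⟩
  n * ((n + m) * n ^ m) + n * n ^ m ≤⟨ +-mono-≤ (*-monoʳ-≤ n (bernoulli n m))
                (*-monoʳ-≤ n (^-monoˡ-≤ m (n≤1+n n))) ⟩
  n * (n * suc n ^ m) + n * suc n ^ m ≡⟨ collect n (suc n ^ m) ⟩
  n * (suc n * suc n ^ m) ∎
  where
  open ≤-Reasoning
  regroup : ∀ n m x → (n + suc m) * (n * x) ≡ n * ((n + m) * x) + n * x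
  regroup = solve-∀
  collect : ∀ n x → n * (n * x) + n * x ≡ n * (suc n * x)
  collect = solve-∀

inverse-bernoulli : ∀ n k r → k + r ≡ suc n → suc n ^ k * r ≤ n ^ k * suc n
inverse-bernoulli n zero    r refl = ≤-refl
inverse-bernoulli n (suc k) r eq = begin
  suc n * suc n ^ k * r ≡⟨ front n (suc n ^ k) r ⟩
  suc n ^ k * (r + r * n) ≤⟨ *-monoʳ-≤ (suc n ^ k) (+-monoˡ-≤ (r * n) r≤n) ⟩
  suc n ^ k * (n + r * n) ≡⟨ back n (suc n ^ k) r ⟩
  n * (suc n ^ k * suc r) ≤⟨ *-monoʳ-≤ n (inverse-bernoulli n k (suc r) (trans (+-suc k r) eq)) ⟩
  n * (n ^ k * suc n) ≡⟨ sym (*-assoc n (n ^ k) (suc n)) ⟩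
  n * n ^ k * suc n ∎
  where
  open ≤-Reasoning
  r≤n : r ≤ n
  r≤n = subst (r ≤_) (suc-injective eq) (m≤n+m r k)
  front : ∀ n x r → suc n * x * r ≡ x * (r + r * n)
  front = solve-∀
  back : ∀ n x r → x * (n + r * n) ≡ n * (x * suc r)
  back = solve-∀

-- For these `k` the number 1 - k/(n + 1) is at least one half, so `inverse-bernoulli` gives (1 +
-- 1/n)^k ≤ 2.
half-power : ∀ n k → k + k ≤ suc n → suc n ^ k ≤ 2 * n ^ k
half-power n k le = *-cancelʳ-≤ _ _ (suc n) (begin
  suc n ^ k * suc n ≤⟨ *-monoʳ-≤ (suc n ^ k) (≤-trans (≤-reflexive (sym eq)) (+-monoˡ-≤ r k≤r)) ⟩
  suc n ^ k * (r + r) ≡⟨ *-distribˡ-+ (suc n ^ k) r r ⟩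
  suc n ^ k * r + suc n ^ k * r ≤⟨ +-mono-≤ (inverse-bernoulli n k r eq) (inverse-bernoulli n k r eq) ⟩
  n ^ k * suc n + n ^ k * suc n ≡⟨ twice (n ^ k) (suc n) ⟩
  2 * n ^ k * suc n ∎)
  where
  open ≤-Reasoning
  r = suc n ∸ k
  eq : k + r ≡ suc n
  eq = m+[n∸m]≡n (≤-trans (m≤m+n k k) le)
  k≤r : k ≤ r
  k≤r = +-cancelˡ-≤ k k r (≤-trans le (≤-reflexive (sym eq)))
  twice : ∀ x y → x * y + x * y ≡ 2 * x * y
  twice = solve-∀

-- Each half of the exponent contributes a factor 2. The constant 4 stands in for e, the limit of (1
-- + 1/n)^n.
compound : ∀ n → suc n ^ n ≤ 4 * n ^ n
compound n = begin
  suc n ^ n ≡⟨ cong (suc n ^_) (sym halves) ⟩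
  suc n ^ (⌊ n /2⌋ + ⌈ n /2⌉) ≡⟨ ^-distribˡ-+-* (suc n) ⌊ n /2⌋ ⌈ n /2⌉ ⟩
  suc n ^ ⌊ n /2⌋ * suc n ^ ⌈ n /2⌉ ≤⟨ *-mono-≤ (half-power n ⌊ n /2⌋ lo) (half-power n ⌈ n /2⌉ hi) ⟩
  (2 * n ^ ⌊ n /2⌋) * (2 * n ^ ⌈ n /2⌉) ≡⟨ pair (n ^ ⌊ n /2⌋) (n ^ ⌈ n /2⌉) ⟩
  4 * (n ^ ⌊ n /2⌋ * n ^ ⌈ n /2⌉) ≡⟨ cong (4 *_) (sym (^-distribˡ-+-* n ⌊ n /2⌋ ⌈ n /2⌉)) ⟩
  4 * n ^ (⌊ n /2⌋ + ⌈ n /2⌉) ≡⟨ cong (λ k → 4 * n ^ k) halves ⟩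
  4 * n ^ n ∎
  where
  open ≤-Reasoning
  halves = ⌊n/2⌋+⌈n/2⌉≡n n
  lo : ⌊ n /2⌋ + ⌊ n /2⌋ ≤ suc n
  lo = ≤-trans (+-monoʳ-≤ ⌊ n /2⌋ (⌊n/2⌋≤⌈n/2⌉ n)) (≤-trans (≤-reflexive halves) (n≤1+n n))
  hi : ⌈ n /2⌉ + ⌈ n /2⌉ ≤ suc n
  hi = ≤-trans (+-monoʳ-≤ ⌈ n /2⌉ (⌊n/2⌋≤⌈n/2⌉ (suc n))) (≤-reflexive (⌊n/2⌋+⌈n/2⌉≡n (suc n)))
  pair : ∀ x y → (2 * x) * (2 * y) ≡ 4 * (x * y)
  pair = solve-∀

-- An integral substitute for (1 + m/n)^n ≤ e^m: by `bernoulli` 1 + m/n is at most (1 + 1/n)^m, and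
-- `compound` bounds the n-th power of the latter.
growth : ∀ n m .{{_ : NonZero n}} → (n + m) ^ n ≤ 4 ^ m * n ^ n
growth n m = *-cancelʳ-≤ _ _ (n ^ (m * n)) {{m^n≢0 n (m * n)}} (begin
  (n + m) ^ n * n ^ (m * n) ≡⟨ cong ((n + m) ^ n *_) (sym (^-*-assoc n m n)) ⟩
  (n + m) ^ n * (n ^ m) ^ n ≡⟨ sym (^-distribʳ-* (n + m) (n ^ m) n) ⟩
  ((n + m) * n ^ m) ^ n ≤⟨ ^-monoˡ-≤ n (bernoulli n m) ⟩
  (n * suc n ^ m) ^ n ≡⟨ ^-distribʳ-* n (suc n ^ m) n ⟩
  n ^ n * (suc n ^ m) ^ n ≡⟨ cong (n ^ n *_) (trans (^-*-assoc (suc n) m n)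
                (trans (cong (suc n ^_) (*-comm m n)) (sym (^-*-assoc (suc n) n m)))) ⟩
  n ^ n * (suc n ^ n) ^ m ≤⟨ *-monoʳ-≤ (n ^ n) (^-monoˡ-≤ m (compound n)) ⟩
  n ^ n * (4 * n ^ n) ^ m ≡⟨ cong (n ^ n *_) (^-distribʳ-* 4 (n ^ n) m) ⟩
  n ^ n * (4 ^ m * (n ^ n) ^ m) ≡⟨ cong (λ x → n ^ n * (4 ^ m * x))
                (trans (^-*-assoc n n m) (cong (n ^_) (*-comm n m))) ⟩
  n ^ n * (4 ^ m * n ^ (m * n)) ≡⟨ rotate (n ^ n) (4 ^ m) (n ^ (m * n)) ⟩
  4 ^ m * n ^ n * n ^ (m * n) ∎)
  where
  open ≤-Reasoning
  rotate : ∀ a b c → a * (b * c) ≡ b * a * c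
  rotate = solve-∀

∣smallSets-suc∣ : ∀ v j → length (smallSets (suc v) (suc j)) ≡ length (smallSets v (suc j)) + length (smallSets v j)
∣smallSets-suc∣ v j = trans (Listₚ.length-++ (List.map (false ∷_) (smallSets v (suc j))))
  (cong₂ _+_ (Listₚ.length-map (false ∷_) (smallSets v (suc j))) (Listₚ.length-map (true ∷_) (smallSets v j)))

-- The count times (m/n)^j is at most (1 + m/n)^v, as each set has weight at
-- least (m/n)^j in the expansion of the latter.
smallSets-weight : ∀ {n m} v j → m ≤ n → length (smallSets v j) * m ^ j * n ^ v ≤ (n + m) ^ v * n ^ j
smallSets-weight {n} {m} zero j m≤n = begin
  1 * m ^ j * 1 ≡⟨ unit (m ^ j) ⟩
  m ^ j ≤⟨ ^-monoˡ-≤ j m≤n ⟩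
  n ^ j ≡⟨ sym (+-identityʳ (n ^ j)) ⟩
  1 * n ^ j ∎
  where
  open ≤-Reasoning
  unit : ∀ x → 1 * x * 1 ≡ x
  unit = solve-∀
smallSets-weight {n} {m} (suc v) zero m≤n = begin
  length (smallSets (suc v) 0) * 1 * (n * n ^ v)
    ≡⟨ cong (λ l → l * 1 * (n * n ^ v)) (Listₚ.length-map (false ∷_) (smallSets v 0)) ⟩
  length (smallSets v 0) * 1 * (n * n ^ v) ≡⟨ front (length (smallSets v 0)) n (n ^ v) ⟩
  n * (length (smallSets v 0) * 1 * n ^ v) ≤⟨ *-mono-≤ (m≤m+n n m) (smallSets-weight v 0 m≤n) ⟩
  (n + m) * ((n + m) ^ v * 1) ≡⟨ sym (*-assoc (n + m) _ 1) ⟩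
  (n + m) * (n + m) ^ v * 1 ∎
  where
  open ≤-Reasoning
  front : ∀ l n x → l * 1 * (n * x) ≡ n * (l * 1 * x)
  front = solve-∀
smallSets-weight {n} {m} (suc v) (suc j) m≤n = begin
  length (smallSets (suc v) (suc j)) * (m * m ^ j) * (n * n ^ v)
    ≡⟨ cong (λ l → l * (m * m ^ j) * (n * n ^ v)) (∣smallSets-suc∣ v j) ⟩
  (a + b) * (m * m ^ j) * (n * n ^ v) ≡⟨ parts a b m (m ^ j) n (n ^ v) ⟩
  n * (a * (m * m ^ j) * n ^ v) + n * m * (b * m ^ j * n ^ v)
    ≤⟨ +-mono-≤ (*-monoʳ-≤ n (smallSets-weight v (suc j) m≤n)) (*-monoʳ-≤ (n * m) (smallSets-weight v j m≤n)) ⟩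
  n * ((n + m) ^ v * (n * n ^ j)) + n * m * ((n + m) ^ v * n ^ j) ≡⟨ collect n m ((n + m) ^ v) (n ^ j) ⟩
  (n + m) * (n + m) ^ v * (n * n ^ j) ∎
  where
  open ≤-Reasoning
  a = length (smallSets v (suc j))
  b = length (smallSets v j)
  parts : ∀ a b m x n y → (a + b) * (m * x) * (n * y) ≡ n * (a * (m * x) * y) + n * m * (b * x * y)
  parts = solve-∀
  collect : ∀ n m x y → n * (x * (n * y)) + n * m * (x * y) ≡ (n + m) * x * (n * y)
  collect = solve-∀

-- The weight m/n serves for every `j`, so the extra factor is always 4 ^ m. This is good enough for
-- the sets A and for sets of `s` jobs alike, because m ≤ s.
∣smallSets∣≤ : ∀ n m j .{{_ : NonZero n}} → m ≤ n → length (smallSets n j) * m ^ j ≤ 4 ^ m * n ^ j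
∣smallSets∣≤ n m j m≤n = *-cancelʳ-≤ _ _ (n ^ n) {{m^n≢0 n n}} (begin
  length (smallSets n j) * m ^ j * n ^ n ≤⟨ smallSets-weight n j m≤n ⟩
  (n + m) ^ n * n ^ j ≤⟨ *-monoˡ-≤ (n ^ j) (growth n m) ⟩
  4 ^ m * n ^ n * n ^ j ≡⟨ swap (4 ^ m) (n ^ n) (n ^ j) ⟩
  4 ^ m * n ^ j * n ^ n ∎)
  where
  open ≤-Reasoning
  swap : ∀ a b c → a * b * c ≡ a * c * b
  swap = solve-∀

∣smallSets-0∣ : ∀ v → length (smallSets v 0) ≡ 1
∣smallSets-0∣ zero    = refl
∣smallSets-0∣ (suc v) = trans (Listₚ.length-map (false ∷_) (smallSets v 0)) (∣smallSets-0∣ v)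

-- t ≼ e means t ≤ (1 + n / m) ^ e.

module Exponents (n m : ℕ) (m≤n : m ≤ n) where

  infix 4 _≼_

  _≼_ : ℕ → ℕ → Set
  t ≼ e = t * m ^ e ≤ (m + n) ^ e

  ≼-mono : ∀ {t e f} → e ≤ f → t ≼ e → t ≼ f
  ≼-mono {t} {e} {f} e≤f p = begin
    t * m ^ f ≡⟨ cong (λ k → t * m ^ k) (sym (m+[n∸m]≡n e≤f)) ⟩
    t * m ^ (e + (f ∸ e)) ≡⟨ cong (t *_) (^-distribˡ-+-* m e (f ∸ e)) ⟩
    t * (m ^ e * m ^ (f ∸ e)) ≡⟨ sym (*-assoc t (m ^ e) _) ⟩
    t * m ^ e * m ^ (f ∸ e) ≤⟨ *-mono-≤ p (^-monoˡ-≤ (f ∸ e) (m≤m+n m n)) ⟩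
    (m + n) ^ e * (m + n) ^ (f ∸ e) ≡⟨ sym (^-distribˡ-+-* (m + n) e (f ∸ e)) ⟩
    (m + n) ^ (e + (f ∸ e)) ≡⟨ cong ((m + n) ^_) (m+[n∸m]≡n e≤f) ⟩
    (m + n) ^ f ∎
    where open ≤-Reasoning

  ≼-weaken : ∀ {t t′ e} → t ≤ t′ → t′ ≼ e → t ≼ e
  ≼-weaken {e = e} t≤t′ p = ≤-trans (*-monoˡ-≤ (m ^ e) t≤t′) p

  ≼-* : ∀ {a b e f} → a ≼ e → b ≼ f → a * b ≼ e + f
  ≼-* {a} {b} {e} {f} p q = begin
    a * b * m ^ (e + f) ≡⟨ cong (a * b *_) (^-distribˡ-+-* m e f) ⟩
    a * b * (m ^ e * m ^ f) ≡⟨ *-interchange a b (m ^ e) (m ^ f) ⟩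
    a * m ^ e * (b * m ^ f) ≤⟨ *-mono-≤ p q ⟩
    (m + n) ^ e * (m + n) ^ f ≡⟨ sym (^-distribˡ-+-* (m + n) e f) ⟩
    (m + n) ^ (e + f) ∎
    where open ≤-Reasoning

  ≼-^ : ∀ {a e} k → a ≼ e → a ^ k ≼ k * e
  ≼-^ zero    p = ≤-refl
  ≼-^ {a} {e} (suc k) p = ≼-* {a} {a ^ k} {e} {k * e} p (≼-^ {a} {e} k p)

  -- The base 1 + n/m is at least 2. Constants and polynomials in n enter the exponent by way of
  -- powers of 2.
  2^≼ : ∀ e → 2 ^ e ≼ e
  2^≼ e = begin
    2 ^ e * m ^ e ≡⟨ sym (^-distribʳ-* 2 m e) ⟩
    (2 * m) ^ e ≤⟨ ^-monoˡ-≤ e (+-monoʳ-≤ m (≤-trans (≤-reflexive (+-identityʳ m)) m≤n)) ⟩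
    (m + n) ^ e ∎
    where open ≤-Reasoning

  k≼k : ∀ k → k ≼ k
  k≼k k = ≼-weaken {k} {2 ^ k} {k} (<⇒≤ (n<2^n k)) (2^≼ k)

  ≼-+ : ∀ {a b e f} → a ≼ e → b ≼ f → a + b ≼ suc (e + f)
  ≼-+ {a} {b} {e} {f} p q = begin
    (a + b) * (m * m ^ (e + f)) ≡⟨ distribute a b m (m ^ (e + f)) ⟩
    m * (a * m ^ (e + f) + b * m ^ (e + f)) ≤⟨ *-monoʳ-≤ m (+-mono-≤
                (≼-mono {a} (m≤m+n e f) p) (≼-mono {b} (m≤n+m f e) q)) ⟩
    m * ((m + n) ^ (e + f) + (m + n) ^ (e + f)) ≡⟨ twice m ((m + n) ^ (e + f)) ⟩
    (m + m) * (m + n) ^ (e + f) ≤⟨ *-monoˡ-≤ ((m + n) ^ (e + f)) (+-monoʳ-≤ m m≤n) ⟩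
    (m + n) * (m + n) ^ (e + f) ∎
    where
    open ≤-Reasoning
    distribute : ∀ a b m x → (a + b) * (m * x) ≡ m * (a * x + b * x)
    distribute = solve-∀
    twice : ∀ m x → m * (x + x) ≡ (m + m) * x
    twice = solve-∀

  -- The summand `m + m` accounts for the factor 4 ^ m.
  smallSets≼ : .{{_ : NonZero n}} → ∀ j → length (smallSets n j) ≼ j + (m + m)
  smallSets≼ j = begin
    l * m ^ (j + (m + m)) ≡⟨ cong (l *_) (^-distribˡ-+-* m j (m + m)) ⟩
    l * (m ^ j * m ^ (m + m)) ≡⟨ sym (*-assoc l (m ^ j) _) ⟩
    l * m ^ j * m ^ (m + m) ≤⟨ *-monoˡ-≤ (m ^ (m + m)) (∣smallSets∣≤ n m j m≤n) ⟩
    4 ^ m * n ^ j * m ^ (m + m) ≡⟨ swap (4 ^ m) (n ^ j) (m ^ (m + m)) ⟩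
    n ^ j * (4 ^ m * m ^ (m + m)) ≡⟨ cong (λ x → n ^ j * (x * m ^ (m + m)))
                (trans (^-*-assoc 2 2 m) (cong (λ k → 2 ^ (m + k)) (+-identityʳ m))) ⟩
    n ^ j * (2 ^ (m + m) * m ^ (m + m)) ≤⟨ *-mono-≤ (^-monoˡ-≤ j (m≤n+m n m)) (2^≼ (m + m)) ⟩
    (m + n) ^ j * (m + n) ^ (m + m) ≡⟨ sym (^-distribˡ-+-* (m + n) j (m + m)) ⟩
    (m + n) ^ (j + (m + m)) ∎
    where
    open ≤-Reasoning
    l = length (smallSets n j)
    swap : ∀ a b c → a * b * c ≡ b * (a * c)
    swap = solve-∀

-- Exponents are measured in units of `s`; 2, 16 and 3 are those of `n≼`, `sets≼` and `lists≼`. The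
-- extra 1 of a sum pays for a factor 2, and a constant k is at most 2 ^ k.
exponent coefficient degree : Cost → ℕ
exponent (con k) = k
exponent jobs    = 2
exponent sets    = 16
exponent lists   = 3
exponent (c ⊞ d) = suc (exponent c + exponent d)
exponent (c ⊠ d) = exponent c + exponent d

coefficient (con k) = k
coefficient jobs    = 1
coefficient sets    = 1
coefficient lists   = 1
coefficient (c ⊞ d) = coefficient c + coefficient d
coefficient (c ⊠ d) = coefficient c * coefficient d

degree (con k) = 0
degree jobs    = 1
degree sets    = 1
degree lists   = 0
degree (c ⊞ d) = degree c + degree d
degree (c ⊠ d) = degree c + degree d

-- The sizes are those for m > n, where `⊥` is the only A and at most `suc n` sets are met.
polynomial : ∀ n c → ⟦ c ⟧ (sizes n (suc n) 1) ≤ coefficient c * suc n ^ degree c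
polynomial n (con k) = ≤-reflexive (sym (*-identityʳ k))
polynomial n jobs    = ≤-trans (n≤1+n n) (≤-reflexive (sym (trans (+-identityʳ _) (*-identityʳ _))))
polynomial n sets    = ≤-reflexive (sym (trans (+-identityʳ _) (*-identityʳ _)))
polynomial n lists   = ≤-refl
polynomial n (c ⊞ d) = begin
  ⟦ c ⟧ ρ + ⟦ d ⟧ ρ ≤⟨ +-mono-≤ (polynomial n c) (polynomial n d) ⟩
  a * u ^ i + b * u ^ j ≤⟨ +-mono-≤ (*-monoʳ-≤ a (^-monoʳ-≤ u (m≤m+n i j)))
                (*-monoʳ-≤ b (^-monoʳ-≤ u (m≤n+m j i))) ⟩
  a * u ^ (i + j) + b * u ^ (i + j) ≡⟨ sym (*-distribʳ-+ (u ^ (i + j)) a b) ⟩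
  (a + b) * u ^ (i + j) ∎
  where
  open ≤-Reasoning
  ρ = sizes n (suc n) 1
  u = suc n
  a = coefficient c
  b = coefficient d
  i = degree c
  j = degree d
polynomial n (c ⊠ d) = begin
  ⟦ c ⟧ ρ * ⟦ d ⟧ ρ ≤⟨ *-mono-≤ (polynomial n c) (polynomial n d) ⟩
  a * u ^ i * (b * u ^ j) ≡⟨ *-interchange a (u ^ i) b (u ^ j) ⟩
  a * b * (u ^ i * u ^ j) ≡⟨ cong (a * b *_) (sym (^-distribˡ-+-* u i j)) ⟩
  a * b * u ^ (i + j) ∎
  where
  open ≤-Reasoning
  ρ = sizes n (suc n) 1
  u = suc n
  a = coefficient c
  b = coefficient d
  i = degree c
  j = degree d

-- The exponent O(√(nm)) for m ≤ n

module Subexponential (n m : ℕ) (0<m : 0 < m) (m≤n : m ≤ n) where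

  open Exponents n m m≤n
  open Root (isqrt (n * m)) public renaming (root to s)

  instance
    n≢0 : NonZero n
    n≢0 = >-nonZero (≤-trans 0<m m≤n)

  k h #heads #antichains #members : ℕ
  k = m ∸ 1
  h = (n + suc s) / suc s
  #heads      = length (smallSets n s)
  #antichains = length (smallSets n k)
  #members    = suc #heads * suc #antichains ^ h * suc #antichains

  m≤s : m ≤ s
  m≤s = ≮⇒≥ λ s<m → <⇒≱ <root+1² (≤-trans (*-mono-≤ s<m s<m) (*-monoˡ-≤ m m≤n))

  0<s : 0 < s
  0<s = ≤-trans 0<m m≤s

  deep : ∀ d → d * suc s ≤ n + suc s → d ≤ h
  deep d le = ≤-trans (≤-reflexive (sym (m*n/n≡m d (suc s)))) (/-monoˡ-≤ (suc s) le)

  -- Here the choice of `s` pays off: up to rounding, `m * h` is nm/(s + 1) + m, and nm < (s + 1)²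
  -- bounds it by s + m.
  m*h≤ : m * h ≤ s + s
  m*h≤ = ≤-trans (s≤s⁻¹ (*-cancelʳ-< (suc s) (m * h) (suc (s + m)) (begin-strict
    m * h * suc s ≡⟨ *-assoc m h (suc s) ⟩
    m * (h * suc s) ≤⟨ *-monoʳ-≤ m (m/n*n≤m (n + suc s) (suc s)) ⟩
    m * (n + suc s) ≡⟨ trans (*-distribˡ-+ m n (suc s)) (cong (_+ m * suc s) (*-comm m n)) ⟩
    n * m + m * suc s <⟨ +-monoˡ-< (m * suc s) <root+1² ⟩
    suc s * suc s + m * suc s ≡⟨ sym (*-distribʳ-+ (suc s) (suc s) m) ⟩
    suc (s + m) * suc s ∎))) (+-monoʳ-≤ s m≤s)
    where open ≤-Reasoning

  n≼ : n ≼ 2 * s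
  n≼ = ≼-weaken {n} {2 ^ (2 * s)} {2 * s} (begin
    n ≤⟨ m≤m*n n m {{>-nonZero 0<m}} ⟩
    n * m ≤⟨ <⇒≤ <root+1² ⟩
    suc s * suc s ≤⟨ *-mono-≤ (n<2^n s) (n<2^n s) ⟩
    2 ^ s * 2 ^ s ≡⟨ sym (^-distribˡ-+-* 2 s s) ⟩
    2 ^ (s + s) ≡⟨ cong (λ e → 2 ^ (s + e)) (sym (+-identityʳ s)) ⟩
    2 ^ (2 * s) ∎) (2^≼ (2 * s))
    where open ≤-Reasoning

  suc≼ : ∀ {t e} → 1 ≤ t → t ≼ e → suc t ≼ suc e
  suc≼ {t} {e} 1≤t p = ≼-weaken {suc t} {2 * t} {suc e}
    (≤-trans (+-monoˡ-≤ t 1≤t) (≤-reflexive (cong (t +_) (sym (+-identityʳ t)))))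
    (≼-* {2} {t} {1} {e} (2^≼ 1) p)

  lists≼ : #antichains ≼ 3 * s
  lists≼ = ≼-mono {#antichains}
    (≤-trans (+-mono-≤ (≤-trans (m∸n≤m m 1) m≤s) (+-mono-≤ m≤s m≤s))
             (≤-reflexive (cong (λ e → s + (s + e)) (sym (+-identityʳ s)))))
    (smallSets≼ k)

  antichains≼ : suc #antichains ≼ 3 * m
  antichains≼ = ≼-mono {suc #antichains}
    (≤-reflexive (trans (cong (_+ (m + m)) (m+[n∸m]≡n {1} 0<m)) (cong (λ e → m + (m + e)) (sym (+-identityʳ m)))))
    (suc≼ {e = k + (m + m)} (∣smallSets∣≥1 n k) (smallSets≼ k))

  heads≼ : suc #heads ≼ 4 * s
  heads≼ = ≼-mono {suc #heads}
    (≤-trans (≤-reflexive (sym (+-suc s (m + m))))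
      (+-monoʳ-≤ s (≤-trans (+-mono-≤ {1} 0<s (+-mono-≤ m≤s m≤s))
        (≤-reflexive (cong (λ e → s + (s + e)) (sym (+-identityʳ s)))))))
    (suc≼ {e = s + (m + m)} (∣smallSets∣≥1 n s) (smallSets≼ s))

  sets≼ : #members ≼ 16 * s
  sets≼ = ≼-mono {#members} le
    (≼-* {a * b ^ h} {b} {4 * s + h * (3 * m)} {3 * m}
      (≼-* {a} {b ^ h} {4 * s} {h * (3 * m)} heads≼ (≼-^ {b} {3 * m} h antichains≼)) antichains≼)
    where
    open ≤-Reasoning
    a = suc #heads
    b = suc #antichains
    regroup : ∀ s h m → 4 * s + h * (3 * m) + 3 * m ≡ 4 * s + 3 * (m * h) + 3 * m
    regroup = solve-∀
    total : ∀ s → 4 * s + 3 * (s + s) + 3 * s + 3 * s ≡ 16 * s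
    total = solve-∀
    le : 4 * s + h * (3 * m) + 3 * m ≤ 16 * s
    le = begin
      4 * s + h * (3 * m) + 3 * m ≡⟨ regroup s h m ⟩
      4 * s + 3 * (m * h) + 3 * m ≤⟨ +-mono-≤ (+-monoʳ-≤ (4 * s) (*-monoʳ-≤ 3 m*h≤)) (*-monoʳ-≤ 3 m≤s) ⟩
      -- Starting down-sets, sets A along the way and caps need 13 * s together; the constant 16
      -- leaves a margin of 3 * s.
      4 * s + 3 * (s + s) + 3 * s ≤⟨ m≤m+n _ (3 * s) ⟩
      4 * s + 3 * (s + s) + 3 * s + 3 * s ≡⟨ total s ⟩
      16 * s ∎

  ρ : Sizes
  ρ = sizes n #members #antichains

  cost≼ : ∀ c → ⟦ c ⟧ ρ ≼ exponent c * s
  cost≼ (con x) = ≼-mono {x} (m≤m*n x s {{>-nonZero 0<s}}) (k≼k x)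
  cost≼ jobs    = n≼
  cost≼ sets    = sets≼
  cost≼ lists   = lists≼
  cost≼ (c ⊞ d) = ≼-mono {⟦ c ⟧ ρ + ⟦ d ⟧ ρ}
    (+-mono-≤ 0<s (≤-reflexive (sym (*-distribʳ-+ s (exponent c) (exponent d)))))
    (≼-+ {⟦ c ⟧ ρ} {⟦ d ⟧ ρ} {exponent c * s} {exponent d * s} (cost≼ c) (cost≼ d))
  cost≼ (c ⊠ d) = subst (⟦ c ⟧ ρ * ⟦ d ⟧ ρ ≼_) (sym (*-distribʳ-+ s (exponent c) (exponent d)))
    (≼-* {⟦ c ⟧ ρ} {⟦ d ⟧ ρ} {exponent c * s} {exponent d * s} (cost≼ c) (cost≼ d))

  -- The exponent C * s is at most C √(nm), so each admissible p/q is at least C * s; comparing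
  -- squares gives q * (C * s) ≤ p without real numbers.
  timeBound : ∀ {c t C} → exponent c ≤ C → t ≤ ⟦ c ⟧ ρ → TimeBound 1 C n m t
  timeBound {c} {t} {C} e≤C t≤ p q _ le = begin
    t ^ q * m ^ p ≤⟨ ≼-mono {t ^ q} q*e≤p (≼-^ {t} {C * s} q
                (≼-weaken {t} {⟦ c ⟧ ρ} {C * s} t≤ (≼-mono {⟦ c ⟧ ρ} (*-monoˡ-≤ s e≤C) (cost≼ c)))) ⟩
    (m + n) ^ p ≡⟨ sym (trans (cong (_* (m + n) ^ p) (1^ q)) (+-identityʳ _)) ⟩
    1 ^ q * (m + n) ^ p ∎
    where
    open ≤-Reasoning
    squared : ∀ q C s → q * (C * s) * (q * (C * s) * 1) ≡ C * (C * 1) * (s * s) * (q * (q * 1))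
    squared = solve-∀
    q*e≤p : q * (C * s) ≤ p
    q*e≤p = ^2-cancel-≤ (≤-trans (≤-reflexive (squared q C s))
      (≤-trans (*-monoˡ-≤ (q ^ 2) (*-monoʳ-≤ (C ^ 2) root²≤)) le))

constantFor : Cost → ℕ
constantFor c = exponent c + (coefficient c + degree c)

exponent≤ : ∀ c → exponent c ≤ constantFor c
exponent≤ c = m≤m+n (exponent c) (coefficient c + degree c)

coefficient≤ : ∀ c → coefficient c ≤ constantFor c
coefficient≤ c = ≤-trans (m≤m+n (coefficient c) (degree c)) (m≤n+m (coefficient c + degree c) (exponent c))

degree≤ : ∀ c → degree c ≤ constantFor c
degree≤ c = ≤-trans (m≤n+m (degree c) (coefficient c)) (m≤n+m (coefficient c + degree c) (exponent c))

-- Abstract, lest type checking unfold these large numerals.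

abstract

  constant : ℕ
  constant = constantFor (cost main)

  exponent≤constant : exponent (cost main) ≤ constant
  exponent≤constant = exponent≤ (cost main)

  coefficient≤constant : coefficient (cost main) ≤ constant
  coefficient≤constant = coefficient≤ (cost main)

  degree≤constant : degree (cost main) ≤ constant
  degree≤constant = degree≤ (cost main)

-- All of the time goes into the factor `K`; the power of 1 + n/m is used only as a number of at
-- least 1.
polynomial-timeBound : ∀ {n m t K} C → t ≤ K → TimeBound K C n m t
polynomial-timeBound {n} {m} C t≤K p q _ _ = *-mono-≤ (^-monoˡ-≤ q t≤K) (^-monoˡ-≤ p (m≤m+n m n))

maxSize-≤ : ∀ {n m} → m ≤ n → maxSize n m ≡ m ∸ 1
maxSize-≤ {n} {m} m≤n with m ∸ n in eq
... | zero  = refl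
... | suc _ = case trans (sym eq) (m≤n⇒m∸n≡0 m≤n) of λ ()

maxSize-> : ∀ {n m} → n < m → maxSize n m ≡ 0
maxSize-> {n} {m} n<m with m ∸ n in eq
... | zero  = ⊥-elim (<⇒≱ n<m (m∸n≡0⇒m≤n eq))
... | suc _ = refl

-- Both ranges of m together

module Final (I : Instance) where

  open Instance I renaming (jobs to n; machines to m)
  open Scheduling _≺_ isOrder m
  open Decomposition _≺_ isOrder m
  open Families _≺_ isOrder m
  open Correspondence I
  open Tables _≺_ isOrder m

  0<m : 0 < m
  0<m = >-nonZero⁻¹ m {{machines≢0}}

  Solved : Sizes → Set
  Solved ρ = ∃[ σ ] ∃[ t ] (⟨ erase main , input I ⟩⇓⟨ σ , t ⟩
             × IsMinimumMakespan I (output σ) × t ≤ ⟦ cost main ⟧ ρ)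

  extract : ∀ {ρ} {Q : State → Set} → Logic.Run ρ main (input I) Q →
            (∀ {τ} → Q τ → IsMinimumMakespan I (regs τ 0)) → Solved ρ
  extract (Logic.run {final} {time} executes time-bound post) f = final , time , executes , f post , time-bound

  solved : ∀ ρ {K} → maxSize n m ≡ K → n ≤ #jobs ρ → length (grown n K) ≤ #lists ρ →
           Family (grown n K) (#sets ρ) → K ≤ m →
           (∀ {ℓ X} → Nonempty X → Sch ℓ X → ∃[ A ] (A ∈ₗ grown n K × Split ℓ X A)) → Solved ρ
  solved ρ refl n≤ #As family K≤m splits = extract
    (Execution.main-spec I ρ n≤ 0<m #As Good good-start (good-visits (λ A∈ → A∈))
      (λ _ vs → let open _⊑_ (⊑-visits vs) in appended , extends) good-bounded)
    λ (T , sws , eq) → let (s , least) = optimal sws in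
      subst (IsMinimumMakespan I) (sym eq) (Sch⇒HasSchedule s , λ M h → least (HasSchedule⇒Sch h))
    where
    open Correctness _≺_ isOrder m 0<m
    open Search (grown n (maxSize n m)) family (λ A∈ → ≤-trans (grown-small A∈) K≤m) splits

  solved-≤ : (m≤n : m ≤ n) → Solved (Subexponential.ρ n m 0<m m≤n)
  solved-≤ m≤n = solved ρ (maxSize-≤ m≤n) ≤-refl (∣grown∣≤ n k) (Layers.layered s k h deep) (m∸n≤m m 1)
    λ ne sch → case split 0<m sch ne of λ (A , small , sp) →
      A , ∈-grown A (s≤s⁻¹ (≤-trans small (≤-reflexive (sym (m+[n∸m]≡n {1} 0<m))))) , sp
    where open Subexponential n m 0<m m≤n

  solved-> : n < m → Solved (sizes n (suc n) 1)
  solved-> n<m = solved (sizes n (suc n) 1) (maxSize-> n<m) ≤-refl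
    (≤-trans (∣grown∣≤ n 0) (≤-reflexive (∣smallSets-0∣ n))) Levels.levelled z≤n
    λ ne sch → ⊥ , ∈-grown ⊥ (≤-reflexive (∣⊥∣≡0 n)) , split-⊥ (<⇒≤ n<m) sch ne

  result : ∃[ σ ] ∃[ t ] (⟨ erase main , input I ⟩⇓⟨ σ , t ⟩
           × IsMinimumMakespan I (output σ) × RunsInTime constant n m t)
  result with m ≤? n
  ... | yes m≤n with solved-≤ m≤n
  ...   | σ , t , ex , opt , t≤ = σ , t , ex , opt ,
    (λ _ → Subexponential.timeBound n m 0<m m≤n {cost main} exponent≤constant t≤) ,
    λ n<m → ⊥-elim (<⇒≱ n<m m≤n)
  result | no m≰n with solved-> (≰⇒> m≰n)
  ...   | σ , t , ex , opt , t≤ = σ , t , ex , opt ,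
    (λ m≤n → ⊥-elim (m≰n m≤n)) ,
    λ _ → polynomial-timeBound constant (≤-trans t≤ (≤-trans (polynomial n (cost main))
      (*-mono-≤ coefficient≤constant (^-monoʳ-≤ (suc n) degree≤constant))))

theorem1p1 : ∃[ P ] ∃[ C ] ((I : Instance) →
    ∃[ σ ] ∃[ t ]
    (⟨ P , input I ⟩⇓⟨ σ , t ⟩
    × IsMinimumMakespan I (output σ)
    × RunsInTime C (Instance.jobs I) (Instance.machines I) t))
theorem1p1 = erase main , constant , Final.result
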